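{- Let $H=(V,E)$ be the hexagonal graph, let $$X=\mathbb{Z}^2\backslash\{(p,q)\;|\;p\le 0,\;p-1\le q\le 1-p\}\subset V$$ be the slit plane domain and let $a=(0,0)(1,0)\in\partial X$. Let $\zeta=\exp(2\pi i/6)$ and, for $j\in\{0,1,\dots,7\}$, $y_j=\exp(2\pi i(6j+1)/48)$. For each $l\in\{0,1,\dots,5\}$ and $k\in\{0,1,\dots,47\}$ consider the generating function $$G_{l,k}(x)=\sum_{\ell(w)=\zeta^l,\;r(w)\equiv k\;(\mathrm{mod}\;48)}x^{|w|},$$ where the sum is over the self-avoiding walks $w$ in $H$ that start in $a$ (first vertex $(0,0)$, first edge $a$) and have all vertices but the first in $X$. Then for each $j\in\{0,1,\dots,7\}$ we have in $\mathbb{C}[[x]]$ the formal identity $$\frac{x}{1+2\,\mathrm{Re}(\zeta^4y_j)\,x}=-\sum_{l=0}^{5}\sum_{k=0}^{47}\zeta^l y_j^k\,G_{l,k}(x).$$ Moreover (as follows from the case $j=7$), $G_{l,k}(x_c)=+\infty$ for some $l,k$, where $x_c=\frac{1}{2\cos(\pi/8)}$.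
   Context: **Hexagonal graph.** $H=(V,E)$ is the plane graph with $V=\mathbb{Z}\times\mathbb{Z}\subset\mathbb{R}^2$, whose edges are all vertical unit segments $(p,q)(p,q+1)$ and those horizontal unit segments $(p,q)(p+1,q)$ with $p\equiv q \pmod 2$. It is a cubic graph isomorphic to the hexagonal lattice graph. For $X\subset V$, $\partial X$ is the set of edges with exactly one endvertex in $X$. **Walks.** A walk in $H$ is a sequence $w=(v_1,e_1,v_2,e_2,\dots,e_n,v_{n+1})$ with $n\ge 1$, $e_j=v_jv_{j+1}\in E$ and $e_j\neq e_{j+1}$ (no backtracks); $|w|=n$ is its length. A self-avoiding walk (SAW) is a walk with all $v_j$ distinct. **Directions $\ell$.** An oriented edge is a pair $(e,v)$ with $v$ an endvertex of $e$, thought of as $e$ oriented away from $v$. The basic orientation of an edge is left-to-right (horizontal edges) or bottom-to-top (vertical edges). Let $\ell_b(e)=1$ for horizontal $e$, and for vertical $e$ let $\ell_b(e)=\zeta$ (resp. $\zeta^2$) if the top vertex of $e$ is incident with a horizontal edge going to the right (resp. to the left). Put $\ell(e,v)=\ell_b(e)$ if $(e,v)$ is oriented as in the basic orientation and $\ell(e,v)=-\ell_b(e)$ otherwise. For a walk $w$ with final vertex $v_{n+1}$ and final edge $e_n$, $\ell(w)=\ell(e_n,v_{n+1})$, i.e. the final edge is oriented oppositely to the direction of the walk. **Winding number $r$.** A hook is a SAW $(v_1,e_1,v_2,e_2,v_3)$ of length $2$. It is a left hook, of weight $+1$, if it turns left (i.e. $e_2$ comes immediately clockwise after $e_1$ around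 $v_2$), and a right hook, of weight $-1$, if it turns right ($e_2$ comes immediately counter-clockwise after $e_1$). For a walk $w=(v_1,e_1,\dots,e_n,v_{n+1})$, $r(w)\in\mathbb{Z}$ is the sum of the weights of the hooks $(v_i,e_i,v_{i+1},e_{i+1},v_{i+2})$, $1\le i\le n-1$ (so $r(w)=0$ if $|w|=1$). $G_{l,k}(x_c)=+\infty$ means that the power series $G_{l,k}$, which has nonnegative coefficients, diverges at the positive real number $x_c$. -}

module Defs where

open import Algebra.Bundles using (CommutativeRing; Semiring)
open import Algebra.Bundles.Raw using (RawRing)
open import Data.Bool.Base using (if_then_else_)
open import Data.Fin.Base as Fin using (Fin; toℕ)
open import Data.Integer.Base as ℤ using (ℤ; +_; 0ℤ; 1ℤ; -1ℤ)
import Data.Integer.Divisibility.Signed as ℤ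
import Data.Integer.Properties as ℤ
open import Data.List.Base using (List; []; _∷_; [_]; _++_; map; concatMap; filter; length; drop; take; zip)
open import Data.List.Relation.Unary.All using (All; all?)
open import Data.Nat.Base as ℕ using (ℕ; zero; suc)
import Data.Nat.Properties as ℕ
open import Data.Product.Base using (∃; _×_; _,_)
open import Data.Product.Properties using (≡-dec)
open import Data.Sum.Base using (_⊎_)
open import Data.Vec.Functional as Vector using (Vector)
open import Level using (Level; _⊔_) renaming (suc to lsuc)
open import Relation.Binary.Core using (Rel)
open import Relation.Binary.Definitions using (DecidableEquality)
open import Relation.Binary.PropositionalEquality using (_≡_)
open import Relation.Binary.Structures using (IsStrictTotalOrder)
open import Relation.Nullary.Decidable using (Dec; does; ¬?; _×-dec_; _⊎-dec_)
open import Relation.Nullary.Negation using (¬_)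
import Algebra.Definitions.RawSemiring
import Data.List.Membership.DecPropositional
import Data.List.Relation.Unary.Unique.DecPropositional
import Data.List.Relation.Unary.Unique.Propositional

infix 4 _≅_[mod_] _≅?_[mod_]

_≅_[mod_] : ℤ → ℤ → ℕ → Set
x ≅ y [mod m ] = (+ m) ℤ.∣ (x ℤ.- y)

_≅?_[mod_] : ∀ x y m → Dec (x ≅ y [mod m ])
x ≅? y [mod m ] = (+ m) ℤ.∣? (x ℤ.- y)

V : Set
V = ℤ × ℤ

infix 4 _≟ⱽ_

_≟ⱽ_ : DecidableEquality V
_≟ⱽ_ = ≡-dec ℤ._≟_ ℤ._≟_

up right down left : V → V
up    (p , q) = p , q ℤ.+ 1ℤ
right (p , q) = p ℤ.+ 1ℤ , q
down  (p , q) = p , q ℤ.- 1ℤ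
left  (p , q) = p ℤ.- 1ℤ , q

-- Edges uv in the basic orientation, from u to v.

Vertical Horizontal Basic : Rel V _
Vertical   u         v = v ≡ up u
Horizontal u@(p , q) v = v ≡ right u × p ≅ q [mod 2 ]
Basic      u         v = Vertical u v ⊎ Horizontal u v

Adj : Rel V _
Adj u v = Basic u v ⊎ Basic v u

vertical? : ∀ u v → Dec (Vertical u v)
vertical? u v = v ≟ⱽ up u

horizontal? : ∀ u v → Dec (Horizontal u v)
horizontal? u@(p , q) v = (v ≟ⱽ right u) ×-dec (p ≅? q [mod 2 ])

basic? : ∀ u v → Dec (Basic u v)
basic? u v = vertical? u v ⊎-dec horizontal? u v

adj? : ∀ u v → Dec (Adj u v)
adj? u v = basic? u v ⊎-dec basic? v u

-- Listed in clockwise order around v, which `LeftHook` relies on.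

neighbours : V → List V
neighbours v = filter (adj? v) (up v ∷ right v ∷ down v ∷ left v ∷ [])

-- All values of ℓ are sixth roots of unity; ζᵉ is represented by its
-- exponent e ∈ {0,…,5}.  As ζ³ = -1, negation adds 3 to the exponents
-- 0, 1, 2 taken by ℓ_b.

ℓᵇ : V → V → ℕ
ℓᵇ u v =
  if does (vertical? u v)
  then (if does (adj? v (right v)) then 1 else 2)
  else 0

-- The edge uv oriented from u to v.

ℓ : V → V → ℕ
ℓ u v = if does (basic? u v) then ℓᵇ u v else 3 ℕ.+ ℓᵇ v u

-- H is simple, so a walk is given by the list v₁, …, vₙ₊₁ of its
-- vertices.

-- The final edge is oriented from vₙ₊₁ to vₙ.

direction : List V → ℕ
direction (u ∷ v ∷ [])       = ℓ v u
direction (_ ∷ w@(_ ∷ _ ∷ _)) = direction w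
direction _                  = 0 -- not a walk of positive length

-- Consecutive pairs of the cyclic list of neighbours of v.

clockwise : V → List (V × V)
clockwise v = zip ns (drop 1 ns ++ take 1 ns)
  where ns = neighbours v

open Data.List.Membership.DecPropositional (≡-dec _≟ⱽ_ _≟ⱽ_) using (_∈_; _∈?_)
open Data.List.Relation.Unary.Unique.Propositional {A = V} using (Unique)
open Data.List.Relation.Unary.Unique.DecPropositional _≟ⱽ_ using (unique?)

-- The edge vw comes immediately clockwise after the edge uv around v.

LeftHook : V → V → V → Set
LeftHook u v w = (u , w) ∈ clockwise v

leftHook? : ∀ u v w → Dec (LeftHook u v w)
leftHook? u v w = (u , w) ∈? clockwise v

-- H is cubic, so a hook that is not a left hook is a right hook.

weight : V → V → V → ℤ
weight u v w = if does (leftHook? u v w) then 1ℤ else -1ℤ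

winding : List V → ℤ
winding (u ∷ vs@(v ∷ w ∷ _)) = weight u v w ℤ.+ winding vs
winding _                    = 0ℤ

-- All paths with n edges starting at v, backtracking allowed.

paths : ℕ → V → List (List V)
paths zero    v = [ [ v ] ]
paths (suc n) v = map (v ∷_) (concatMap (paths n) (neighbours v))

X : V → Set
X (p , q) = ¬ (p ℤ.≤ 0ℤ × p ℤ.- 1ℤ ℤ.≤ q × q ℤ.≤ 1ℤ ℤ.- p)

X? : ∀ v → Dec (X v)
X? (p , q) =
  ¬? ((p ℤ.≤? 0ℤ) ×-dec (p ℤ.- 1ℤ ℤ.≤? q) ×-dec (q ℤ.≤? 1ℤ ℤ.- p))

-- Self-avoidance excludes backtracks.

SlitSAW : List V → Set
SlitSAW w = Unique w × All X (drop 1 w)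

slitSAW? : ∀ w → Dec (SlitSAW w)
slitSAW? w = unique? w ×-dec all? X? (drop 1 w)

-- The walks of length n with first edge a = (0,0)(1,0).

slitSAWs : ℕ → List (List V)
slitSAWs zero    = []
slitSAWs (suc n) =
  filter slitSAW? (map ((0ℤ , 0ℤ) ∷_) (paths n (1ℤ , 0ℤ)))

Counted : Fin 6 → Fin 48 → List V → Set
Counted l k w = direction w ≡ toℕ l × winding w ≅ + toℕ k [mod 48 ]

counted? : ∀ l k w → Dec (Counted l k w)
counted? l k w =
  (direction w ℕ.≟ toℕ l) ×-dec (winding w ≅? + toℕ k [mod 48 ])

-- The coefficient of xⁿ in G_{l,k}.

G : Fin 6 → Fin 48 → ℕ → ℕ
G l k n = length (filter (counted? l k) (slitSAWs n))

module PowerSeries {c e} (A : RawRing c e) where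
  open RawRing A
  open Algebra.Definitions.RawSemiring rawSemiring using (sum)

  const : Carrier → ℕ → Carrier
  const a zero    = a
  const a (suc _) = 0#

  x : ℕ → Carrier
  x (suc zero) = 1#
  x _          = 0#

  ⟦x⟧ : RawRing c e
  ⟦x⟧ = record
    { Carrier = ℕ → Carrier
    ; _≈_     = λ f g → ∀ n → f n ≈ g n
    ; _+_     = λ f g n → f n + g n
    ; _*_     = λ f g n → sum {suc n} λ i → f (toℕ i) * g (n ℕ.∸ toℕ i)
    ; -_      = λ f n → - f n
    ; 0#      = const 0#
    ; 1#      = const 1#
    }

  -- The inverse of a power series f with constant term 1: its
  -- coefficients satisfy cₙ₊₁ = - Σ_{i ≤ n} fᵢ₊₁ cₙ₋ᵢ.  The vector
  -- `inverseCoefficients f n` is cₙ, …, c₀.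

  inverseCoefficients : (ℕ → Carrier) → ∀ n → Vector Carrier (suc n)
  inverseCoefficients f zero    = λ _ → 1#
  inverseCoefficients f (suc n) = (- sum λ i → f (suc (toℕ i)) * cs i) Vector.∷ cs
    where cs = inverseCoefficients f n

  inverse : (ℕ → Carrier) → ℕ → Carrier
  inverse f n = inverseCoefficients f n Fin.zero

-- The ordered field of real numbers, up to isomorphism: a totally
-- ordered field with suprema.  This is the classical structure: since
-- the order is trichotomous and `sup` applies to every predicate, it
-- entails excluded middle, so existence statements about real numbers
-- have their classical strength.
--
-- cos, sin and π are given by the classical axioms that determine them
-- uniquely on ℝ: the addition theorems and the unit circle equation make
-- θ ↦ cos θ + i sin θ a homomorphism to the unit circle, `sin-π` and
-- `sin-pos` make π its half period, and the last two inequalities, which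
-- give lim_{θ→0} sin θ / θ = 1, fix the unit of angle.

record RealNumbers (c ℓ₁ ℓ₂ : Level) : Set (lsuc (c ⊔ ℓ₁ ⊔ ℓ₂)) where
  field
    commutativeRing : CommutativeRing c ℓ₁

  open CommutativeRing commutativeRing public

  infix  4 _<_ _≤_
  infix  9 _⁻¹

  field
    _<_                : Rel Carrier ℓ₂
    isStrictTotalOrder : IsStrictTotalOrder _≈_ _<_
    0<1                : 0# < 1#
    +-monoˡ-<          : ∀ z {x y} → x < y → x + z < y + z
    *-pos              : ∀ {x y} → 0# < x → 0# < y → 0# < x * y

    -- The value at 0# is irrelevant.
    _⁻¹        : Carrier → Carrier
    *-inverseʳ : ∀ {x} → ¬ x ≈ 0# → x * x ⁻¹ ≈ 1#

  _≤_ : Rel Carrier ℓ₂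
  x ≤ y = ¬ y < x

  field
    sup : (P : Carrier → Set (c ⊔ ℓ₁ ⊔ ℓ₂)) →
          ∃ P →
          (∃ λ b → ∀ x → P x → x ≤ b) →
          ∃ λ s → (∀ x → P x → x ≤ s) ×
                  (∀ y → y < s → ∃ λ x → P x × y < x)

    cos sin  : Carrier → Carrier
    cos-cong : ∀ {x y} → x ≈ y → cos x ≈ cos y
    sin-cong : ∀ {x y} → x ≈ y → sin x ≈ sin y
    cos-+    : ∀ x y → cos (x + y) ≈ cos x * cos y - sin x * sin y
    sin-+    : ∀ x y → sin (x + y) ≈ sin x * cos y + cos x * sin y
    cos²+sin²≈1 : ∀ x → cos x * cos x + sin x * sin x ≈ 1#

    π       : Carrier
    0<π     : 0# < π
    sin-π   : sin π ≈ 0#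
    sin-pos : ∀ x → 0# < x → x < π → 0# < sin x
    sinx<x  : ∀ x → 0# < x → x < π → sin x < x
    xcosx<sinx : ∀ x → 0# < x → x < π → x * cos x < sin x

module Analysis {c ℓ₁ ℓ₂} (ℝ : RealNumbers c ℓ₁ ℓ₂) where

  open RealNumbers ℝ
  open Algebra.Definitions.RawSemiring (Semiring.rawSemiring semiring)
    using (sum; _^_) renaming (_×_ to _·_)

  fromℕ : ℕ → Carrier
  fromℕ n = n · 1#

  infixl 7 _/_

  _/_ : Carrier → Carrier → Carrier
  x / y = x * y ⁻¹

  -- For a series with nonnegative coefficients g and x > 0.

  DivergesAt : (ℕ → ℕ) → Carrier → Set (c ⊔ ℓ₂)
  DivergesAt g x =
    ∀ M → ∃ λ N → M < sum {N} λ n → fromℕ (g (toℕ n)) * x ^ toℕ n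

  xᶜ : Carrier
  xᶜ = 1# / (fromℕ 2 * cos (π / fromℕ 8))

  infix 5 _+i_

  record Complex : Set c where
    constructor _+i_
    field
      re im : Carrier

  open Complex public

  ℂ : RawRing c ℓ₁
  ℂ = record
    { Carrier = Complex
    ; _≈_     = λ z w → re z ≈ re w × im z ≈ im w
    ; _+_     = λ z w → re z + re w +i im z + im w
    ; _*_     = λ z w → re z * re w - im z * im w +i re z * im w + im z * re w
    ; -_      = λ z → - re z +i - im z
    ; 0#      = 0# +i 0#
    ; 1#      = 1# +i 0#
    }

  fromℝ : Carrier → Complex
  fromℝ x = x +i 0#

  2Re : Complex → Carrier
  2Re z = fromℕ 2 * re z

  -- exp(iθ), by Euler's formula.

  expi : Carrier → Complex
  expi θ = cos θ +i sin θ

  ζ : Complex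
  ζ = expi (fromℕ 2 * π / fromℕ 6)

  y : Fin 8 → Complex
  y j = expi (fromℕ 2 * π * fromℕ (6 ℕ.* toℕ j ℕ.+ 1) / fromℕ 48)

  module ℂ where
    open RawRing ℂ public
    open Algebra.Definitions.RawSemiring rawSemiring public using (_^_)

  module ℂ⟦x⟧ where
    open PowerSeries ℂ public
    open RawRing ⟦x⟧ public
    open Algebra.Definitions.RawSemiring rawSemiring public using (sum)

  fromCounts : (ℕ → ℕ) → ℕ → Complex
  fromCounts g n = fromℝ (fromℕ (g n))

{-# OPTIONS --safe #-}

-- Since ζ = y⁸ and y²⁴ = -1 for y = y j, the weight ζ^ℓ(w) y^r(w) of a walk w
-- is a power of y, with exponent 8 ℓ(w) + r(w).  Extending each walk of length
-- n by its two possible next edges multiplies the sum of the weights by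
-- -2 Re (ζ⁴ y).  The extensions that are not among the walks of length n + 1
-- cancel in pairs: one that closes a loop is paired with the one that runs
-- through this loop backwards, and one that leaves X with its mirror image.
-- This requires the winding numbers of loops and of walks that leave X.  They
-- are found by Hopf's proof of the Umlaufsatz in the brick wall drawing of H:
-- the edges of a walk rotate as much as its secants, and the secants are
-- under control because the slit prevents them from turning around.
--
-- For j = 7 it follows that there are at least (2 cos (π / 8))ⁿ⁻¹ walks of
-- length n, so that the sum of the 6 · 48 series diverges at x_c.

module Submission where

open import Defs
open import Algebra.Bundles using (AbelianGroup; CommutativeRing; Semiring)
open import Algebra.Bundles.Raw using (RawRing)
import Algebra.Definitions.RawSemiring
import Algebra.Properties.CommutativeMonoid.Sum
import Algebra.Properties.CommutativeSemigroup
import Algebra.Properties.Ring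
import Algebra.Properties.Semiring.Exp
import Algebra.Properties.Semiring.Mult
import Algebra.Properties.Semiring.Sum
import Algebra.Solver.Ring.NaturalCoefficients.Default
open import Algebra.Structures using (IsCommutativeRing)
open import Data.Bool.Base using (Bool; not; true; false; if_then_else_)
open import Data.Empty using (⊥; ⊥-elim)
open import Data.Fin.Base as Fin using (Fin; toℕ; fromℕ<)
open import Data.Fin.Patterns using (0F; 1F; 2F; 3F; 4F; 5F; 6F; 7F)
import Data.Fin.Properties as Fin
open import Data.Integer.Base as ℤ using (ℤ; +_; -[1+_]; 0ℤ; 1ℤ; -1ℤ)
import Data.Integer.DivMod as ℤ
import Data.Integer.Divisibility.Signed as ℤ
import Data.Integer.Properties as ℤ
open import Data.Integer.Tactic.RingSolver using (solve-∀)
open import Data.List.Base using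
  (List; []; _∷_; _++_; _∷ʳ_; map; filter; zip; drop; take; reverse; initLast; _∷ʳ′_; length
  ; concatMap; [_]; foldr)
import Data.List.Membership.DecPropositional
open import Data.List.Membership.Propositional using (_∈_; _∉_; find; lose)
open import Data.List.Membership.Propositional.Properties using
  (∈-map⁺; ∈-map⁻; ∈-∃++; ∈-filter⁺; ∈-filter⁻; ∈-++⁺ʳ; ∈-concatMap⁺; ∈-concatMap⁻)
import Data.List.Properties as List
open import Data.List.Relation.Binary.Permutation.Propositional as ↭ using
  (_↭_; prep; ↭-refl; ↭-sym; ↭-trans; ↭⇒↭ₛ)
open import Data.List.Relation.Binary.Permutation.Propositional.Properties using
  (All-resp-↭; ↭-reverse; ↭-length; shift; ∈-resp-↭)
import Data.List.Relation.Binary.Permutation.Setoid.Properties as ↭ₛ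
open import Data.List.Relation.Unary.All as All using (All; []; _∷_)
import Data.List.Relation.Unary.All.Properties as All
open import Data.List.Relation.Unary.AllPairs using (AllPairs; []; _∷_)
open import Data.List.Relation.Unary.Any using (here; there)
open import Data.List.Relation.Unary.Linked as Linked using (Linked; []; [-]; _∷_)
import Data.List.Relation.Unary.Linked.Properties as Linked
open import Data.List.Relation.Unary.Unique.Propositional using (Unique)
import Data.List.Relation.Unary.Unique.Propositional.Properties as Unique
open import Data.Nat.Base as ℕ using (ℕ; zero; suc)
import Data.Nat.DivMod as ℕ
import Data.Nat.Divisibility as ℕ
import Data.Nat.Properties as ℕ
open import Data.Nat.Tactic.RingSolver using () renaming (solve-∀ to ℕ-solve-∀)
open import Data.Product.Base using (_×_; _,_; proj₁; proj₂; ∃; uncurry; ∃₂)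
open import Data.Product.Properties using (≡-dec)
open import Data.Sum.Base using (_⊎_; inj₁; inj₂; swap; [_,_]′; fromInj₂)
open import Data.Vec.Functional using (Vector)
open import Function.Base using (_∘_; case_of_)
open import Level using (_⊔_; Lift; lift)
open import Relation.Binary.Core using (Rel)
open import Relation.Binary.Definitions using (DecidableEquality; tri<; tri≈; tri>)
open import Relation.Binary.PropositionalEquality using
  (_≡_; _≢_; refl; sym; trans; cong; cong₂; subst; subst₂; module ≡-Reasoning)
open import Relation.Binary.PropositionalEquality.Properties using () renaming (setoid to ≡-setoid)
import Relation.Binary.Reasoning.Setoid
open import Relation.Binary.Structures using (IsEquivalence; IsStrictTotalOrder)
open import Relation.Nullary.Decidable using
  (Dec; map′; from-yes; ¬?; _→-dec_; _⊎-dec_; _×-dec_; yes; no; does; dec-true; dec-false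
  ; decidable-stable)
open import Relation.Nullary.Negation using (¬_; contradiction)
open import Algebra.Properties.Group (AbelianGroup.group ℤ.+-0-abelianGroup) using (∙-cancelʳ)

open Data.List.Membership.DecPropositional _≟ⱽ_ using () renaming (_∈?_ to _∈ⱽ?_)

-- Both cancellations impose the same condition on `y`. A walk that enters the slit from above or
-- below has winding number 4 or -4 and final direction ζ or ζ⁵, so mirror images cancel if ζ y⁴ +
-- ζ⁵ y⁻⁴ = 0, that is, y⁸ = ζ. Reversing a loop changes the winding number by 8 and the direction
-- by two sixths of a turn in the same sense. The factor is ζ² y⁸ or its inverse, which is -1 under
-- the same condition. The numbers `y j` are the eight roots of y⁸ = ζ. A left turn multiplies the
-- weight by ζ y = y⁹ and a right turn by the inverse; as ζ = -ζ⁴, these add up to -2 Re (ζ⁴ y).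
-- Both winding numbers rest on one property of the slit: the ray to the west of each of its points
-- stays inside it. Seen from the slit, no vertex of X is in the west, so that the octant number has
-- a branch along the whole walk and a sweep depends only on its two ends. Turnings are compared as
-- integers, not modulo a full turn.

ℤ-+-congˡ : ∀ i {j k : ℤ} → j ≡ k → i ℤ.+ j ≡ i ℤ.+ k
ℤ-+-congˡ i = cong (λ j → i ℤ.+ j)

-- Octants and bearings

-- The octant of a nonzero vector, counted counterclockwise: the open half
-- axes have even numbers, the open quadrants odd ones.

octant : ℤ → ℤ → Fin 8
octant (+ suc _)  (+ zero)   = 0F
octant (+ suc _)  (+ suc _)  = 1F
octant (+ zero)   (+ suc _)  = 2F
octant -[1+ _ ]   (+ suc _)  = 3F
octant -[1+ _ ]   (+ zero)   = 4F
octant -[1+ _ ]   -[1+ _ ]   = 5F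
octant (+ zero)   -[1+ _ ]   = 6F
octant (+ suc _)  -[1+ _ ]   = 7F
octant (+ zero)   (+ zero)   = 0F -- irrelevant

bearing : V → V → Fin 8
bearing (p , q) (p′ , q′) = octant (p′ ℤ.- p) (q′ ℤ.- q)

opposite : Fin 8 → Fin 8
opposite 0F = 4F
opposite 1F = 5F
opposite 2F = 6F
opposite 3F = 7F
opposite 4F = 0F
opposite 5F = 1F
opposite 6F = 2F
opposite 7F = 3F

gap : Fin 8 → Fin 8 → ℕ
gap i j = (8 ℕ.+ toℕ j ℕ.∸ toℕ i) ℕ.% 8

-- The signed number of octants from i to j, if i and j are near.

κ : Fin 8 → Fin 8 → ℤ
κ i j with gap i j
... | 1 = 1ℤ
... | 7 = -1ℤ
... | _ = 0ℤ

record Near (i j : Fin 8) : Set where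
  constructor near
  field gap-small : gap i j ≡ 0 ⊎ gap i j ≡ 1 ⊎ gap i j ≡ 7

near? : ∀ i j → Dec (Near i j)
near? i j = map′ near Near.gap-small
  ((gap i j ℕ.≟ 0) ⊎-dec (gap i j ℕ.≟ 1) ⊎-dec (gap i j ℕ.≟ 7))

near-sym : ∀ i j → Near i j → Near j i
near-sym = from-yes (Fin.all? λ i → Fin.all? λ j → near? i j →-dec near? j i)

near-opposite : ∀ i j → Near i j → Near (opposite i) (opposite j)
near-opposite = from-yes (Fin.all? λ i → Fin.all? λ j →
  near? i j →-dec near? (opposite i) (opposite j))

κ-sym : ∀ i j → κ j i ≡ ℤ.- κ i j
κ-sym = from-yes (Fin.all? λ i → Fin.all? λ j → κ j i ℤ.≟ ℤ.- κ i j)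

κ-opposite : ∀ i j → κ (opposite i) (opposite j) ≡ κ i j
κ-opposite = from-yes (Fin.all? λ i → Fin.all? λ j → κ (opposite i) (opposite j) ℤ.≟ κ i j)

-- Around a square the values of κ add up to a multiple of 8 of absolute
-- value at most 4.

κ-square : ∀ i j → Near i j → ∀ k → Near j k → ∀ l → Near i l → Near l k →
           κ i j ℤ.+ κ j k ≡ κ i l ℤ.+ κ l k
κ-square = from-yes (Fin.all? λ i → Fin.all? λ j → near? i j →-dec Fin.all? λ k →
  near? j k →-dec Fin.all? λ l → near? i l →-dec near? l k →-dec
  (κ i j ℤ.+ κ j k ℤ.≟ κ i l ℤ.+ κ l k))

-- The branch of the octant number that is cut along the west half axis.

principal : Fin 8 → ℤ
principal 5F = -[1+ 2 ]
principal 6F = -[1+ 1 ]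
principal 7F = -[1+ 0 ]
principal i  = + toℕ i

κ-principal : ∀ i j → Near i j → i ≢ 4F → j ≢ 4F → κ i j ≡ principal j ℤ.- principal i
κ-principal = from-yes (Fin.all? λ i → Fin.all? λ j → near? i j →-dec
  ¬? (i Fin.≟ 4F) →-dec ¬? (j Fin.≟ 4F) →-dec (κ i j ℤ.≟ principal j ℤ.- principal i))

-- An integer coordinate cannot change its sign without vanishing. As the open half axes are octants
-- of their own, a unit step leads to the same or an adjacent octant, unless it starts or ends at
-- the origin.
octant-right : ∀ x y → ¬ (x ≡ 0ℤ × y ≡ 0ℤ) → ¬ (x ℤ.+ 1ℤ ≡ 0ℤ × y ≡ 0ℤ) →
               Near (octant x y) (octant (x ℤ.+ 1ℤ) y)
octant-right (+ zero)      (+ zero)   n _ = contradiction (refl , refl) n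
octant-right (+ zero)      (+ suc _)  _ _ = from-yes (near? 2F 1F)
octant-right (+ zero)      -[1+ _ ]   _ _ = from-yes (near? 6F 7F)
octant-right (+ suc _)     (+ zero)   _ _ = from-yes (near? 0F 0F)
octant-right (+ suc _)     (+ suc _)  _ _ = from-yes (near? 1F 1F)
octant-right (+ suc _)     -[1+ _ ]   _ _ = from-yes (near? 7F 7F)
octant-right -[1+ zero ]   (+ zero)   _ n = contradiction (refl , refl) n
octant-right -[1+ zero ]   (+ suc _)  _ _ = from-yes (near? 3F 2F)
octant-right -[1+ zero ]   -[1+ _ ]   _ _ = from-yes (near? 5F 6F)
octant-right -[1+ suc _ ]  (+ zero)   _ _ = from-yes (near? 4F 4F)
octant-right -[1+ suc _ ]  (+ suc _)  _ _ = from-yes (near? 3F 3F)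
octant-right -[1+ suc _ ]  -[1+ _ ]   _ _ = from-yes (near? 5F 5F)

octant-up : ∀ x y → ¬ (x ≡ 0ℤ × y ≡ 0ℤ) → ¬ (x ≡ 0ℤ × y ℤ.+ 1ℤ ≡ 0ℤ) →
            Near (octant x y) (octant x (y ℤ.+ 1ℤ))
octant-up (+ zero)   (+ zero)      n _ = contradiction (refl , refl) n
octant-up (+ suc _)  (+ zero)      _ _ = from-yes (near? 0F 1F)
octant-up -[1+ _ ]   (+ zero)      _ _ = from-yes (near? 4F 3F)
octant-up (+ zero)   (+ suc _)     _ _ = from-yes (near? 2F 2F)
octant-up (+ suc _)  (+ suc _)     _ _ = from-yes (near? 1F 1F)
octant-up -[1+ _ ]   (+ suc _)     _ _ = from-yes (near? 3F 3F)
octant-up (+ zero)   -[1+ zero ]   _ n = contradiction (refl , refl) n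
octant-up (+ suc _)  -[1+ zero ]   _ _ = from-yes (near? 7F 0F)
octant-up -[1+ _ ]   -[1+ zero ]   _ _ = from-yes (near? 5F 4F)
octant-up (+ zero)   -[1+ suc _ ]  _ _ = from-yes (near? 6F 6F)
octant-up (+ suc _)  -[1+ suc _ ]  _ _ = from-yes (near? 7F 7F)
octant-up -[1+ _ ]   -[1+ suc _ ]  _ _ = from-yes (near? 5F 5F)

octant-neg : ∀ x y → ¬ (x ≡ 0ℤ × y ≡ 0ℤ) → octant (ℤ.- x) (ℤ.- y) ≡ opposite (octant x y)
octant-neg (+ zero)   (+ zero)   n = contradiction (refl , refl) n
octant-neg (+ zero)   (+ suc _)  _ = refl
octant-neg (+ zero)   -[1+ _ ]   _ = refl
octant-neg (+ suc _)  (+ zero)   _ = refl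
octant-neg (+ suc _)  (+ suc _)  _ = refl
octant-neg (+ suc _)  -[1+ _ ]   _ = refl
octant-neg -[1+ _ ]   (+ zero)   _ = refl
octant-neg -[1+ _ ]   (+ suc _)  _ = refl
octant-neg -[1+ _ ]   -[1+ _ ]   _ = refl

difference≢0 : ∀ {p q p′ q′} → (p , q) ≢ (p′ , q′) → ¬ (p′ ℤ.- p ≡ 0ℤ × q′ ℤ.- q ≡ 0ℤ)
difference≢0 n (e , e′) = n (cong₂ _,_ (sym (ℤ.i-j≡0⇒i≡j _ _ e)) (sym (ℤ.i-j≡0⇒i≡j _ _ e′)))

+-−-swap : ∀ i j k → i ℤ.+ j ℤ.- k ≡ i ℤ.- k ℤ.+ j
+-−-swap = solve-∀

bearing-right : ∀ b u → b ≢ u → b ≢ right u → Near (bearing b u) (bearing b (right u))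
bearing-right (p₀ , q₀) (p , q) n n′ with difference≢0 n′
... | m rewrite +-−-swap p 1ℤ p₀ = octant-right _ _ (difference≢0 n) m

bearing-up : ∀ b u → b ≢ u → b ≢ up u → Near (bearing b u) (bearing b (up u))
bearing-up (p₀ , q₀) (p , q) n n′ with difference≢0 n′
... | m rewrite +-−-swap q 1ℤ q₀ = octant-up _ _ (difference≢0 n) m

bearing-near : ∀ {b u v} → Adj u v → b ≢ u → b ≢ v → Near (bearing b u) (bearing b v)
bearing-near (inj₁ (inj₁ refl))       n n′ = bearing-up _ _ n n′
bearing-near (inj₁ (inj₂ (refl , _))) n n′ = bearing-right _ _ n n′
bearing-near (inj₂ (inj₁ refl))       n n′ = near-sym _ _ (bearing-up _ _ n′ n)
bearing-near (inj₂ (inj₂ (refl , _))) n n′ = near-sym _ _ (bearing-right _ _ n′ n)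

neg-− : ∀ i j → ℤ.- (i ℤ.- j) ≡ j ℤ.- i
neg-− = solve-∀

bearing-opposite : ∀ {u v} → u ≢ v → bearing v u ≡ opposite (bearing u v)
bearing-opposite {p , q} {p′ , q′} n =
  trans (sym (cong₂ octant (neg-− p′ p) (neg-− q′ q))) (octant-neg _ _ (difference≢0 n))

κ-bearing-opposite : ∀ {a b c d} → a ≢ b → c ≢ d →
                     κ (bearing b a) (bearing d c) ≡ κ (bearing a b) (bearing c d)
κ-bearing-opposite {a} {b} {c} {d} n m =
  trans (cong₂ κ (bearing-opposite n) (bearing-opposite m)) (κ-opposite (bearing a b) (bearing c d))

bearing-near′ : ∀ {b b′ v} → Adj b b′ → b ≢ v → b′ ≢ v → Near (bearing b v) (bearing b′ v)
bearing-near′ e n n′ =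
  subst₂ Near (sym (bearing-opposite (n ∘ sym))) (sym (bearing-opposite (n′ ∘ sym)))
    (near-opposite _ _ (bearing-near e (n ∘ sym) (n′ ∘ sym)))

-- The variation, in octants, of the bearing from b of a point moving along w.

sweep : V → List V → ℤ
sweep b (u ∷ w@(v ∷ _)) = κ (bearing b u) (bearing b v) ℤ.+ sweep b w
sweep b _               = 0ℤ

All-last : ∀ {P : V → Set} xs {z} → All P (xs ∷ʳ z) → P z
All-last []       (p ∷ _)  = p
All-last (_ ∷ xs) (_ ∷ ps) = All-last xs ps

-- The head of `xs ∷ʳ z`, a list that is never empty.
first : List V → V → V
first []      z = z
first (x ∷ _) _ = x

sweep-∷ : ∀ b x ys z →
          sweep b (x ∷ (ys ∷ʳ z)) ≡ κ (bearing b x) (bearing b (first ys z)) ℤ.+ sweep b (ys ∷ʳ z)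
sweep-∷ b x []      z = refl
sweep-∷ b x (_ ∷ _) z = refl

sweep-∷ʳ : ∀ b xs y z →
           sweep b (xs ∷ʳ y ∷ʳ z) ≡ sweep b (xs ∷ʳ y) ℤ.+ κ (bearing b y) (bearing b z)
sweep-∷ʳ b []           y z = ℤ.+-comm (κ (bearing b y) (bearing b z)) 0ℤ
sweep-∷ʳ b (x ∷ [])     y z =
  trans (ℤ-+-congˡ (κ (bearing b x) (bearing b y)) (sweep-∷ʳ b [] y z))
        (sym (ℤ.+-assoc (κ (bearing b x) (bearing b y)) _ _))
sweep-∷ʳ b (x ∷ xs@(x′ ∷ _)) y z =
  trans (ℤ-+-congˡ (κ (bearing b x) (bearing b x′)) (sweep-∷ʳ b xs y z))
        (sym (ℤ.+-assoc (κ (bearing b x) (bearing b x′)) _ _))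

-- A discrete homotopy: at each vertex of the path a rung joins the bearings from `b` and from `b′`.
-- The rungs cut the strip into squares, which `κ-square` closes one by one, so the two sweeps
-- differ only by the end rungs.
sweep-strip : ∀ {b b′} ys z → Adj b b′ → Linked Adj (ys ∷ʳ z) →
              All (b ≢_) (ys ∷ʳ z) → All (b′ ≢_) (ys ∷ʳ z) →
              sweep b (ys ∷ʳ z) ℤ.+ κ (bearing b z) (bearing b′ z) ≡
              κ (bearing b (first ys z)) (bearing b′ (first ys z)) ℤ.+ sweep b′ (ys ∷ʳ z)
sweep-strip {b} {b′} [] z e _ _ _ = ℤ.+-comm 0ℤ (κ (bearing b z) (bearing b′ z))
sweep-strip {b} {b′} (x ∷ ys) z e l (n ∷ ns) (n′ ∷ ns′) = begin
  sweep b (x ∷ ys ∷ʳ z) ℤ.+ κz                 ≡⟨ cong (ℤ._+ κz) (sweep-∷ b x ys z) ⟩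
  (κ b⇢x b⇢y ℤ.+ sweep b (ys ∷ʳ z)) ℤ.+ κz     ≡⟨ ℤ.+-assoc (κ b⇢x b⇢y) _ _ ⟩
  κ b⇢x b⇢y ℤ.+ (sweep b (ys ∷ʳ z) ℤ.+ κz)     ≡⟨ ℤ-+-congˡ (κ b⇢x b⇢y) (sweep-strip ys z e (Linked.tail l) ns ns′) ⟩
  κ b⇢x b⇢y ℤ.+ (κ b⇢y b′⇢y ℤ.+ S′)            ≡⟨ ℤ.+-assoc (κ b⇢x b⇢y) _ _ ⟨
  (κ b⇢x b⇢y ℤ.+ κ b⇢y b′⇢y) ℤ.+ S′            ≡⟨ cong (ℤ._+ S′) square ⟩
  (κ b⇢x b′⇢x ℤ.+ κ b′⇢x b′⇢y) ℤ.+ S′          ≡⟨ ℤ.+-assoc (κ b⇢x b′⇢x) _ _ ⟩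
  κ b⇢x b′⇢x ℤ.+ (κ b′⇢x b′⇢y ℤ.+ S′)          ≡⟨ ℤ-+-congˡ (κ b⇢x b′⇢x) (sweep-∷ b′ x ys z) ⟨
  κ b⇢x b′⇢x ℤ.+ sweep b′ (x ∷ ys ∷ʳ z)        ∎
  where
  open ≡-Reasoning
  y    = first ys z
  b⇢x  = bearing b x
  b⇢y  = bearing b y
  b′⇢x = bearing b′ x
  b′⇢y = bearing b′ y
  κz   = κ (bearing b z) (bearing b′ z)
  S′   = sweep b′ (ys ∷ʳ z)
  first-step : ∀ {P : V → Set} ys → All P (ys ∷ʳ z) → P (first ys z)
  first-step []      (p ∷ _) = p
  first-step (_ ∷ _) (p ∷ _) = p
  first-edge : ∀ ys → Linked Adj (x ∷ ys ∷ʳ z) → Adj x (first ys z)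
  first-edge []      (e ∷ _) = e
  first-edge (_ ∷ _) (e ∷ _) = e
  xy = first-edge ys l
  ny = first-step ys ns
  ny′ = first-step ys ns′
  square = κ-square b⇢x b⇢y (bearing-near xy n ny) b′⇢y (bearing-near′ e ny ny′)
                    b′⇢x (bearing-near′ e n n′) (bearing-near xy n′ ny′)

-- Away from the west, `principal` is a branch of the octant number along the whole path, and the
-- sum of the values of κ telescopes.
sweep-principal : ∀ {b} ys z → Linked Adj (ys ∷ʳ z) → All (b ≢_) (ys ∷ʳ z) →
                  All (λ u → bearing b u ≢ 4F) (ys ∷ʳ z) →
                  sweep b (ys ∷ʳ z) ≡ principal (bearing b z) ℤ.- principal (bearing b (first ys z))
sweep-principal {b} [] z _ _ _ = sym (ℤ.+-inverseʳ (principal (bearing b z)))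
sweep-principal {b} (x ∷ []) z (e ∷ l) (n ∷ ns@(n′ ∷ _)) (m ∷ ms@(m′ ∷ _)) =
  trans (ℤ.+-identityʳ _) (κ-principal _ _ (bearing-near e n n′) m m′)
sweep-principal {b} (x ∷ y ∷ ys) z (e ∷ l) (n ∷ ns@(n′ ∷ _)) (m ∷ ms@(m′ ∷ _)) =
  trans (cong₂ ℤ._+_ (κ-principal _ _ (bearing-near e n n′) m m′) (sweep-principal (y ∷ ys) z l ns ms))
        (telescope (principal (bearing b x)) (principal (bearing b y)) (principal (bearing b z)))
  where
  telescope : ∀ i j k → (j ℤ.- i) ℤ.+ (k ℤ.- j) ≡ k ℤ.- i
  telescope = solve-∀

-- The rotation, in octants, from the edge ab to the edge bc, by way of the
-- secant ac.

turn : V → V → V → ℤ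
turn a b c = κ (bearing a b) (bearing a c) ℤ.+ κ (bearing a c) (bearing b c)

rotation : List V → ℤ
rotation (a ∷ w@(b ∷ c ∷ _)) = turn a b c ℤ.+ rotation w
rotation _                   = 0ℤ

-- Hopf's homotopy: the secant of a self-avoiding path can be moved through
-- all secants instead of along the tangents.

hopf : ∀ b xs z → Linked Adj (b ∷ xs ∷ʳ z) → AllPairs _≢_ (b ∷ xs ∷ʳ z) →
       rotation (b ∷ xs ∷ʳ z) ≡ sweep b (xs ∷ʳ z) ℤ.+ sweep z (b ∷ xs)
hopf b []           z _       _ = refl
hopf b (c ∷ xs) z (e ∷ l) (b≢ ∷ u@(c≢ ∷ _)) = begin
  rotation (b ∷ c ∷ xs ∷ʳ z)                           ≡⟨ rotation-∷ xs ⟩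
  turn b c d ℤ.+ rotation (c ∷ xs ∷ʳ z)                ≡⟨ ℤ-+-congˡ (turn b c d) (hopf c xs z l u) ⟩
  turn b c d ℤ.+ (S′ ℤ.+ sweep z (c ∷ xs))             ≡⟨ regroup (κ b⇢c b⇢d) (κ b⇢d c⇢d) S′ _ ⟩
  κ b⇢c b⇢d ℤ.+ (κ b⇢d c⇢d ℤ.+ S′) ℤ.+ sweep z (c ∷ xs)
    ≡⟨ cong (λ i → κ b⇢c b⇢d ℤ.+ i ℤ.+ sweep z (c ∷ xs)) strip ⟨
  κ b⇢c b⇢d ℤ.+ (S ℤ.+ κz) ℤ.+ sweep z (c ∷ xs)        ≡⟨ regroup′ (κ b⇢c b⇢d) S κz _ ⟩
  (κ b⇢c b⇢d ℤ.+ S) ℤ.+ (κz ℤ.+ sweep z (c ∷ xs))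
    -- Reversing both secants turns the last rung of the strip, at `z`, into the first step of the
    -- sweep seen from `z`.
    ≡⟨ cong₂ ℤ._+_ (sym (sweep-∷ b c xs z))
         (cong (ℤ._+ sweep z (c ∷ xs)) (sym (κ-bearing-opposite (All-last xs (All.tail b≢)) (All-last xs c≢)))) ⟩
  sweep b (c ∷ xs ∷ʳ z) ℤ.+ sweep z (b ∷ c ∷ xs)       ∎
  where
  open ≡-Reasoning
  d   = first xs z
  b⇢c = bearing b c
  b⇢d = bearing b d
  c⇢d = bearing c d
  S   = sweep b (xs ∷ʳ z)
  S′  = sweep c (xs ∷ʳ z)
  κz  = κ (bearing b z) (bearing c z)
  strip = sweep-strip xs z e (Linked.tail l) (All.tail b≢) c≢
  rotation-∷ : ∀ xs → rotation (b ∷ c ∷ xs ∷ʳ z) ≡ turn b c (first xs z) ℤ.+ rotation (c ∷ xs ∷ʳ z)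
  rotation-∷ []      = refl
  rotation-∷ (_ ∷ _) = refl
  regroup : ∀ i j k l → (i ℤ.+ j) ℤ.+ (k ℤ.+ l) ≡ i ℤ.+ (j ℤ.+ k) ℤ.+ l
  regroup = solve-∀
  regroup′ : ∀ i j k l → i ℤ.+ (j ℤ.+ k) ℤ.+ l ≡ (i ℤ.+ j) ℤ.+ (k ℤ.+ l)
  regroup′ = solve-∀

-- Directions at a vertex

Parityℤ : Bool → ℤ → Set
Parityℤ true  i = + 2 ℤ.∣ i
Parityℤ false i = + 2 ℤ.∣ i ℤ.+ 1ℤ

-- The value `true` marks the even vertices, whose horizontal edge goes to the right. As a record,
-- unlike `Parityℤ`, it lets `e` and `v` be inferred from a proof.
record Parity (e : Bool) (v : V) : Set where
  constructor ⟨_⟩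
  field difference : Parityℤ e (proj₁ v ℤ.- proj₂ v)

parityℤ : ∀ i → ∃ λ e → Parityℤ e i
parityℤ i with i ℤ.%ℕ 2 | i ℤ./ℕ 2 | ℤ.n%ℕd<d i 2 | ℤ.a≡a%ℕn+[a/ℕn]*n i 2
... | 0 | k | _ | eq = true , ℤ.divides k (trans eq (ℤ.+-identityˡ _))
... | 1 | k | _ | eq = false , ℤ.divides (k ℤ.+ 1ℤ) (trans (cong (ℤ._+ 1ℤ) eq) (lemma k))
  where
  lemma : ∀ k → 1ℤ ℤ.+ k ℤ.* + 2 ℤ.+ 1ℤ ≡ (k ℤ.+ 1ℤ) ℤ.* + 2
  lemma = solve-∀
... | suc (suc _) | _ | ℕ.s≤s (ℕ.s≤s ()) | _

parity : ∀ v → ∃ λ e → Parity e v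
parity (p , q) = let e , h = parityℤ (p ℤ.- q) in e , ⟨ h ⟩

parity-suc : ∀ e i → Parityℤ e i → Parityℤ (not e) (i ℤ.+ 1ℤ)
parity-suc true  i d = subst (+ 2 ℤ.∣_) (sym (ℤ.+-assoc i 1ℤ 1ℤ)) (ℤ.∣m∣n⇒∣m+n d ℤ.∣-refl)
parity-suc false i d = d

parity-pred : ∀ e i → Parityℤ e i → Parityℤ (not e) (i ℤ.- 1ℤ)
parity-pred true  i d = subst (+ 2 ℤ.∣_) (lemma i) d
  where
  lemma : ∀ i → i ≡ i ℤ.- 1ℤ ℤ.+ 1ℤ
  lemma = solve-∀
parity-pred false i d = subst (+ 2 ℤ.∣_) (lemma i) (ℤ.∣m∣n⇒∣m-n d ℤ.∣-refl)
  where
  lemma : ∀ i → i ℤ.+ 1ℤ ℤ.- + 2 ≡ i ℤ.- 1ℤ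
  lemma = solve-∀

parity-even : ∀ {e v} → Parity e v → Parity true v → e ≡ true
parity-even {true}  _  _  = refl
parity-even {false} ⟨ d′ ⟩ ⟨ d ⟩ with ℤ.∣⇒∣ᵤ (ℤ.∣m+n∣m⇒∣n d′ d)
... | 2∣1 = contradiction (ℕ.∣⇒≤ 2∣1) λ { (ℕ.s≤s ()) }

data Dir : Set where
  north east south west : Dir

_≟ᴰ_ : DecidableEquality Dir
north ≟ᴰ north = yes refl
north ≟ᴰ east = no λ ()
north ≟ᴰ south = no λ ()
north ≟ᴰ west = no λ ()
east ≟ᴰ north = no λ ()
east ≟ᴰ east = yes refl
east ≟ᴰ south = no λ ()
east ≟ᴰ west = no λ ()
south ≟ᴰ north = no λ ()
south ≟ᴰ east = no λ ()
south ≟ᴰ south = yes refl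
south ≟ᴰ west = no λ ()
west ≟ᴰ north = no λ ()
west ≟ᴰ east = no λ ()
west ≟ᴰ south = no λ ()
west ≟ᴰ west = yes refl

step : Dir → V → V
step north = up
step east = right
step south = down
step west = left

back : Dir → Dir
back north = south
back east = west
back south = north
back west = east

vec : Dir → V
vec north = 0ℤ  , 1ℤ
vec east = 1ℤ  , 0ℤ
vec south = 0ℤ  , -1ℤ
vec west = -1ℤ , 0ℤ

step-vec : ∀ d p q → step d (p , q) ≡ (p ℤ.+ proj₁ (vec d) , q ℤ.+ proj₂ (vec d))
step-vec north p q = cong (_, q ℤ.+ 1ℤ) (sym (ℤ.+-identityʳ p))
step-vec east p q = cong (p ℤ.+ 1ℤ ,_) (sym (ℤ.+-identityʳ q))
step-vec south p q = cong (_, q ℤ.- 1ℤ) (sym (ℤ.+-identityʳ p))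
step-vec west p q = cong (p ℤ.- 1ℤ ,_) (sym (ℤ.+-identityʳ q))

axis : Dir → Fin 8
axis east = 0F
axis north = 2F
axis west = 4F
axis south = 6F

axis-injective : ∀ {d d′} → axis d ≡ axis d′ → d ≡ d′
axis-injective {north} {north} _ = refl
axis-injective {east} {east} _ = refl
axis-injective {south} {south} _ = refl
axis-injective {west} {west} _ = refl

secant : Dir → Dir → Fin 8
secant d d′ = octant (proj₁ (vec d′) ℤ.- proj₁ (vec d)) (proj₂ (vec d′) ℤ.- proj₂ (vec d))

+-cancel-− : ∀ i j k → (i ℤ.+ k) ℤ.- (i ℤ.+ j) ≡ k ℤ.- j
+-cancel-− = solve-∀

bearing-secant : ∀ d d′ v → bearing (step d v) (step d′ v) ≡ secant d d′
bearing-secant d d′ (p , q) = trans (cong₂ bearing (step-vec d p q) (step-vec d′ p q))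
  (cong₂ octant (+-cancel-− p _ _) (+-cancel-− q _ _))

bearing-step : ∀ d v → bearing v (step d v) ≡ axis d
bearing-step d (p , q) = trans (cong (bearing (p , q)) (step-vec d p q))
  (trans (cong₂ octant (lemma p (proj₁ (vec d))) (lemma q (proj₂ (vec d)))) (octant-vec d))
  where
  lemma : ∀ i k → (i ℤ.+ k) ℤ.- i ≡ k
  lemma = solve-∀
  octant-vec : ∀ d → octant (proj₁ (vec d)) (proj₂ (vec d)) ≡ axis d
  octant-vec north = refl
  octant-vec east = refl
  octant-vec south = refl
  octant-vec west = refl

bearing-unstep : ∀ d v → bearing (step d v) v ≡ axis (back d)
bearing-unstep d (p , q) = trans (cong (λ u → bearing u (p , q)) (step-vec d p q))
  (trans (cong₂ octant (lemma p (proj₁ (vec d))) (lemma q (proj₂ (vec d)))) (octant-vec d))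
  where
  lemma : ∀ i k → i ℤ.- (i ℤ.+ k) ≡ ℤ.- k
  lemma = solve-∀
  octant-vec : ∀ d → octant (ℤ.- proj₁ (vec d)) (ℤ.- proj₂ (vec d)) ≡ axis (back d)
  octant-vec north = refl
  octant-vec east = refl
  octant-vec south = refl
  octant-vec west = refl

step-injective : ∀ {d d′ v} → step d v ≡ step d′ v → d ≡ d′
step-injective {d} {d′} {v} eq =
  axis-injective (trans (sym (bearing-step d v)) (trans (cong (bearing v) eq) (bearing-step d′ v)))

i+1-1≡i : ∀ i → i ℤ.+ 1ℤ ℤ.- 1ℤ ≡ i
i+1-1≡i = solve-∀

i-1+1≡i : ∀ i → i ℤ.- 1ℤ ℤ.+ 1ℤ ≡ i
i-1+1≡i = solve-∀

back-step : ∀ d v → step (back d) (step d v) ≡ v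
back-step north (p , q) = cong (p ,_) (i+1-1≡i q)
back-step east  (p , q) = cong (_, q) (i+1-1≡i p)
back-step south (p , q) = cong (p ,_) (i-1+1≡i q)
back-step west  (p , q) = cong (_, q) (i-1+1≡i p)

parity-step : ∀ {e} d {v} → Parity e v → Parity (not e) (step d v)
parity-step {e} north {p , q} ⟨ h ⟩ = ⟨ subst (Parityℤ (not e)) (lemma p q) (parity-pred e _ h) ⟩
  where
  lemma : ∀ p q → p ℤ.- q ℤ.- 1ℤ ≡ p ℤ.- (q ℤ.+ 1ℤ)
  lemma = solve-∀
parity-step {e} east {p , q} ⟨ h ⟩ = ⟨ subst (Parityℤ (not e)) (lemma p q) (parity-suc e _ h) ⟩
  where
  lemma : ∀ p q → p ℤ.- q ℤ.+ 1ℤ ≡ p ℤ.+ 1ℤ ℤ.- q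
  lemma = solve-∀
parity-step {e} south {p , q} ⟨ h ⟩ = ⟨ subst (Parityℤ (not e)) (lemma p q) (parity-suc e _ h) ⟩
  where
  lemma : ∀ p q → p ℤ.- q ℤ.+ 1ℤ ≡ p ℤ.- (q ℤ.- 1ℤ)
  lemma = solve-∀
parity-step {e} west {p , q} ⟨ h ⟩ = ⟨ subst (Parityℤ (not e)) (lemma p q) (parity-pred e _ h) ⟩
  where
  lemma : ∀ p q → p ℤ.- q ℤ.- 1ℤ ≡ p ℤ.- 1ℤ ℤ.- q
  lemma = solve-∀

-- In clockwise order.

dirs : Bool → List Dir
dirs true  = north ∷ east ∷ south ∷ []
dirs false = north ∷ south ∷ west ∷ []

adj-step : ∀ {e d v} → Parity e v → d ∈ dirs e → Adj v (step d v)
adj-step {true}  h (here refl) = inj₁ (inj₁ refl)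
adj-step {true}  ⟨ h ⟩ (there (here refl)) = inj₁ (inj₂ (refl , h))
adj-step {true}  {v = v} h (there (there (here refl))) = inj₂ (inj₁ (sym (back-step south v)))
adj-step {false} h (here refl) = inj₁ (inj₁ refl)
adj-step {false} {v = v} h (there (here refl)) = inj₂ (inj₁ (sym (back-step south v)))
adj-step {false} {v = v} h (there (there (here refl))) =
  inj₂ (inj₂ (sym (back-step west v) , Parity.difference (parity-step west h)))

step-adj : ∀ {e v w} → Parity e v → Adj v w → ∃ λ d → d ∈ dirs e × w ≡ step d v
step-adj {e} h (inj₁ (inj₁ refl)) = north , north-∈ e , refl
  where
  north-∈ : ∀ e → north ∈ dirs e
  north-∈ true  = here refl
  north-∈ false = here refl
step-adj {e} h (inj₁ (inj₂ (refl , h′))) =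
  east , subst (λ e → east ∈ dirs e) (sym (parity-even h ⟨ h′ ⟩)) (there (here refl)) , refl
step-adj {e} {w = w} h (inj₂ (inj₁ refl)) = south , south-∈ e , sym (back-step north w)
  where
  south-∈ : ∀ e → south ∈ dirs e
  south-∈ true  = there (there (here refl))
  south-∈ false = there (here refl)
step-adj {true} {w = w} h (inj₂ (inj₂ (refl , h′))) =
  contradiction (parity-even {e = false} (parity-step east {w} ⟨ h′ ⟩) h) λ ()
step-adj {false} {w = w} h (inj₂ (inj₂ (refl , h′))) =
  west , there (there (here refl)) , sym (back-step east w)

neighbours-step : ∀ {e v} → Parity e v → neighbours v ≡ map (λ d → step d v) (dirs e)
neighbours-step {true} {v} h =
  trans (accept (adj-step h (here refl))) (cong (up v ∷_)
  (trans (accept (adj-step h (there (here refl)))) (cong (right v ∷_)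
  (trans (accept (adj-step h (there (there (here refl))))) (cong (down v ∷_)
  (reject λ a → case step-adj h a of λ
    { (_ , here refl , eq)                 → case step-injective {west} {north} {v} eq of λ ()
    ; (_ , there (here refl) , eq)         → case step-injective {west} {east} {v} eq of λ ()
    ; (_ , there (there (here refl)) , eq) → case step-injective {west} {south} {v} eq of λ () }))))))
  where
  accept : ∀ {x xs} → Adj v x → filter (adj? v) (x ∷ xs) ≡ x ∷ filter (adj? v) xs
  accept = List.filter-accept (adj? v)
  reject : ∀ {x xs} → ¬ Adj v x → filter (adj? v) (x ∷ xs) ≡ filter (adj? v) xs
  reject = List.filter-reject (adj? v)
neighbours-step {false} {v} h =
  trans (accept (adj-step h (here refl))) (cong (up v ∷_)
  (trans (reject λ a → case step-adj h a of λ
    { (_ , here refl , eq)                 → case step-injective {east} {north} {v} eq of λ ()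
    ; (_ , there (here refl) , eq)         → case step-injective {east} {south} {v} eq of λ ()
    ; (_ , there (there (here refl)) , eq) → case step-injective {east} {west} {v} eq of λ () })
  (trans (accept (adj-step h (there (here refl)))) (cong (down v ∷_)
  (accept (adj-step h (there (there (here refl)))))))))
  where
  accept : ∀ {x xs} → Adj v x → filter (adj? v) (x ∷ xs) ≡ x ∷ filter (adj? v) xs
  accept = List.filter-accept (adj? v)
  reject : ∀ {x xs} → ¬ Adj v x → filter (adj? v) (x ∷ xs) ≡ filter (adj? v) xs
  reject = List.filter-reject (adj? v)

open Data.List.Membership.DecPropositional (≡-dec _≟ᴰ_ _≟ᴰ_) using (_∈?_)

clockwiseDirs : Bool → List (Dir × Dir)
clockwiseDirs e = zip (dirs e) (drop 1 (dirs e) ++ take 1 (dirs e))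

weightᴰ : Bool → Dir → Dir → ℤ
weightᴰ e d d′ = if does ((d , d′) ∈? clockwiseDirs e) then 1ℤ else -1ℤ

clockwise-step : ∀ {e v} → Parity e v →
                 clockwise v ≡ map (λ (d , d′) → step d v , step d′ v) (clockwiseDirs e)
clockwise-step {true}  h = cong (λ ns → zip ns (drop 1 ns ++ take 1 ns)) (neighbours-step h)
clockwise-step {false} h = cong (λ ns → zip ns (drop 1 ns ++ take 1 ns)) (neighbours-step h)

weight-step : ∀ {e v} → Parity e v → ∀ d d′ → weight (step d v) v (step d′ v) ≡ weightᴰ e d d′
weight-step {e} {v} h d d′ with (d , d′) ∈? clockwiseDirs e
... | yes i = cong (if_then 1ℤ else -1ℤ) (dec-true (leftHook? (step d v) v (step d′ v))
  (subst ((step d v , step d′ v) ∈_) (sym (clockwise-step h))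
    (∈-map⁺ (λ (d , d′) → step d v , step d′ v) i)))
... | no n  = cong (if_then 1ℤ else -1ℤ) (dec-false (leftHook? (step d v) v (step d′ v))
  λ i → case ∈-map⁻ _ (subst ((step d v , step d′ v) ∈_) (clockwise-step h) i) of λ
    { (_ , i′ , eq) → n (subst (_∈ clockwiseDirs e)
        (sym (cong₂ _,_ (step-injective {v = v} (cong proj₁ eq)) (step-injective {v = v} (cong proj₂ eq)))) i′) })

-- In the regular hexagonal lattice, the three edges point to 0, 2 and 4 sixths of a turn at an even
-- vertex, and to 1, 3 and 5 sixths at an odd one.
ℓᴰ : Bool → Dir → ℕ
ℓᴰ true  north = 2
ℓᴰ false north = 1
ℓᴰ _     east = 0
ℓᴰ true  south = 4
ℓᴰ false south = 5
ℓᴰ _     west = 3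

adj-right : ∀ {e v} → Parity e v → does (adj? v (right v)) ≡ e
adj-right {true}  {v} h = dec-true (adj? v (right v)) (adj-step h (there (here refl)))
adj-right {false} {v} h = dec-false (adj? v (right v)) λ a → case step-adj h a of λ
    { (_ , here refl , eq)                 → case step-injective {east} {north} {v} eq of λ ()
    ; (_ , there (here refl) , eq)         → case step-injective {east} {south} {v} eq of λ ()
    ; (_ , there (there (here refl)) , eq) → case step-injective {east} {west} {v} eq of λ () }

ℓᵇ-up : ∀ {e v} → Parity e v → ℓᵇ v (up v) ≡ (if e then 2 else 1)
ℓᵇ-up {e} {v} h = trans
  (cong (if_then (if does (adj? (up v) (right (up v))) then 1 else 2) else 0)
    (dec-true (vertical? v (up v)) refl))
  (trans (cong (if_then 1 else 2) (adj-right {v = up v} (parity-step north h))) (if-not e))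
  where
  if-not : ∀ e → (if not e then 1 else 2) ≡ (if e then 2 else 1)
  if-not true  = refl
  if-not false = refl

ℓᵇ-right : ∀ v → ℓᵇ v (right v) ≡ 0
ℓᵇ-right v =
  cong (if_then (if does (adj? (right v) (right (right v))) then 1 else 2) else 0)
    (dec-false (vertical? v (right v)) λ eq → case step-injective {east} {north} {v} eq of λ ())

ℓ-basic : ∀ {u v} → Basic u v → ℓ u v ≡ ℓᵇ u v
ℓ-basic {u} {v} b = cong (if_then ℓᵇ u v else 3 ℕ.+ ℓᵇ v u) (dec-true (basic? u v) b)

ℓ-nonbasic : ∀ {u v} → ¬ Basic u v → ℓ u v ≡ 3 ℕ.+ ℓᵇ v u
ℓ-nonbasic {u} {v} b = cong (if_then ℓᵇ u v else 3 ℕ.+ ℓᵇ v u) (dec-false (basic? u v) b)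

ℓ-step : ∀ {e d v} → Parity e v → d ∈ dirs e → ℓ v (step d v) ≡ ℓᴰ e d
ℓ-step {e} {north} {v} h _ = trans (ℓ-basic {v} {up v} (inj₁ refl)) (trans (ℓᵇ-up h) (table e))
  where
  table : ∀ e → (if e then 2 else 1) ≡ ℓᴰ e north
  table true  = refl
  table false = refl
ℓ-step {true} {east} {v} h _ = trans (ℓ-basic {v} {right v} (inj₂ (refl , Parity.difference h))) (ℓᵇ-right v)
ℓ-step {false} {east} {v} h (there (there (here ())))
ℓ-step {e} {south} {v} h _ = trans
  (ℓ-nonbasic {v} {down v} λ
    { (inj₁ eq) → case step-injective {south} {north} {v} eq of λ ()
    ; (inj₂ (eq , _)) → case step-injective {south} {east} {v} eq of λ () })
  (trans (cong (3 ℕ.+_) (trans (cong (ℓᵇ (down v)) (sym (back-step south v))) (ℓᵇ-up (parity-step south h))))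
    (table e))
  where
  table : ∀ e → 3 ℕ.+ (if not e then 2 else 1) ≡ ℓᴰ e south
  table true  = refl
  table false = refl
ℓ-step {true} {west} {v} h (there (there (here ())))
ℓ-step {true} {west} {v} h (there (there (there ())))
ℓ-step {false} {west} {v} h _ = trans
  (ℓ-nonbasic {v} {left v} λ
    { (inj₁ eq) → case step-injective {west} {north} {v} eq of λ ()
    ; (inj₂ (eq , _)) → case step-injective {west} {east} {v} eq of λ () })
  (cong (3 ℕ.+_) (trans (cong (ℓᵇ (left v)) (sym (back-step west v))) (ℓᵇ-right (left v))))

back-∈ : ∀ {e d} → d ∈ dirs e → back d ∈ dirs (not e)
back-∈ {true}  (here refl)                 = there (here refl)
back-∈ {true}  (there (here refl))         = there (there (here refl))
back-∈ {true}  (there (there (here refl))) = here refl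
back-∈ {false} (here refl)                 = there (there (here refl))
back-∈ {false} (there (here refl))         = here refl
back-∈ {false} (there (there (here refl))) = there (here refl)

ℓ-unstep : ∀ {e d v} → Parity e v → d ∈ dirs e → ℓ (step d v) v ≡ ℓᴰ (not e) (back d)
ℓ-unstep {e} {d} {v} h i = subst (λ w → ℓ (step d v) w ≡ ℓᴰ (not e) (back d)) (back-step d v)
  (ℓ-step (parity-step d h) (back-∈ i))

turnᴰ : Dir → Dir → ℤ
turnᴰ d d′ = κ (axis (back d)) (secant d d′) ℤ.+ κ (secant d d′) (axis d′)

turn-step : ∀ d d′ v → turn (step d v) v (step d′ v) ≡ turnᴰ d d′
turn-step d d′ v = cong₂ ℤ._+_
  (cong₂ κ (bearing-unstep d v) (bearing-secant d d′ v))
  (cong₂ κ (bearing-secant d d′ v) (bearing-step d′ v))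

-- The walk turns by sixths of a full turn in the hexagonal lattice, and by
-- eighths of a full turn in the brick wall drawing of H.  The edge uv makes
-- up for the difference between the two directions, in units of 1/24.

tilt : V → V → ℤ
tilt u v = + 4 ℤ.* + ℓ u v ℤ.- + 3 ℤ.* + toℕ (bearing u v)

tiltᴰ : Bool → Dir → ℤ
tiltᴰ e d = + 4 ℤ.* + ℓᴰ e d ℤ.- + 3 ℤ.* + toℕ (axis d)

tilt-step : ∀ {e d v} → Parity e v → d ∈ dirs e → tilt v (step d v) ≡ tiltᴰ e d
tilt-step {e} {d} {v} h i = cong₂ (λ j k → + 4 ℤ.* + j ℤ.- + 3 ℤ.* + toℕ k) (ℓ-step h i) (bearing-step d v)

-- Reversal adds half a turn to the direction in either drawing. With the chosen representatives the
-- difference is the same integer: all tilts of edges are 0, 2 or -2.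
tilt-unstep : ∀ {e d v} → Parity e v → d ∈ dirs e → tilt (step d v) v ≡ tiltᴰ e d
tilt-unstep {e} {d} {v} h i = trans
  (cong₂ (λ j k → + 4 ℤ.* + j ℤ.- + 3 ℤ.* + toℕ k) (ℓ-unstep h i) (bearing-unstep d v))
  (table e i)
  where
  table : ∀ e {d} → d ∈ dirs e → tiltᴰ (not e) (back d) ≡ tiltᴰ e d
  table true  (here refl)                 = refl
  table true  (there (here refl))         = refl
  table true  (there (there (here refl))) = refl
  table false (here refl)                 = refl
  table false (there (here refl))         = refl
  table false (there (there (here refl))) = refl

adj-sym : ∀ {u v} → Adj u v → Adj v u
adj-sym = swap

tilt-sym : ∀ {u v} → Adj u v → tilt u v ≡ tilt v u
tilt-sym {u} a with e , h ← parity u with d , i , refl ← step-adj h a =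
  trans (tilt-step h i) (sym (tilt-unstep h i))

all-dirs? : ∀ {p} {P : Dir → Dir → Set p} → (∀ d d′ → Dec (P d d′)) → ∀ e →
            Dec (All (λ d → All (P d) (dirs e)) (dirs e))
all-dirs? P? e = All.all? (λ d → All.all? (P? d) (dirs e)) (dirs e)

-- A finite check. In 24ths of a full turn, a hook turns by 4 in the hexagonal lattice and an octant
-- is 3; the tilts of its two edges make up the difference. Going straight on in the brick wall from
-- the north to the south of an even vertex, for example, reads -4 = 0 - 2 - 2.
weight-turnᴰ : ∀ e {d d′} → d ∈ dirs e → d′ ∈ dirs e → d ≢ d′ →
  + 4 ℤ.* weightᴰ e d d′ ≡ + 3 ℤ.* turnᴰ d d′ ℤ.+ tiltᴰ e d′ ℤ.- tiltᴰ e d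
weight-turnᴰ e i i′ = All.lookup (All.lookup (table e) i) i′
  where
  P? : ∀ e d d′ → Dec (d ≢ d′ → + 4 ℤ.* weightᴰ e d d′ ≡ + 3 ℤ.* turnᴰ d d′ ℤ.+ tiltᴰ e d′ ℤ.- tiltᴰ e d)
  P? e d d′ = ¬? (d ≟ᴰ d′) →-dec (_ ℤ.≟ _)
  table : ∀ e → All (λ d → All (λ d′ → d ≢ d′ →
    + 4 ℤ.* weightᴰ e d d′ ≡ + 3 ℤ.* turnᴰ d d′ ℤ.+ tiltᴰ e d′ ℤ.- tiltᴰ e d) (dirs e)) (dirs e)
  table true  = from-yes (all-dirs? (P? true) true)
  table false = from-yes (all-dirs? (P? false) false)

weight-turn : ∀ {a b c} → Adj a b → Adj b c → a ≢ c →
              + 4 ℤ.* weight a b c ≡ + 3 ℤ.* turn a b c ℤ.+ tilt b c ℤ.- tilt a b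
weight-turn {a} {b} {c} ab bc a≢c
  with e , h ← parity b
  with d , i , refl ← step-adj h (adj-sym ab)
  with d′ , i′ , refl ← step-adj h bc = begin
  + 4 ℤ.* weight a b c                                    ≡⟨ cong (+ 4 ℤ.*_) (weight-step h d d′) ⟩
  + 4 ℤ.* weightᴰ e d d′                                  ≡⟨ weight-turnᴰ e i i′ (a≢c ∘ cong (λ d → step d b)) ⟩
  + 3 ℤ.* turnᴰ d d′ ℤ.+ tiltᴰ e d′ ℤ.- tiltᴰ e d
    ≡⟨ cong₂ ℤ._-_ (cong₂ ℤ._+_ (cong (+ 3 ℤ.*_) (turn-step d d′ b)) (tilt-step h i′)) (tilt-unstep h i) ⟨
  + 3 ℤ.* turn a b c ℤ.+ tilt b c ℤ.- tilt a b            ∎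
  where open ≡-Reasoning

-- Winding numbers

-- The value 0ℤ for a list of length at most 1 is irrelevant.

lastTilt : List V → ℤ
lastTilt (u ∷ v ∷ [])        = tilt u v
lastTilt (_ ∷ w@(_ ∷ _ ∷ _)) = lastTilt w
lastTilt _                   = 0ℤ

lastTilt-∷ʳ : ∀ xs u v → lastTilt (xs ∷ʳ u ∷ʳ v) ≡ tilt u v
lastTilt-∷ʳ []           u v = refl
lastTilt-∷ʳ (_ ∷ [])     u v = refl
lastTilt-∷ʳ (_ ∷ x ∷ [])     u v = refl
lastTilt-∷ʳ (_ ∷ x ∷ y ∷ xs) u v = lastTilt-∷ʳ (x ∷ y ∷ xs) u v

direction-∷ʳ : ∀ xs u v → direction (xs ∷ʳ u ∷ʳ v) ≡ ℓ v u
direction-∷ʳ []           u v = refl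
direction-∷ʳ (_ ∷ [])     u v = refl
direction-∷ʳ (_ ∷ x ∷ [])     u v = refl
direction-∷ʳ (_ ∷ x ∷ y ∷ xs) u v = direction-∷ʳ (x ∷ y ∷ xs) u v

-- The tilts telescope, leaving those of the first and the last edge.
winding-rotation : ∀ a b xs → Linked Adj (a ∷ b ∷ xs) → AllPairs _≢_ (a ∷ b ∷ xs) →
  + 4 ℤ.* winding (a ∷ b ∷ xs) ≡ + 3 ℤ.* rotation (a ∷ b ∷ xs) ℤ.+ lastTilt (a ∷ b ∷ xs) ℤ.- tilt a b
winding-rotation a b [] _ _ = lemma (tilt a b)
  where
  lemma : ∀ i → + 0 ≡ + 0 ℤ.+ i ℤ.- i
  lemma = solve-∀
winding-rotation a b (c ∷ xs) (ab ∷ l@(bc ∷ _)) ((_ ∷ a≢c ∷ _) ∷ u) = begin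
  + 4 ℤ.* (weight a b c ℤ.+ winding w)                   ≡⟨ ℤ.*-distribˡ-+ (+ 4) (weight a b c) (winding w) ⟩
  + 4 ℤ.* weight a b c ℤ.+ + 4 ℤ.* winding w
    ≡⟨ cong₂ ℤ._+_ (weight-turn ab bc a≢c) (winding-rotation b c xs l u) ⟩
  (+ 3 ℤ.* turn a b c ℤ.+ tilt b c ℤ.- tilt a b) ℤ.+ (+ 3 ℤ.* rotation w ℤ.+ lastTilt w ℤ.- tilt b c)
    ≡⟨ lemma (turn a b c) (tilt b c) (tilt a b) (rotation w) (lastTilt w) ⟩
  + 3 ℤ.* (turn a b c ℤ.+ rotation w) ℤ.+ lastTilt w ℤ.- tilt a b ∎
  where
  open ≡-Reasoning
  w = b ∷ c ∷ xs
  lemma : ∀ i j k r t → (+ 3 ℤ.* i ℤ.+ j ℤ.- k) ℤ.+ (+ 3 ℤ.* r ℤ.+ t ℤ.- j) ≡ + 3 ℤ.* (i ℤ.+ r) ℤ.+ t ℤ.- k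
  lemma = solve-∀

-- The two parts overlap in one edge, so that every hook lies in exactly one of them.
winding-++ : ∀ xs a b ys →
             winding (xs ++ a ∷ b ∷ ys) ≡ winding (xs ++ a ∷ b ∷ []) ℤ.+ winding (a ∷ b ∷ ys)
winding-++ []               a b ys = sym (ℤ.+-identityˡ _)
winding-++ (x ∷ [])         a b ys =
  trans (ℤ-+-congˡ (weight x a b) (winding-++ [] a b ys))
        (sym (ℤ.+-assoc (weight x a b) 0ℤ (winding (a ∷ b ∷ ys))))
winding-++ (x ∷ y ∷ [])     a b ys =
  trans (ℤ-+-congˡ (weight x y a) (winding-++ (y ∷ []) a b ys))
        (sym (ℤ.+-assoc (weight x y a) (winding (y ∷ a ∷ b ∷ [])) (winding (a ∷ b ∷ ys))))
winding-++ (x ∷ xs@(y ∷ z ∷ zs)) a b ys =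
  trans (ℤ-+-congˡ (weight x y z) (winding-++ xs a b ys))
        (sym (ℤ.+-assoc (weight x y z) (winding (xs ++ a ∷ b ∷ [])) (winding (a ∷ b ∷ ys))))

-- The slit and the edges that leave X

Slit : V → Set
Slit (p , q) = p ℤ.≤ 0ℤ × p ℤ.- 1ℤ ℤ.≤ q × q ℤ.≤ 1ℤ ℤ.- p

slit : ∀ {v} → ¬ X v → Slit v
slit {p , q} = decidable-stable ((p ℤ.≤? 0ℤ) ×-dec (p ℤ.- 1ℤ ℤ.≤? q) ×-dec (q ℤ.≤? 1ℤ ℤ.- p))

o : V
o = 0ℤ , 0ℤ

o∉X : ¬ X o
o∉X x = x (ℤ.≤-refl , ℤ.-≤+ , ℤ.+≤+ ℕ.z≤n)

octant-west : ∀ x y → octant x y ≡ 4F → x ℤ.≤ 0ℤ × y ≡ 0ℤ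
octant-west -[1+ _ ]  (+ zero)  _  = ℤ.-≤+ , refl
octant-west (+ zero)  (+ zero)  ()
octant-west (+ zero)  (+ suc _) ()
octant-west (+ zero)  -[1+ _ ]  ()
octant-west (+ suc _) (+ zero)  ()
octant-west (+ suc _) (+ suc _) ()
octant-west (+ suc _) -[1+ _ ]  ()
octant-west -[1+ _ ]  (+ suc _) ()
octant-west -[1+ _ ]  -[1+ _ ]  ()

-- The slit contains the ray from each of its points to the west.

bearing-west : ∀ {z u} → ¬ X z → X u → bearing z u ≢ 4F
bearing-west {p , q} {p′ , q′} z u eq with slit z | octant-west (p′ ℤ.- p) (q′ ℤ.- q) eq
... | p≤0 , p-1≤q , q≤1-p | p′-p≤0 , q′-q≡0 with refl ← ℤ.i-j≡0⇒i≡j q′ q q′-q≡0 =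
  u ( ℤ.≤-trans p′≤p p≤0
    , ℤ.≤-trans (ℤ.+-monoˡ-≤ -1ℤ p′≤p) p-1≤q
    , ℤ.≤-trans q≤1-p (ℤ.+-monoʳ-≤ 1ℤ (ℤ.neg-mono-≤ p′≤p)))
  where
  p′≤p : p′ ℤ.≤ p
  p′≤p = ℤ.i-j≤0⇒i≤j p′-p≤0

exponent : List V → ℤ
exponent w = + 8 ℤ.* + direction w ℤ.+ winding w

-- The edges at which a walk leaves X, except a.

data Exit : V → V → Set where
  upper : ∀ p → p ℤ.≤ 0ℤ → Exit (p , 1ℤ ℤ.- p) (up (p , 1ℤ ℤ.- p))
  lower : ∀ p → p ℤ.≤ 0ℤ → Exit (p , p ℤ.- 1ℤ) (down (p , p ℤ.- 1ℤ))

-- At the upper side the final direction is 1 and the winding number 4, with 8 · 1 + 4 = 12; at the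
-- lower side they are 5 and -4, with 8 · 5 - 4 = 36. The difference 24 is the sign -1.
exit-exponent : ∀ {z y} → Exit z y → ℤ
exit-exponent (upper _ _) = + 12
exit-exponent (lower _ _) = + 36

exit-parity : ∀ {z y} → Exit z y → Parity false z
exit-parity (upper p _) = ⟨ ℤ.divides p (lemma p) ⟩
  where
  lemma : ∀ p → p ℤ.- (1ℤ ℤ.- p) ℤ.+ 1ℤ ≡ p ℤ.* + 2
  lemma = solve-∀
exit-parity (lower p _) = ⟨ ℤ.divides 1ℤ (lemma p) ⟩
  where
  lemma : ∀ p → p ℤ.- (p ℤ.- 1ℤ) ℤ.+ 1ℤ ≡ 1ℤ ℤ.* + 2
  lemma = solve-∀

exit-adj : ∀ {z y} → Exit z y → Adj z y
exit-adj ex@(upper _ _) = adj-step (exit-parity ex) (here refl)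
exit-adj ex@(lower _ _) = adj-step (exit-parity ex) (there (here refl))

-- The walk starts to the east and ends to the south by way of north and west, or the mirror image
-- of this: three quarters of a turn.
exit-rotation : ∀ {z y} → Exit z y → ℤ
exit-rotation (upper _ _) = + 6
exit-rotation (lower _ _) = ℤ.- + 6

-- The first summand is the sweep seen from `o`, which starts in the east; the second is the sweep
-- seen from `z`, from `o` to `y`.
exit-bearings : ∀ {z y} (ex : Exit z y) →
  (principal (bearing o z) ℤ.- 0ℤ) ℤ.+ (principal (bearing z y) ℤ.- principal (bearing z o)) ≡ exit-rotation ex
exit-bearings (upper p p≤0) rewrite bearing-step north (p , 1ℤ ℤ.- p) = lemma p p≤0
  where
  lemma : ∀ p → p ℤ.≤ 0ℤ →
    (principal (bearing o (p , 1ℤ ℤ.- p)) ℤ.- 0ℤ) ℤ.+ (+ 2 ℤ.- principal (bearing (p , 1ℤ ℤ.- p) o)) ≡ + 6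
  lemma (+ zero)  _ = refl
  lemma -[1+ n ]  _ = refl
  lemma (+ suc _) (ℤ.+≤+ ())
exit-bearings (lower p p≤0) rewrite bearing-step south (p , p ℤ.- 1ℤ) = lemma p p≤0
  where
  lemma : ∀ p → p ℤ.≤ 0ℤ →
    (principal (bearing o (p , p ℤ.- 1ℤ)) ℤ.- 0ℤ) ℤ.+ (ℤ.- + 2 ℤ.- principal (bearing (p , p ℤ.- 1ℤ) o)) ≡ ℤ.- + 6
  lemma (+ zero)  _ = refl
  lemma -[1+ n ]  _ = refl
  lemma (+ suc _) (ℤ.+≤+ ())

exit-slit : ∀ {z y} → Exit z y → ¬ X z
exit-slit (upper p p≤0) x = x (p≤0 , lemma , ℤ.≤-refl)
  where
  lemma : p ℤ.- 1ℤ ℤ.≤ 1ℤ ℤ.- p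
  lemma = ℤ.≤-trans (ℤ.+-monoˡ-≤ -1ℤ p≤0) (ℤ.≤-trans ℤ.-≤+ (ℤ.+-monoʳ-≤ 1ℤ (ℤ.neg-mono-≤ p≤0)))
exit-slit (lower p p≤0) x = x (p≤0 , ℤ.≤-refl , lemma)
  where
  lemma : p ℤ.- 1ℤ ℤ.≤ 1ℤ ℤ.- p
  lemma = ℤ.≤-trans (ℤ.+-monoˡ-≤ -1ℤ p≤0) (ℤ.≤-trans ℤ.-≤+ (ℤ.+-monoʳ-≤ 1ℤ (ℤ.neg-mono-≤ p≤0)))

exit-west : ∀ {z y} → Exit z y → bearing o z ≢ 4F × bearing z o ≢ 4F
exit-west (upper p p≤0) = lemma p p≤0
  where
  lemma : ∀ p → p ℤ.≤ 0ℤ → bearing o (p , 1ℤ ℤ.- p) ≢ 4F × bearing (p , 1ℤ ℤ.- p) o ≢ 4F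
  lemma (+ zero)  _ = (λ ()) , (λ ())
  lemma -[1+ n ]  _ = (λ ()) , (λ ())
  lemma (+ suc _) (ℤ.+≤+ ())
exit-west (lower p p≤0) = lemma p p≤0
  where
  lemma : ∀ p → p ℤ.≤ 0ℤ → bearing o (p , p ℤ.- 1ℤ) ≢ 4F × bearing (p , p ℤ.- 1ℤ) o ≢ 4F
  lemma (+ zero)  _ = (λ ()) , (λ ())
  lemma -[1+ n ]  _ = (λ ()) , (λ ())
  lemma (+ suc _) (ℤ.+≤+ ())

exit-tilt : ∀ {z y} (ex : Exit z y) →
  + 32 ℤ.* + ℓ z y ℤ.+ (+ 3 ℤ.* exit-rotation ex ℤ.+ tilt y z) ≡ + 4 ℤ.* exit-exponent ex
exit-tilt {z} ex@(upper _ _) =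
  cong₂ (λ i t → + 32 ℤ.* + i ℤ.+ (+ 18 ℤ.+ t)) (ℓ-step {d = north} (exit-parity ex) (here refl))
    (tilt-unstep {d = north} (exit-parity ex) (here refl))
exit-tilt {z} ex@(lower _ _) =
  cong₂ (λ i t → + 32 ℤ.* + i ℤ.+ (ℤ.- + 18 ℤ.+ t)) (ℓ-step {d = south} (exit-parity ex) (there (here refl)))
    (tilt-unstep {d = south} (exit-parity ex) (there (here refl)))

-- A step to the west stays in the slit, and a step up or down leaves it only from one of its two
-- sides. A step to the east starts at an even vertex, hence strictly between the sides, whose
-- vertices are odd; from there only the tip `o` leads into X.
exit : ∀ {z y} → ¬ X z → X y → Adj z y → Exit z y ⊎ (z ≡ o × y ≡ right o)
exit {z} {y} nz xy zy
  with e , h ← parity z with d , i , refl ← step-adj h zy with slit nz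
... | p≤0 , l , r = go e h d i xy
  where
  p = proj₁ z
  q = proj₂ z
  <1-p : q ≢ 1ℤ ℤ.- p → q ℤ.+ 1ℤ ℤ.≤ 1ℤ ℤ.- p
  <1-p n = subst (λ i → i ℤ.≤ 1ℤ ℤ.- p) (ℤ.+-comm 1ℤ q) (ℤ.i<j⇒suc[i]≤j (ℤ.≤∧≢⇒< r n))
  >p-1 : q ≢ p ℤ.- 1ℤ → p ℤ.- 1ℤ ℤ.≤ q ℤ.- 1ℤ
  >p-1 n = subst (λ i → p ℤ.- 1ℤ ℤ.≤ i) (ℤ.+-comm -1ℤ q) (ℤ.i<j⇒i≤pred[j] (ℤ.≤∧≢⇒< l (n ∘ sym)))
  exit-east : ∀ p q → p ℤ.≤ 0ℤ → p ℤ.- 1ℤ ℤ.≤ q ℤ.- 1ℤ → q ℤ.+ 1ℤ ℤ.≤ 1ℤ ℤ.- p → X (right (p , q)) →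
         Exit (p , q) (right (p , q)) ⊎ ((p , q) ≡ o × right (p , q) ≡ right o)
  exit-east p q p≤0 l r xy with subst₂ ℤ._≤_ (lemma p) (lemma q) (ℤ.+-monoˡ-≤ 1ℤ l)
                         | subst₂ ℤ._≤_ (lemma′ q) (lemma″ p) (ℤ.+-monoˡ-≤ -1ℤ r)
    where
    lemma : ∀ p → p ℤ.- 1ℤ ℤ.+ 1ℤ ≡ p
    lemma = solve-∀
    lemma′ : ∀ p → p ℤ.+ 1ℤ ℤ.- 1ℤ ≡ p
    lemma′ = solve-∀
    lemma″ : ∀ p → 1ℤ ℤ.- p ℤ.- 1ℤ ≡ ℤ.- p
    lemma″ = solve-∀
  exit-east (+ suc _) q (ℤ.+≤+ ()) _ _ xy | _ | _
  exit-east (+ zero)  q p≤0 l r xy | p≤q | q≤-p with refl ← ℤ.≤-antisym q≤-p p≤q = inj₂ (refl , refl)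
  exit-east p@(-[1+ n ]) q p≤0 l r xy | p≤q | q≤-p = contradiction
    ( subst (ℤ._≤ 0ℤ) (ℤ.+-comm 1ℤ p) (ℤ.i<j⇒suc[i]≤j {p} ℤ.-<+)
    , subst (ℤ._≤ q) (lemma p) p≤q , subst (q ℤ.≤_) (lemma′ p) q≤-p) xy
    where
    lemma : ∀ p → p ≡ p ℤ.+ 1ℤ ℤ.- 1ℤ
    lemma = solve-∀
    lemma′ : ∀ p → ℤ.- p ≡ 1ℤ ℤ.- (p ℤ.+ 1ℤ)
    lemma′ = solve-∀
  go : ∀ e → Parity e z → ∀ d → d ∈ dirs e → X (step d z) → Exit z (step d z) ⊎ (z ≡ o × step d z ≡ right o)
  go e h north i xy with q ℤ.≟ 1ℤ ℤ.- p
  ... | yes refl = inj₁ (upper p p≤0)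
  ... | no n     = contradiction (p≤0 , ℤ.≤-trans l (ℤ.i≤i+j q 1ℤ) , <1-p n) xy
  go e h south i xy with q ℤ.≟ p ℤ.- 1ℤ
  ... | yes refl = inj₁ (lower p p≤0)
  ... | no n     = contradiction (p≤0 , >p-1 n , ℤ.≤-trans (ℤ.i-j≤i q 1ℤ) r) xy
  go e h west i xy = contradiction
    ( ℤ.≤-trans (ℤ.i-j≤i p 1ℤ) p≤0
    , ℤ.≤-trans (ℤ.+-monoˡ-≤ -1ℤ (ℤ.i-j≤i p 1ℤ)) l
    , ℤ.≤-trans r (ℤ.+-monoʳ-≤ 1ℤ (ℤ.neg-mono-≤ (ℤ.i-j≤i p 1ℤ)))) xy
  go false h east (there (there (here ()))) xy
  go true h east i xy with q ℤ.≟ 1ℤ ℤ.- p | q ℤ.≟ p ℤ.- 1ℤ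
  ... | yes refl | _        = contradiction (parity-even (exit-parity (upper p p≤0)) h) λ ()
  ... | no _     | yes refl = contradiction (parity-even (exit-parity (lower p p≤0)) h) λ ()
  ... | no n     | no n′    = exit-east p q p≤0 (>p-1 n′) (<1-p n) xy

winding-rotation′ : ∀ a ys z → Linked Adj (a ∷ ys ∷ʳ z) → AllPairs _≢_ (a ∷ ys ∷ʳ z) →
  + 4 ℤ.* winding (a ∷ ys ∷ʳ z) ≡
  + 3 ℤ.* rotation (a ∷ ys ∷ʳ z) ℤ.+ lastTilt (a ∷ ys ∷ʳ z) ℤ.- tilt a (first ys z)
winding-rotation′ a []       z = winding-rotation a z []
winding-rotation′ a (b ∷ ys) z = winding-rotation a b (ys ∷ʳ z)

All-init : ∀ {P : V → Set} xs {z} → All P (xs ∷ʳ z) → All P xs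
All-init []       _        = []
All-init (_ ∷ xs) (p ∷ ps) = p ∷ All-init xs ps

Linked-init : ∀ xs {z} → Linked Adj (xs ∷ʳ z) → Linked Adj xs
Linked-init []           _       = []
Linked-init (_ ∷ [])     _       = [-]
Linked-init (_ ∷ x ∷ xs) (e ∷ l) = e ∷ Linked-init (x ∷ xs) l

Linked-last : ∀ xs {y z} → Linked Adj (xs ∷ʳ y ∷ʳ z) → Adj y z
Linked-last []           (e ∷ _) = e
Linked-last (_ ∷ [])     (_ ∷ l) = Linked-last [] l
Linked-last (_ ∷ x ∷ xs) (_ ∷ l) = Linked-last (x ∷ xs) l

AllPairs-last : ∀ xs {z : V} → AllPairs _≢_ (xs ∷ʳ z) → All (z ≢_) xs
AllPairs-last []       _        = []
AllPairs-last (_ ∷ xs) (n ∷ ns) = (All-last xs n ∘ sym) ∷ AllPairs-last xs ns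

Unique-init : ∀ xs {z : V} → AllPairs _≢_ (xs ∷ʳ z) → AllPairs _≢_ xs
Unique-init []       _       = []
Unique-init (_ ∷ xs) (n ∷ u) = All-init xs n ∷ Unique-init xs u

first-∷ʳ : ∀ xs y z → first (xs ∷ʳ y) z ≡ first xs y
first-∷ʳ []      y z = refl
first-∷ʳ (_ ∷ _) y z = refl

-- By `hopf` the rotation is the sum of the sweeps seen from the two ends `o` and `z`. Both ends are
-- in the slit and see nothing of the walk in the west, so `sweep-principal` evaluates both sweeps.
exit-walk : ∀ {z y} (ex : Exit z y) xs → first xs y ≡ right o →
  Linked Adj (o ∷ xs ∷ʳ y ∷ʳ z) → AllPairs _≢_ (o ∷ xs ∷ʳ y ∷ʳ z) → All X (xs ∷ʳ y) →
  exponent (o ∷ xs ∷ʳ y ∷ʳ z) ≡ exit-exponent ex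
exit-walk {z} {y} ex xs f≡ l u@(o≢ ∷ _) x = ℤ.*-cancelˡ-≡ (+ 4) _ _ (begin
  + 4 ℤ.* (+ 8 ℤ.* + direction w ℤ.+ winding w)
    ≡⟨ distribute (+ direction w) (winding w) ⟩
  + 32 ℤ.* + direction w ℤ.+ + 4 ℤ.* winding w
    ≡⟨ cong₂ (λ d r → + 32 ℤ.* + d ℤ.+ r) (direction-∷ʳ (o ∷ xs) y z)
         (winding-rotation′ o (xs ∷ʳ y) z l u) ⟩
  + 32 ℤ.* + ℓ z y ℤ.+ (+ 3 ℤ.* rotation w ℤ.+ lastTilt w ℤ.- tilt o (first (xs ∷ʳ y) z))
    -- The initial edge `a` points to the east in both drawings, so its tilt is 0.
    ≡⟨ cong (λ t → + 32 ℤ.* + ℓ z y ℤ.+ t) (cong₂ ℤ._-_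
         (cong₂ (λ r t → + 3 ℤ.* r ℤ.+ t) rotation≡ (lastTilt-∷ʳ (o ∷ xs) y z))
         (cong (tilt o) f≡′)) ⟩
  + 32 ℤ.* + ℓ z y ℤ.+ (+ 3 ℤ.* exit-rotation ex ℤ.+ tilt y z ℤ.- 0ℤ)
    ≡⟨ cong (λ t → + 32 ℤ.* + ℓ z y ℤ.+ t) (ℤ.+-identityʳ _) ⟩
  + 32 ℤ.* + ℓ z y ℤ.+ (+ 3 ℤ.* exit-rotation ex ℤ.+ tilt y z)
    ≡⟨ exit-tilt ex ⟩
  + 4 ℤ.* exit-exponent ex ∎)
  where
  open ≡-Reasoning
  w = o ∷ xs ∷ʳ y ∷ʳ z
  distribute : ∀ d r → + 4 ℤ.* (+ 8 ℤ.* d ℤ.+ r) ≡ + 32 ℤ.* d ℤ.+ + 4 ℤ.* r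
  distribute = solve-∀
  f≡′ : first (xs ∷ʳ y) z ≡ right o
  f≡′ = trans (first-∷ʳ xs y z) f≡
  All-∷ʳ : ∀ {P : V → Set} xs {z} → All P xs → P z → All P (xs ∷ʳ z)
  All-∷ʳ []       []       p = p ∷ []
  All-∷ʳ (_ ∷ xs) (q ∷ qs) p = q ∷ All-∷ʳ xs qs p
  sweep-o : sweep o (xs ∷ʳ y ∷ʳ z) ≡ principal (bearing o z) ℤ.- 0ℤ
  sweep-o = trans
    (sweep-principal (xs ∷ʳ y) z (Linked.tail l) o≢
      (All-∷ʳ (xs ∷ʳ y) (All.map (bearing-west o∉X) x) (proj₁ (exit-west ex))))
    (cong (λ i → principal (bearing o z) ℤ.- principal (bearing o i)) f≡′)
  sweep-z : sweep z (o ∷ xs ∷ʳ y) ≡ principal (bearing z y) ℤ.- principal (bearing z o)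
  sweep-z = sweep-principal (o ∷ xs) y (Linked-init (o ∷ xs ∷ʳ y) l) (AllPairs-last (o ∷ xs ∷ʳ y) u)
    (proj₂ (exit-west ex) ∷ All.map (bearing-west (exit-slit ex)) x)
  rotation≡ : rotation w ≡ exit-rotation ex
  rotation≡ = trans (hopf o (xs ∷ʳ y) z l u) (trans (cong₂ ℤ._+_ sweep-o sweep-z) (exit-bearings ex))

-- The number of turns of a closed path around a point is constant while the point moves without
-- meeting the path: the two end rungs of a closed strip coincide and cancel.
sweep-closed : ∀ pre u v zs → Linked Adj (pre ∷ʳ u) → Linked Adj (v ∷ zs ∷ʳ v) →
  All (λ b → All (b ≢_) (v ∷ zs ∷ʳ v)) (pre ∷ʳ u) →
  sweep (first pre u) (v ∷ zs ∷ʳ v) ≡ sweep u (v ∷ zs ∷ʳ v)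
sweep-closed []           u v zs _ _ _ = refl
sweep-closed (b ∷ pre) u v zs l c (n ∷ ns) = trans
  (∙-cancelʳ κv _ _ (trans (sweep-strip (v ∷ zs) v (edge pre l) c n (head pre ns)) (ℤ.+-comm κv _)))
  (sweep-closed pre u v zs (Linked.tail l) c ns)
  where
  b′ = first pre u
  κv = κ (bearing b v) (bearing b′ v)
  edge : ∀ pre → Linked Adj (b ∷ pre ∷ʳ u) → Adj b (first pre u)
  edge []      (e ∷ _) = e
  edge (_ ∷ _) (e ∷ _) = e
  head : ∀ {P : V → Set} pre → All P (pre ∷ʳ u) → P (first pre u)
  head []      (p ∷ _) = p
  head (_ ∷ _) (p ∷ _) = p

sweep-o-closed : ∀ v zs → Linked Adj (v ∷ zs ∷ʳ v) → All X (v ∷ zs ∷ʳ v) → sweep o (v ∷ zs ∷ʳ v) ≡ 0ℤ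
sweep-o-closed v zs l x = trans
  (sweep-principal (v ∷ zs) v l (All.map (λ { x refl → o∉X x }) x) (All.map (bearing-west o∉X) x))
  (ℤ.+-inverseʳ (principal (bearing o v)))

-- A self-avoiding walk u v l₁ … lₖ returns to v, and the loop does not wind
-- around u.

lasso-turn : ∀ u v l₁ ms lₖ → Adj u v → Linked Adj (v ∷ l₁ ∷ (ms ∷ʳ lₖ) ∷ʳ v) →
  All (u ≢_) (v ∷ l₁ ∷ (ms ∷ʳ lₖ) ∷ʳ v) → AllPairs _≢_ (l₁ ∷ (ms ∷ʳ lₖ) ∷ʳ v) →
  sweep u (v ∷ l₁ ∷ (ms ∷ʳ lₖ) ∷ʳ v) ≡ 0ℤ →
  turn u v l₁ ℤ.+ (turn v l₁ (first ms lₖ) ℤ.+ rotation (l₁ ∷ (ms ∷ʳ lₖ) ∷ʳ v)) ≡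
  + 2 ℤ.* turn u v lₖ ℤ.- turn u v l₁ ℤ.+ turn lₖ v l₁
lasso-turn u v l₁ ms lₖ uv (vl ∷ l) (u≢v ∷ u≢) d@(l₁≢ ∷ d′) closed =
  -- The whole walk meets itself, so `hopf` is applied to the path l₁ ... lₖ v only. The hypotheses
  -- of `combine` are, in order: the closed sweep seen from `u`, the strip from `u` to `v`, the
  -- first step of the sweep seen from `v`, the strip from `l₁` to `v`, `hopf`, and the reversal of
  -- the secants in `turn lₖ v l₁`.
  combine (κ (bearing u v) (bearing u l₁)) (κ (bearing u l₁) (bearing v l₁))
          (κ (bearing v l₁) (bearing v l₂)) (κ (bearing v l₂) (bearing l₁ l₂))
          (κ (bearing u v) (bearing u lₖ)) (κ (bearing u lₖ) (bearing v lₖ))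
          (κ (bearing v lₖ) (bearing l₁ lₖ)) (κ (bearing l₁ lₖ) (bearing l₁ v))
          (sweep u (l₁ ∷ ms ∷ʳ lₖ)) (sweep v (l₁ ∷ ms ∷ʳ lₖ)) (sweep v (ms ∷ʳ lₖ)) (sweep l₁ (ms ∷ʳ lₖ))
          (rotation (l₁ ∷ (ms ∷ʳ lₖ) ∷ʳ v)) (turn lₖ v l₁)
    (trans (cong (λ s → κ (bearing u v) (bearing u l₁) ℤ.+ s)
       (trans (cong (λ k → sweep u (l₁ ∷ ms ∷ʳ lₖ) ℤ.+ k) (sym (κ-sym (bearing u v) (bearing u lₖ))))
              (sym (sweep-∷ʳ u (l₁ ∷ ms) lₖ v))))
       closed)
    (sweep-strip (l₁ ∷ ms) lₖ uv l′ (All-init (l₁ ∷ ms ∷ʳ lₖ) u≢) v≢)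
    (sweep-∷ v l₁ ms lₖ)
    (trans (cong (λ k → sweep l₁ (ms ∷ʳ lₖ) ℤ.+ k) (sym (κ-sym (bearing v lₖ) (bearing l₁ lₖ))))
      (trans (sweep-strip ms lₖ (adj-sym vl) (Linked.tail l′) (All-init (ms ∷ʳ lₖ) l₁≢) (All.tail v≢))
        (cong (λ k → k ℤ.+ sweep v (ms ∷ʳ lₖ)) (κ-sym (bearing v l₂) (bearing l₁ l₂)))))
    (trans (hopf l₁ (ms ∷ʳ lₖ) v l d)
      (cong (λ s → s ℤ.+ sweep v (l₁ ∷ ms ∷ʳ lₖ)) (sweep-∷ʳ l₁ ms lₖ v)))
    (cong₂ ℤ._+_ (κ-bearing-opposite v≢lₖ l₁≢lₖ) (κ-bearing-opposite l₁≢lₖ (All-last (ms ∷ʳ lₖ) l₁≢)))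
  where
  l₂ = first ms lₖ
  l′ : Linked Adj (l₁ ∷ ms ∷ʳ lₖ)
  l′ = Linked-init (l₁ ∷ ms ∷ʳ lₖ) l
  v≢ : All (v ≢_) (l₁ ∷ ms ∷ʳ lₖ)
  v≢ = AllPairs-last (l₁ ∷ ms ∷ʳ lₖ) d
  v≢lₖ : v ≢ lₖ
  v≢lₖ = All-last (l₁ ∷ ms) v≢
  l₁≢lₖ : l₁ ≢ lₖ
  l₁≢lₖ = All-last ms (All-init (ms ∷ʳ lₖ) l₁≢)
  combine : ∀ a b c c′ e f g h su sv sv′ sl r t →
    a ℤ.+ (su ℤ.- e) ≡ 0ℤ → su ℤ.+ f ≡ b ℤ.+ sv → sv ≡ c ℤ.+ sv′ → sl ℤ.- g ≡ ℤ.- c′ ℤ.+ sv′ →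
    r ≡ sl ℤ.+ h ℤ.+ sv → t ≡ g ℤ.+ h →
    (a ℤ.+ b) ℤ.+ ((c ℤ.+ c′) ℤ.+ r) ≡ + 2 ℤ.* (e ℤ.+ f) ℤ.- (a ℤ.+ b) ℤ.+ t
  combine a b c c′ e f g h su sv sv′ sl r t h₁ h₂ h₃ h₄ refl refl = ℤ.i-j≡0⇒i≡j _ _
    (trans (lemma a b c c′ e f g h su sv sv′ sl)
      (cong₂ (λ i j → i ℤ.+ j) (cong₂ (λ i j → + 2 ℤ.* i ℤ.- + 2 ℤ.* j) h₁ (ℤ.i≡j⇒i-j≡0 h₂))
        (cong₂ (λ i j → i ℤ.- j) (ℤ.i≡j⇒i-j≡0 h₄) (ℤ.i≡j⇒i-j≡0 h₃))))
    where
    lemma : ∀ a b c c′ e f g h su sv sv′ sl →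
      ((a ℤ.+ b) ℤ.+ ((c ℤ.+ c′) ℤ.+ (sl ℤ.+ h ℤ.+ sv))) ℤ.- (+ 2 ℤ.* (e ℤ.+ f) ℤ.- (a ℤ.+ b) ℤ.+ (g ℤ.+ h)) ≡
      (+ 2 ℤ.* (a ℤ.+ (su ℤ.- e)) ℤ.- + 2 ℤ.* ((su ℤ.+ f) ℤ.- (b ℤ.+ sv))) ℤ.+
      (((sl ℤ.- g) ℤ.- (ℤ.- c′ ℤ.+ sv′)) ℤ.- (sv ℤ.- (c ℤ.+ sv′)))
    lemma = solve-∀

-- This is the Umlaufsatz with its sign. Replacing the hook at `v` from `u` by the one from `lₖ`
-- gives the winding number of the closed loop, 2 (`weight u v lₖ` - `weight u v l₁` +
-- `weight lₖ v l₁`). It is 6 or -6, according to the cyclic order of the three edges at `v`. In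
-- this form the effect of reversing the loop is a finite check.
lasso-winding : ∀ u v l₁ ms lₖ → Adj u v → Linked Adj (v ∷ l₁ ∷ (ms ∷ʳ lₖ) ∷ʳ v) →
  All (u ≢_) (v ∷ l₁ ∷ (ms ∷ʳ lₖ) ∷ʳ v) → AllPairs _≢_ (l₁ ∷ (ms ∷ʳ lₖ) ∷ʳ v) →
  sweep u (v ∷ l₁ ∷ (ms ∷ʳ lₖ) ∷ʳ v) ≡ 0ℤ →
  winding (u ∷ v ∷ l₁ ∷ (ms ∷ʳ lₖ) ∷ʳ v) ≡
  + 2 ℤ.* weight u v lₖ ℤ.- weight u v l₁ ℤ.+ weight lₖ v l₁
lasso-winding u v l₁ ms lₖ uv l@(vl ∷ l′) u≢@(u≢v ∷ u≢l₁ ∷ u≢′) d@(l₁≢ ∷ d′) closed =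
  ℤ.*-cancelˡ-≡ (+ 4) _ _ (trans (cong (+ 4 ℤ.*_) (winding-∷ ms))
    (combine (weight u v l₁) (weight v l₁ l₂) (winding loop) (weight u v lₖ) (weight lₖ v l₁)
       (turn u v l₁) (turn v l₁ l₂) (rotation loop) (turn u v lₖ) (turn lₖ v l₁)
       (tilt u v) (tilt v l₁) (tilt l₁ l₂) (tilt lₖ v)
       (weight-turn uv vl u≢l₁)
       (weight-turn vl l₁l₂ (first-last ms v≢))
       (trans (winding-rotation′ l₁ (ms ∷ʳ lₖ) v l′ d)
         (cong₂ (λ t t′ → + 3 ℤ.* rotation loop ℤ.+ t ℤ.- t′) (lastTilt-∷ʳ (l₁ ∷ ms) lₖ v)
           (cong (tilt l₁) (first-∷ʳ ms lₖ v))))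
       (trans (weight-turn uv (adj-sym lv) u≢lₖ)
         (cong (λ t → + 3 ℤ.* turn u v lₖ ℤ.+ t ℤ.- tilt u v) (tilt-sym (adj-sym lv))))
       (weight-turn lv vl lₖ≢l₁)
       (lasso-turn u v l₁ ms lₖ uv l u≢ d closed)))
  where
  l₂ = first ms lₖ
  loop = l₁ ∷ (ms ∷ʳ lₖ) ∷ʳ v
  v≢ : All (v ≢_) (ms ∷ʳ lₖ)
  v≢ = All.tail (AllPairs-last (l₁ ∷ ms ∷ʳ lₖ) d)
  first-last : ∀ {P : V → Set} ms {z} → All P (ms ∷ʳ z) → P (first ms z)
  first-last []      (p ∷ _) = p
  first-last (_ ∷ _) (p ∷ _) = p
  first-edge : ∀ ms {z zs} → Linked Adj (l₁ ∷ (ms ∷ʳ z) ∷ʳ zs) → Adj l₁ (first ms z)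
  first-edge []      (e ∷ _) = e
  first-edge (_ ∷ _) (e ∷ _) = e
  l₁l₂ = first-edge ms l′
  lv = Linked-last (l₁ ∷ ms) l′
  u≢lₖ = All-last ms (All-init (ms ∷ʳ lₖ) u≢′)
  lₖ≢l₁ = All-last ms (All-init (ms ∷ʳ lₖ) l₁≢) ∘ sym
  winding-∷ : ∀ ms → winding (u ∷ v ∷ l₁ ∷ (ms ∷ʳ lₖ) ∷ʳ v) ≡
    weight u v l₁ ℤ.+ (weight v l₁ (first ms lₖ) ℤ.+ winding (l₁ ∷ (ms ∷ʳ lₖ) ∷ʳ v))
  winding-∷ []      = refl
  winding-∷ (_ ∷ _) = refl
  combine : ∀ w₁ w₂ w w₃ w₄ t₁ t₂ r t₃ t₄ a b c e →
    + 4 ℤ.* w₁ ≡ + 3 ℤ.* t₁ ℤ.+ b ℤ.- a → + 4 ℤ.* w₂ ≡ + 3 ℤ.* t₂ ℤ.+ c ℤ.- b →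
    + 4 ℤ.* w ≡ + 3 ℤ.* r ℤ.+ e ℤ.- c → + 4 ℤ.* w₃ ≡ + 3 ℤ.* t₃ ℤ.+ e ℤ.- a →
    + 4 ℤ.* w₄ ≡ + 3 ℤ.* t₄ ℤ.+ b ℤ.- e →
    t₁ ℤ.+ (t₂ ℤ.+ r) ≡ + 2 ℤ.* t₃ ℤ.- t₁ ℤ.+ t₄ →
    + 4 ℤ.* (w₁ ℤ.+ (w₂ ℤ.+ w)) ≡ + 4 ℤ.* (+ 2 ℤ.* w₃ ℤ.- w₁ ℤ.+ w₄)
  combine w₁ w₂ w w₃ w₄ t₁ t₂ r t₃ t₄ a b c e h₁ h₂ h h₃ h₄ ht = begin
    + 4 ℤ.* (w₁ ℤ.+ (w₂ ℤ.+ w))                   ≡⟨ distribute w₁ w₂ w ⟩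
    + 4 ℤ.* w₁ ℤ.+ (+ 4 ℤ.* w₂ ℤ.+ + 4 ℤ.* w)     ≡⟨ cong₂ ℤ._+_ h₁ (cong₂ ℤ._+_ h₂ h) ⟩
    (+ 3 ℤ.* t₁ ℤ.+ b ℤ.- a) ℤ.+ ((+ 3 ℤ.* t₂ ℤ.+ c ℤ.- b) ℤ.+ (+ 3 ℤ.* r ℤ.+ e ℤ.- c))
                                                  ≡⟨ middle t₁ t₂ r a b c e ⟩
    + 3 ℤ.* (t₁ ℤ.+ (t₂ ℤ.+ r)) ℤ.+ (e ℤ.- a)     ≡⟨ cong (λ t → + 3 ℤ.* t ℤ.+ (e ℤ.- a)) ht ⟩
    + 3 ℤ.* (+ 2 ℤ.* t₃ ℤ.- t₁ ℤ.+ t₄) ℤ.+ (e ℤ.- a)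
                                                  ≡⟨ middle′ t₁ t₃ t₄ a b e ⟩
    + 2 ℤ.* (+ 3 ℤ.* t₃ ℤ.+ e ℤ.- a) ℤ.- (+ 3 ℤ.* t₁ ℤ.+ b ℤ.- a) ℤ.+ (+ 3 ℤ.* t₄ ℤ.+ b ℤ.- e)
      ≡⟨ cong₂ ℤ._+_ (cong₂ (λ i j → + 2 ℤ.* i ℤ.- j) h₃ h₁) h₄ ⟨
    + 2 ℤ.* (+ 4 ℤ.* w₃) ℤ.- + 4 ℤ.* w₁ ℤ.+ + 4 ℤ.* w₄
                                                  ≡⟨ right′ w₁ w₃ w₄ ⟩
    + 4 ℤ.* (+ 2 ℤ.* w₃ ℤ.- w₁ ℤ.+ w₄) ∎
    where
    open ≡-Reasoning
    distribute : ∀ i j k → + 4 ℤ.* (i ℤ.+ (j ℤ.+ k)) ≡ + 4 ℤ.* i ℤ.+ (+ 4 ℤ.* j ℤ.+ + 4 ℤ.* k)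
    distribute = solve-∀
    middle : ∀ t₁ t₂ r a b c e →
      (+ 3 ℤ.* t₁ ℤ.+ b ℤ.- a) ℤ.+ ((+ 3 ℤ.* t₂ ℤ.+ c ℤ.- b) ℤ.+ (+ 3 ℤ.* r ℤ.+ e ℤ.- c)) ≡
      + 3 ℤ.* (t₁ ℤ.+ (t₂ ℤ.+ r)) ℤ.+ (e ℤ.- a)
    middle = solve-∀
    middle′ : ∀ t₁ t₃ t₄ a b e → + 3 ℤ.* (+ 2 ℤ.* t₃ ℤ.- t₁ ℤ.+ t₄) ℤ.+ (e ℤ.- a) ≡
      + 2 ℤ.* (+ 3 ℤ.* t₃ ℤ.+ e ℤ.- a) ℤ.- (+ 3 ℤ.* t₁ ℤ.+ b ℤ.- a) ℤ.+ (+ 3 ℤ.* t₄ ℤ.+ b ℤ.- e)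
    middle′ = solve-∀
    right′ : ∀ w₁ w₃ w₄ → + 2 ℤ.* (+ 4 ℤ.* w₃) ℤ.- + 4 ℤ.* w₁ ℤ.+ + 4 ℤ.* w₄ ≡
      + 4 ℤ.* (+ 2 ℤ.* w₃ ℤ.- w₁ ℤ.+ w₄)
    right′ = solve-∀

-- Exponents of extended walks and of reversed loops

branchᴰ : Bool → Dir → Dir → ℤ
branchᴰ e d d′ = + 8 ℤ.* + ℓᴰ (not e) (back d′) ℤ.+ weightᴰ e d d′

-- A left turn changes the exponent by 9 ≡ 8 · 4 + 8 · 3 + 1, a right turn
-- by 39 ≡ 8 · 2 + 8 · 3 - 1.

data Turns (k i j : ℤ) : Set where
  left-right : i ≅ k ℤ.+ + 9 [mod 48 ] → j ≅ k ℤ.+ + 39 [mod 48 ] → Turns k i j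
  right-left : i ≅ k ℤ.+ + 39 [mod 48 ] → j ≅ k ℤ.+ + 9 [mod 48 ] → Turns k i j

turns? : ∀ e d d₁ d₂ → Dec (Turns (+ 8 ℤ.* + ℓᴰ e d) (branchᴰ e d d₁) (branchᴰ e d d₂))
turns? e d d₁ d₂ = map′ [ uncurry left-right , uncurry right-left ]′
  (λ { (left-right l r) → inj₁ (l , r) ; (right-left r l) → inj₂ (r , l) })
  (  (branchᴰ e d d₁ ≅? + 8 ℤ.* + ℓᴰ e d ℤ.+ + 9 [mod 48 ])
       ×-dec (branchᴰ e d d₂ ≅? + 8 ℤ.* + ℓᴰ e d ℤ.+ + 39 [mod 48 ])
   ⊎-dec (branchᴰ e d d₁ ≅? + 8 ℤ.* + ℓᴰ e d ℤ.+ + 39 [mod 48 ])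
       ×-dec (branchᴰ e d d₂ ≅? + 8 ℤ.* + ℓᴰ e d ℤ.+ + 9 [mod 48 ]))

branchesᴰ : ∀ e {d} → d ∈ dirs e → ∃₂ λ d₁ d₂ →
  filter (λ d′ → ¬? (d′ ≟ᴰ d)) (dirs e) ≡ d₁ ∷ d₂ ∷ [] ×
  Turns (+ 8 ℤ.* + ℓᴰ e d) (branchᴰ e d d₁) (branchᴰ e d d₂)
branchesᴰ true  (here refl)                 = east , south , refl , from-yes (turns? true north east south)
branchesᴰ true  (there (here refl))         = north , south , refl , from-yes (turns? true east north south)
branchesᴰ true  (there (there (here refl))) = north , east , refl , from-yes (turns? true south north east)
branchesᴰ false (here refl)                 = south , west , refl , from-yes (turns? false north south west)
branchesᴰ false (there (here refl))         = north , west , refl , from-yes (turns? false south north west)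
branchesᴰ false (there (there (here refl))) = north , south , refl , from-yes (turns? false west north south)

branch : V → V → V → ℤ
branch a b c = + 8 ℤ.* + ℓ c b ℤ.+ weight a b c

branch-step : ∀ {e d d′ b} → Parity e b → d′ ∈ dirs e → branch (step d b) b (step d′ b) ≡ branchᴰ e d d′
branch-step {e} {d} {d′} {b} h i = cong₂ (λ j k → + 8 ℤ.* + j ℤ.+ k) (ℓ-unstep h i) (weight-step h d d′)

branches-step : ∀ {e d b} → Parity e b → d ∈ dirs e → ∃₂ λ c₁ c₂ →
  filter (λ c → ¬? (c ≟ⱽ step d b)) (neighbours b) ≡ c₁ ∷ c₂ ∷ [] ×
  Turns (+ 8 ℤ.* + ℓ b (step d b)) (branch (step d b) b c₁) (branch (step d b) b c₂)
branches-step {e} {d} {b} h i = let d₁ , d₂ , eq , turns = branchesᴰ e i in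
  step d₁ b , step d₂ b ,
  trans (cong (filter (λ c → ¬? (c ≟ⱽ step d b))) (neighbours-step h))
    (trans (filter-step (dirs e)) (cong (map (λ d′ → step d′ b)) eq)) ,
  subst₂ (Turns _) (sym (branch-step h (other eq (here refl)))) (sym (branch-step h (other eq (there (here refl)))))
    (subst (λ l → Turns (+ 8 ℤ.* + l) (branchᴰ e d d₁) (branchᴰ e d d₂)) (sym (ℓ-step h i)) turns)
  where
  other : ∀ {ds d′} → filter (λ d′ → ¬? (d′ ≟ᴰ d)) (dirs e) ≡ ds → d′ ∈ ds → d′ ∈ dirs e
  other eq j = proj₁ (∈-filter⁻ (λ d′ → ¬? (d′ ≟ᴰ d)) (subst (_ ∈_) (sym eq) j))
  filter-step : ∀ ds → filter (λ c → ¬? (c ≟ⱽ step d b)) (map (λ d′ → step d′ b) ds) ≡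
                       map (λ d′ → step d′ b) (filter (λ d′ → ¬? (d′ ≟ᴰ d)) ds)
  filter-step [] = refl
  filter-step (d′ ∷ ds) with d′ ≟ᴰ d
  ... | yes refl = trans (List.filter-reject (λ c → ¬? (c ≟ⱽ step d b)) (λ n → n refl)) (filter-step ds)
  ... | no n     = trans (List.filter-accept (λ c → ¬? (c ≟ⱽ step d b)) (n ∘ step-injective {v = b}))
                         (cong (step d′ b ∷_) (filter-step ds))

branches : ∀ {a b} → Adj b a → ∃₂ λ c₁ c₂ →
  filter (λ c → ¬? (c ≟ⱽ a)) (neighbours b) ≡ c₁ ∷ c₂ ∷ [] ×
  Turns (+ 8 ℤ.* + ℓ b a) (branch a b c₁) (branch a b c₂)
branches {a} {b} ba = let e , h = parity b; d , i , eq = step-adj h ba in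
  subst (λ a → ∃₂ λ c₁ c₂ → filter (λ c → ¬? (c ≟ⱽ a)) (neighbours b) ≡ c₁ ∷ c₂ ∷ [] ×
                 Turns (+ 8 ℤ.* + ℓ b a) (branch a b c₁) (branch a b c₂))
    (sym eq) (branches-step h i)

loopᴰ : Bool → Dir → Dir → Dir → ℤ
loopᴰ e d d₁ dₖ = + 8 ℤ.* + ℓᴰ e dₖ ℤ.+ (+ 2 ℤ.* weightᴰ e d dₖ ℤ.- weightᴰ e d d₁ ℤ.+ weightᴰ e dₖ d₁)

-- Reversal changes the winding number from -4 to 4 and the direction by 2 modulo 6, or both the
-- other way round: 8 + 8 · 2 = 24, which is congruent to -24.
loopᴰ-reverse : ∀ e {d d₁ dₖ} → d ∈ dirs e → d₁ ∈ dirs e → dₖ ∈ dirs e → d ≢ d₁ → d ≢ dₖ → d₁ ≢ dₖ →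
                loopᴰ e d dₖ d₁ ≅ loopᴰ e d d₁ dₖ ℤ.+ + 24 [mod 48 ]
loopᴰ-reverse e i i₁ iₖ = All.lookup (All.lookup (All.lookup (table e) i) i₁) iₖ
  where
  P : Bool → Dir → Dir → Dir → Set
  P e d d₁ dₖ = d ≢ d₁ → d ≢ dₖ → d₁ ≢ dₖ → loopᴰ e d dₖ d₁ ≅ loopᴰ e d d₁ dₖ ℤ.+ + 24 [mod 48 ]
  P? : ∀ e d d₁ dₖ → Dec (P e d d₁ dₖ)
  P? e d d₁ dₖ = ¬? (d ≟ᴰ d₁) →-dec ¬? (d ≟ᴰ dₖ) →-dec ¬? (d₁ ≟ᴰ dₖ) →-dec
    (loopᴰ e d dₖ d₁ ≅? loopᴰ e d d₁ dₖ ℤ.+ + 24 [mod 48 ])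
  all? : ∀ e → Dec (All (λ d → All (λ d₁ → All (P e d d₁) (dirs e)) (dirs e)) (dirs e))
  all? e = All.all? (λ d → All.all? (λ d₁ → All.all? (P? e d d₁) (dirs e)) (dirs e)) (dirs e)
  table : ∀ e → All (λ d → All (λ d₁ → All (P e d d₁) (dirs e)) (dirs e)) (dirs e)
  table true  = from-yes (all? true)
  table false = from-yes (all? false)

loop : V → V → V → V → ℤ
loop u v l₁ lₖ = + 8 ℤ.* + ℓ v lₖ ℤ.+ (+ 2 ℤ.* weight u v lₖ ℤ.- weight u v l₁ ℤ.+ weight lₖ v l₁)

loop-reverse : ∀ {u v l₁ lₖ} → Adj v u → Adj v l₁ → Adj v lₖ → u ≢ l₁ → u ≢ lₖ → l₁ ≢ lₖ →
               loop u v lₖ l₁ ≅ loop u v l₁ lₖ ℤ.+ + 24 [mod 48 ]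
loop-reverse {u} {v} {l₁} {lₖ} vu vl₁ vlₖ u≢l₁ u≢lₖ l₁≢lₖ =
  let e , h = parity v ; d , i , eq = step-adj h vu
      d₁ , i₁ , eq₁ = step-adj h vl₁ ; dₖ , iₖ , eqₖ = step-adj h vlₖ
  in subst₂ (λ j k → j ≅ k ℤ.+ + 24 [mod 48 ])
    (sym (loop-step h eq eqₖ eq₁ i₁)) (sym (loop-step h eq eq₁ eqₖ iₖ))
    (loopᴰ-reverse e i i₁ iₖ
      (distinct u≢l₁ eq eq₁) (distinct u≢lₖ eq eqₖ) (distinct l₁≢lₖ eq₁ eqₖ))
  where
  distinct : ∀ {u u′ d d′} → u ≢ u′ → u ≡ step d v → u′ ≡ step d′ v → d ≢ d′
  distinct n refl refl refl = n refl
  loop-step : ∀ {e u l l′ d d₁ dₖ} → Parity e v → u ≡ step d v → l ≡ step d₁ v → l′ ≡ step dₖ v → dₖ ∈ dirs e →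
              loop u v l l′ ≡ loopᴰ e d d₁ dₖ
  loop-step {d = d} {d₁} {dₖ} h refl refl refl i = cong₂ (λ j k → + 8 ℤ.* + j ℤ.+ k) (ℓ-step h i)
    (cong₂ ℤ._+_ (cong₂ (λ j k → + 2 ℤ.* j ℤ.- k) (weight-step h d dₖ) (weight-step h d d₁)) (weight-step h dₖ d₁))

-- Walks in the slit plane

Walk : List V → Set
Walk w = ∃ λ t → w ≡ o ∷ right o ∷ t × Linked Adj w × Unique w × All X (right o ∷ t)

Extends : List V → V → Set
Extends w c = ∃ λ xs → ∃₂ λ a b → w ≡ xs ∷ʳ a ∷ʳ b × Adj b c × c ≢ a

Linked-∷ʳ : ∀ xs {y z} → Linked Adj (xs ∷ʳ y) → Adj y z → Linked Adj (xs ∷ʳ y ∷ʳ z)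
Linked-∷ʳ []           [-]     a = a ∷ [-]
Linked-∷ʳ (x ∷ [])     (e ∷ l) a = e ∷ Linked-∷ʳ [] l a
Linked-∷ʳ (x ∷ y ∷ xs) (e ∷ l) a = e ∷ Linked-∷ʳ (y ∷ xs) l a

Linked-extends : ∀ {w c} → Linked Adj w → Extends w c → Linked Adj (w ∷ʳ c)
Linked-extends l (xs , a , b , refl , bc , _) = Linked-∷ʳ (xs ∷ʳ a) l bc

Linked-++ʳ : ∀ xs {ys} → Linked Adj (xs ++ ys) → Linked Adj ys
Linked-++ʳ []       l = l
Linked-++ʳ (x ∷ xs) l = Linked-++ʳ xs (Linked.tail l)

Linked-++ : ∀ xs {y ys} → Linked Adj (xs ∷ʳ y) → Linked Adj (y ∷ ys) → Linked Adj (xs ++ y ∷ ys)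
Linked-++ []           _       l = l
Linked-++ (x ∷ [])     (e ∷ _) l = e ∷ l
Linked-++ (x ∷ y ∷ xs) (e ∷ k) l = e ∷ Linked-++ (y ∷ xs) k l

Linked-++ˡ : ∀ xs {y ys} → Linked Adj (xs ++ y ∷ ys) → Linked Adj (xs ∷ʳ y)
Linked-++ˡ []           _       = [-]
Linked-++ˡ (x ∷ [])     (e ∷ _) = e ∷ [-]
Linked-++ˡ (x ∷ y ∷ xs) (e ∷ l) = e ∷ Linked-++ˡ (y ∷ xs) l

Linked-reverse : ∀ xs → Linked Adj xs → Linked Adj (reverse xs)
Linked-reverse []           _       = []
Linked-reverse (x ∷ [])     _       = [-]
Linked-reverse (x ∷ y ∷ xs) (e ∷ l) = subst (Linked Adj)
  (sym (trans (List.unfold-reverse x (y ∷ xs)) (cong (_∷ʳ x) (List.unfold-reverse y xs))))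
  (Linked-∷ʳ (reverse xs) (subst (Linked Adj) (List.unfold-reverse y xs) (Linked-reverse (y ∷ xs) l)) (adj-sym e))

Unique-resp-↭ : ∀ {xs ys : List V} → xs ↭ ys → Unique xs → Unique ys
Unique-resp-↭ p = ↭ₛ.Unique-resp-↭ (≡-setoid V) (↭⇒↭ₛ p)

-- Reflection in the horizontal axis

reflect : V → V
reflect (p , q) = p , ℤ.- q

reflect-involutive : ∀ v → reflect (reflect v) ≡ v
reflect-involutive (p , q) = cong (p ,_) (ℤ.neg-involutive q)

reflect-injective : ∀ {u v} → reflect u ≡ reflect v → u ≡ v
reflect-injective {u} {v} eq =
  trans (sym (reflect-involutive u)) (trans (cong reflect eq) (reflect-involutive v))

reflect-basic : ∀ {u v} → Basic u v → Adj (reflect u) (reflect v)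
reflect-basic {p , q} (inj₁ refl) = inj₂ (inj₁ (cong (p ,_) (lemma q)))
  where
  lemma : ∀ q → ℤ.- q ≡ ℤ.- (q ℤ.+ 1ℤ) ℤ.+ 1ℤ
  lemma = solve-∀
reflect-basic {p , q} (inj₂ (refl , d)) = inj₁ (inj₂ (refl ,
  subst (+ 2 ℤ.∣_) (lemma p q) (ℤ.∣m∣n⇒∣m+n d (ℤ.divides q refl))))
  where
  lemma : ∀ p q → p ℤ.- q ℤ.+ q ℤ.* + 2 ≡ p ℤ.- (ℤ.- q)
  lemma = solve-∀

reflect-adj : ∀ {u v} → Adj u v → Adj (reflect u) (reflect v)
reflect-adj (inj₁ b) = reflect-basic b
reflect-adj (inj₂ b) = adj-sym (reflect-basic b)

reflect-X : ∀ {v} → X v → X (reflect v)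
reflect-X {p , q} x (p≤0 , l , r) = x (p≤0 ,
  subst₂ ℤ._≤_ (neg-− 1ℤ p) (ℤ.neg-involutive q) (ℤ.neg-mono-≤ r) ,
  subst₂ ℤ._≤_ (ℤ.neg-involutive q) (neg-− p 1ℤ) (ℤ.neg-mono-≤ l))

reflect-X⁻ : ∀ {v} → X (reflect v) → X v
reflect-X⁻ {v} x = subst X (reflect-involutive v) (reflect-X x)

reflect-walk : ∀ {w} → Walk w → Walk (map reflect w)
reflect-walk (t , refl , l , u , x) =
  map reflect t , refl , Linked.map⁺ (Linked.map reflect-adj l) , Unique.map⁺ reflect-injective u ,
  All.map⁺ (All.map reflect-X x)

map-∷ʳ : ∀ (f : V → V) xs z → map f (xs ∷ʳ z) ≡ map f xs ∷ʳ f z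
map-∷ʳ f xs z = List.map-++ f xs (z ∷ [])

reflect-extends : ∀ {w c} → Extends w c → Extends (map reflect w) (reflect c)
reflect-extends (xs , a , b , refl , bc , c≢a) =
  map reflect xs , reflect a , reflect b ,
  trans (map-∷ʳ reflect (xs ∷ʳ a) b) (cong (_∷ʳ reflect b) (map-∷ʳ reflect xs a)) ,
  reflect-adj bc , c≢a ∘ reflect-injective

reflect-exit : ∀ {z y} (ex : Exit z y) →
  ∃ λ (ex′ : Exit (reflect z) (reflect y)) → exit-exponent ex′ ≅ exit-exponent ex ℤ.+ + 24 [mod 48 ]
reflect-exit (upper p p≤0) = to-lower (cong (p ,_) (neg-− 1ℤ p)) (cong (p ,_) (lemma p))
  where
  lemma : ∀ p → ℤ.- (1ℤ ℤ.- p ℤ.+ 1ℤ) ≡ p ℤ.- 1ℤ ℤ.- 1ℤ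
  lemma = solve-∀
  to-lower : ∀ {z y} → z ≡ (p , p ℤ.- 1ℤ) → y ≡ down (p , p ℤ.- 1ℤ) →
             ∃ λ (ex : Exit z y) → exit-exponent ex ≅ + 36 [mod 48 ]
  to-lower refl refl = lower p p≤0 , ℤ.divides 0ℤ refl
reflect-exit (lower p p≤0) = to-upper (cong (p ,_) (neg-− p 1ℤ)) (cong (p ,_) (lemma p))
  where
  lemma : ∀ p → ℤ.- (p ℤ.- 1ℤ ℤ.- 1ℤ) ≡ 1ℤ ℤ.- p ℤ.+ 1ℤ
  lemma = solve-∀
  -- 36 + 24 = 60, congruent to the exponent 12 of the upper side.
  to-upper : ∀ {z y} → z ≡ (p , 1ℤ ℤ.- p) → y ≡ up (p , 1ℤ ℤ.- p) →
             ∃ λ (ex : Exit z y) → exit-exponent ex ≅ + 60 [mod 48 ]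
  to-upper refl refl = upper p p≤0 , ℤ.divides -1ℤ refl

walk-∉ : ∀ {w c} → Walk w → ¬ X c → c ≢ o → All (_≢ c) w
walk-∉ (t , refl , _ , _ , x) nx n = (n ∘ sym) ∷ All.map (λ { x refl → nx x }) x

Unique-∷ʳ : ∀ {w} {c : V} → Unique w → All (_≢ c) w → Unique (w ∷ʳ c)
Unique-∷ʳ []        []       = [] ∷ []
Unique-∷ʳ (n ∷ u) (m ∷ ms) = All.++⁺ n (m ∷ []) ∷ Unique-∷ʳ u ms

exit-≢o : ∀ {z y} → Exit z y → z ≢ o
exit-≢o ex refl = contradiction (parity-even (exit-parity ex) ⟨ ℤ.divides 0ℤ refl ⟩) λ ()

exit-exponent-walk : ∀ {w z y} (ex : Exit z y) → Walk w → ∀ xs → w ≡ xs ∷ʳ y →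
                     exponent (w ∷ʳ z) ≡ exit-exponent ex
exit-exponent-walk ex (_ , refl , _) [] ()
exit-exponent-walk {z = z} {y} ex wk@(t , refl , l , u , x) (_ ∷ xs) eq =
  go xs (List.∷-injectiveʳ eq)
    (subst (λ w → Linked Adj (w ∷ʳ z)) (sym eq) (Linked-∷ʳ (_ ∷ xs) (subst (Linked Adj) eq l) (adj-sym (exit-adj ex))))
    (Unique-∷ʳ u (walk-∉ wk (exit-slit ex) (exit-≢o ex))) x
  where
  go : ∀ xs → right o ∷ t ≡ xs ∷ʳ y → Linked Adj (o ∷ right o ∷ t ∷ʳ z) → Unique (o ∷ right o ∷ t ∷ʳ z) →
       All X (right o ∷ t) → exponent (o ∷ right o ∷ t ∷ʳ z) ≡ exit-exponent ex
  go []       refl = exit-walk ex [] refl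
  go (_ ∷ xs) refl = exit-walk ex (right o ∷ xs) refl

walk-last : ∀ {w} → Walk w → ∀ xs a b → w ≡ xs ∷ʳ a ∷ʳ b → X b
walk-last (_ , refl , _ , _ , x ∷ _) []       a b refl = x
walk-last (_ , refl , _ , _ , x)     (_ ∷ xs) a b eq   =
  All-last (xs ∷ʳ a) (subst (All X) (List.∷-injectiveʳ eq) x)

-- The edge `a` is excluded: a self-avoiding walk is at `right o` only as its second vertex, and
-- going on to `o` from there would be a backtrack.
walk-exit : ∀ {w c} → Walk w → Extends w c → ¬ X c →
            ∃ λ xs → ∃ λ b → w ≡ xs ∷ʳ b × Exit c b
walk-exit {w} {c} wk@(t , eq , _ , u , _) (xs , a , b , w≡ , bc , c≢a) nc
  with exit nc (walk-last wk xs a b w≡) (adj-sym bc)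
... | inj₁ ex = xs ∷ʳ a , b , w≡ , ex
... | inj₂ (refl , refl) = ⊥-elim (absurd xs (trans (sym eq) w≡) (subst Unique eq u) c≢a)
  where
  absurd : ∀ xs → o ∷ right o ∷ t ≡ xs ∷ʳ a ∷ʳ right o → Unique (o ∷ right o ∷ t) → o ≢ a → ⊥
  absurd []           refl _               n = n refl
  absurd (_ ∷ [])     refl (_ ∷ (n ∷ _) ∷ _) _ = n refl
  absurd (_ ∷ _ ∷ xs) refl (_ ∷ n ∷ _)     _ = All-last (xs ∷ʳ a) n refl

-- Loops closed by an extension

reverseAfter : V → List V → List V
reverseAfter c []       = []
reverseAfter c (x ∷ xs) = x ∷ (if does (x ≟ⱽ c) then reverse xs else reverseAfter c xs)

reverseAfter-↭ : ∀ c w → reverseAfter c w ↭ w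
reverseAfter-↭ c []       = ↭-refl
reverseAfter-↭ c (x ∷ xs) with does (x ≟ⱽ c)
... | true  = prep x (↭-reverse xs)
... | false = prep x (reverseAfter-↭ c xs)

reverseAfter-++ : ∀ ys c zs → All (_≢ c) ys → reverseAfter c (ys ++ c ∷ zs) ≡ ys ++ c ∷ reverse zs
reverseAfter-++ []       c zs []       =
  cong (λ b → c ∷ (if b then reverse zs else reverseAfter c zs)) (dec-true (c ≟ⱽ c) refl)
reverseAfter-++ (y ∷ ys) c zs (n ∷ ns) = trans
  (cong (λ b → y ∷ (if b then reverse (ys ++ c ∷ zs) else reverseAfter c (ys ++ c ∷ zs))) (dec-false (y ≟ⱽ c) n))
  (cong (y ∷_) (reverseAfter-++ ys c zs ns))

record Lasso (w : List V) (c : V) : Set where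
  constructor lasso
  field
    pre   : List V
    u l₁  : V
    ms    : List V
    lₖ    : V
    shape : w ≡ (pre ∷ʳ u) ++ c ∷ l₁ ∷ (ms ∷ʳ lₖ)
    close : Adj lₖ c

adj-irreflexive : ∀ {v} → ¬ Adj v v
adj-irreflexive {v} a = let e , h = parity v ; d , _ , eq = step-adj h a in
  absurd e h (subst (Parity (not e)) (sym eq) (parity-step d h))
  where
  absurd : ∀ e → Parity e v → ¬ Parity (not e) v
  absurd true  h h′ = contradiction (parity-even h′ h) λ ()
  absurd false h h′ = contradiction (parity-even h h′) λ ()

walk-lasso : ∀ {w c} → Walk w → Extends w c → X c → c ∈ w → Lasso w c
walk-lasso {w} {c} (t , w≡ , _) (xs , a , b , w≡′ , bc , c≢a) xc c∈w
  with ys , zs , eq ← ∈-∃++ c∈w with initLast ys | initLast zs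
-- The vertex `c` is not the start `o`, which is outside X, nor the last vertex, since adjacent
-- vertices have different parity, nor the last but one, since an extension does not backtrack. The
-- loop therefore has at least three vertices.
... | [] | _ = contradiction (subst X (List.∷-injectiveˡ (trans (sym eq) w≡)) xc) o∉X
... | pre ∷ʳ′ u | [] =
  contradiction (subst (λ b → Adj b c) (List.∷ʳ-injectiveʳ (xs ∷ʳ a) (pre ∷ʳ u) (trans (sym w≡′) eq)) bc) adj-irreflexive
... | pre ∷ʳ′ u | [] ∷ʳ′ l = contradiction
  (List.∷ʳ-injectiveʳ (pre ∷ʳ u) xs (List.∷ʳ-injectiveˡ (pre ∷ʳ u ∷ʳ c) (xs ∷ʳ a)
    (trans (List.++-assoc (pre ∷ʳ u) (c ∷ []) (l ∷ [])) (trans (sym eq) w≡′)))) c≢a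
... | pre ∷ʳ′ u | (l₁ ∷ ms) ∷ʳ′ lₖ = lasso pre u l₁ ms lₖ eq
  (subst (λ b → Adj b c) (List.∷ʳ-injectiveʳ (xs ∷ʳ a) ((pre ∷ʳ u) ++ c ∷ l₁ ∷ ms)
    (trans (sym w≡′) (trans eq (sym (List.++-assoc (pre ∷ʳ u) (c ∷ l₁ ∷ ms) (lₖ ∷ [])))))) bc)

Unique-++⁻ : ∀ (xs : List V) {ys} → Unique (xs ++ ys) → Unique ys × All (λ x → All (x ≢_) ys) xs
Unique-++⁻ []       u       = u , []
Unique-++⁻ (x ∷ xs) (n ∷ u) = let v , ns = Unique-++⁻ xs u in v , All.++⁻ʳ xs n ∷ ns

-- The loop lies in X and so does not turn around `o`. The walk from `o` to `u` avoids it, which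
-- carries this over to `u` as `lasso-winding` requires. The winding number up to `c` is split off
-- because it is common to both orientations of the loop.
lasso-exponent : ∀ {w c} (L : Lasso w c) → let open Lasso L in Walk w →
  exponent (w ∷ʳ c) ≡ winding (pre ++ u ∷ c ∷ []) ℤ.+ loop u c l₁ lₖ
lasso-exponent {c = v} (lasso pre u l₁ ms lₖ refl close) wk@(_ , w≡ , l , uq , x) = begin
  + 8 ℤ.* + direction (w ∷ʳ v) ℤ.+ winding (w ∷ʳ v)
    ≡⟨ cong₂ (λ d r → + 8 ℤ.* + d ℤ.+ r) direction≡ winding≡ ⟩
  + 8 ℤ.* + ℓ v lₖ ℤ.+ (winding (pre ++ u ∷ v ∷ []) ℤ.+ turns)
    ≡⟨ rearrange (+ 8 ℤ.* + ℓ v lₖ) (winding (pre ++ u ∷ v ∷ [])) turns ⟩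
  winding (pre ++ u ∷ v ∷ []) ℤ.+ loop u v l₁ lₖ ∎
  where
  open ≡-Reasoning
  zs = l₁ ∷ (ms ∷ʳ lₖ)
  w = (pre ∷ʳ u) ++ v ∷ zs
  turns = + 2 ℤ.* weight u v lₖ ℤ.- weight u v l₁ ℤ.+ weight lₖ v l₁
  rearrange : ∀ i j k → i ℤ.+ (j ℤ.+ k) ≡ j ℤ.+ (i ℤ.+ k)
  rearrange = solve-∀
  w∷ʳv : w ∷ʳ v ≡ (pre ∷ʳ u) ++ v ∷ zs ∷ʳ v
  w∷ʳv = List.++-assoc (pre ∷ʳ u) (v ∷ zs) (v ∷ [])
  w∷ʳv′ : w ∷ʳ v ≡ pre ++ u ∷ v ∷ zs ∷ʳ v
  w∷ʳv′ = trans w∷ʳv (List.++-assoc pre (u ∷ []) (v ∷ zs ∷ʳ v))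
  linked : Linked Adj ((pre ∷ʳ u) ++ v ∷ zs ∷ʳ v)
  linked = subst (Linked Adj) w∷ʳv (subst (λ w → Linked Adj (w ∷ʳ v)) w≡last
    (Linked-∷ʳ ((pre ∷ʳ u) ++ v ∷ l₁ ∷ ms) (subst (Linked Adj) (sym w≡last) l) close))
    where
    w≡last : ((pre ∷ʳ u) ++ v ∷ l₁ ∷ ms) ∷ʳ lₖ ≡ w
    w≡last = List.++-assoc (pre ∷ʳ u) (v ∷ l₁ ∷ ms) (lₖ ∷ [])
  direction≡ : direction (w ∷ʳ v) ≡ ℓ v lₖ
  direction≡ = trans
    (cong (λ w → direction (w ∷ʳ v)) (sym (List.++-assoc (pre ∷ʳ u) (v ∷ l₁ ∷ ms) (lₖ ∷ []))))
    (direction-∷ʳ ((pre ∷ʳ u) ++ v ∷ l₁ ∷ ms) lₖ v)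
  linked-loop : Linked Adj (v ∷ zs ∷ʳ v)
  linked-loop = Linked-++ʳ (pre ∷ʳ u) linked
  tail≢ : All (λ b → All (b ≢_) (v ∷ zs ∷ʳ v)) (pre ∷ʳ u)
  tail≢ = All.map (λ { n@(n₁ ∷ _) → All.++⁺ n (n₁ ∷ []) }) (proj₂ (Unique-++⁻ (pre ∷ʳ u) uq))
  unique-loop : Unique (zs ∷ʳ v)
  unique-loop with n ∷ u ← proj₁ (Unique-++⁻ (pre ∷ʳ u) uq) = Unique-∷ʳ u (All.map (_∘ sym) n)
  from-o : first pre u ≡ o
  from-o = head pre w≡
    where
    head : ∀ {ys} pre → (pre ∷ʳ u) ++ ys ≡ o ∷ right o ∷ proj₁ wk → first pre u ≡ o
    head []      eq = List.∷-injectiveˡ eq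
    head (_ ∷ _) eq = List.∷-injectiveˡ eq
  suffix : ∀ {ys} pre → (pre ∷ʳ u) ++ ys ≡ o ∷ right o ∷ proj₁ wk → All X ys
  suffix []        eq = subst (All X) (sym (List.∷-injectiveʳ eq)) x
  suffix (_ ∷ pre) eq = All.++⁻ʳ (pre ∷ʳ u) (subst (All X) (sym (List.∷-injectiveʳ eq)) x)
  loop∈X : All X (v ∷ zs ∷ʳ v)
  loop∈X = let x′ = suffix pre w≡ in All.++⁺ x′ (All.head x′ ∷ [])
  closed : sweep u (v ∷ zs ∷ʳ v) ≡ 0ℤ
  closed = trans
    (sym (sweep-closed pre u v zs (Linked-init (pre ∷ʳ u) (Linked-++ˡ (pre ∷ʳ u) linked)) linked-loop tail≢))
    (trans (cong (λ b → sweep b (v ∷ zs ∷ʳ v)) from-o) (sweep-o-closed v zs linked-loop loop∈X))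
  uv : Adj u v
  uv = Linked.head (Linked-++ʳ pre (subst (Linked Adj) (List.++-assoc pre (u ∷ []) (v ∷ zs ∷ʳ v)) linked))
  winding≡ : winding (w ∷ʳ v) ≡ winding (pre ++ u ∷ v ∷ []) ℤ.+ turns
  winding≡ = trans (cong winding w∷ʳv′) (trans (winding-++ pre u v (zs ∷ʳ v))
    (cong (λ r → winding (pre ++ u ∷ v ∷ []) ℤ.+ r)
      (lasso-winding u v l₁ ms lₖ uv linked-loop (All-last pre tail≢) unique-loop closed)))

-- The involution on the bad extensions

Bad : List V × V → Set
Bad (w , c) = Walk w × Extends w c × (¬ X c ⊎ c ∈ w)

partner : List V × V → List V × V
partner (w , c) = if does (X? c) then (reverseAfter c w , c) else (map reflect w , reflect c)

partner-X : ∀ {w c} → X c → partner (w , c) ≡ (reverseAfter c w , c)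
partner-X {w} {c} x = cong (if_then (reverseAfter c w , c) else (map reflect w , reflect c)) (dec-true (X? c) x)

partner-¬X : ∀ {w c} → ¬ X c → partner (w , c) ≡ (map reflect w , reflect c)
partner-¬X {w} {c} x = cong (if_then (reverseAfter c w , c) else (map reflect w , reflect c)) (dec-false (X? c) x)

pairExponent : List V × V → ℤ
pairExponent (w , c) = exponent (w ∷ʳ c)

Partners : List V × V → List V × V → Set
Partners p p′ = Bad p′ × partner p′ ≡ p × length (proj₁ p′) ≡ length (proj₁ p) ×
                pairExponent p′ ≅ pairExponent p ℤ.+ + 24 [mod 48 ]

reflect-partners : ∀ {w c} → Walk w → Extends w c → ¬ X c → Partners (w , c) (map reflect w , reflect c)
reflect-partners {w} {c} wk ext nc =
  (reflect-walk wk , reflect-extends ext , inj₁ nc′) ,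
  trans (partner-¬X nc′)
    (cong₂ _,_ (trans (sym (List.map-∘ w)) (trans (List.map-cong reflect-involutive w) (List.map-id w)))
      (reflect-involutive c)) ,
  List.length-map reflect w ,
  congruent
  where
  nc′ : ¬ X (reflect c)
  nc′ = nc ∘ reflect-X⁻
  congruent : exponent (map reflect w ∷ʳ reflect c) ≅ exponent (w ∷ʳ c) ℤ.+ + 24 [mod 48 ]
  congruent =
    let xs , b , w≡ , ex = walk-exit wk ext nc
        ex′ , e = reflect-exit ex
    in subst₂ (λ i j → i ≅ j ℤ.+ + 24 [mod 48 ])
         (sym (exit-exponent-walk ex′ (reflect-walk wk) (map reflect xs)
           (trans (cong (map reflect) w≡) (map-∷ʳ reflect xs b))))
         (sym (exit-exponent-walk ex wk xs w≡)) e

reverse-∷-∷ʳ : ∀ (x : V) ys z → reverse (x ∷ ys ∷ʳ z) ≡ z ∷ (reverse ys ∷ʳ x)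
reverse-∷-∷ʳ x ys z = trans (List.unfold-reverse x (ys ∷ʳ z)) (cong (_∷ʳ x) (List.reverse-++ ys (z ∷ [])))

reverseAfter-walk : ∀ {w c} → Walk w → X c → Linked Adj (reverseAfter c w) → Walk (reverseAfter c w)
reverseAfter-walk {c = c} (t , refl , _ , u , x) xc l =
  (if does (right o ≟ⱽ c) then reverse t else reverseAfter c t) , shape , l ,
  Unique-resp-↭ (↭-sym (reverseAfter-↭ c (o ∷ right o ∷ t))) u ,
  All-resp-↭ (↭-sym (reverseAfter-↭ c (right o ∷ t))) x
  where
  shape : reverseAfter c (o ∷ right o ∷ t) ≡ o ∷ reverseAfter c (right o ∷ t)
  shape = cong (λ b → o ∷ (if b then reverse (right o ∷ t) else reverseAfter c (right o ∷ t)))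
    (dec-false (o ≟ⱽ c) λ { refl → o∉X xc })

lasso-extends : ∀ {w c} → Lasso w c → Unique w → Extends w c
lasso-extends {c = c} (lasso pre u l₁ ms lₖ refl close) uq =
  penultimate ms (proj₁ (Unique-++⁻ (pre ∷ʳ u) uq))
  where
  penultimate : ∀ ms → Unique (c ∷ l₁ ∷ (ms ∷ʳ lₖ)) → Extends ((pre ∷ʳ u) ++ c ∷ l₁ ∷ (ms ∷ʳ lₖ)) c
  penultimate ms (n ∷ _) with initLast ms
  ... | [] = (pre ∷ʳ u) ∷ʳ c , l₁ , lₖ ,
    sym (trans (cong (_∷ʳ lₖ) (List.++-assoc (pre ∷ʳ u) (c ∷ []) (l₁ ∷ [])))
               (List.++-assoc (pre ∷ʳ u) (c ∷ l₁ ∷ []) (lₖ ∷ []))) ,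
    close , All.head n
  ... | ms ∷ʳ′ m = (pre ∷ʳ u) ++ c ∷ l₁ ∷ ms , m , lₖ ,
    sym (trans (cong (_∷ʳ lₖ) (List.++-assoc (pre ∷ʳ u) (c ∷ l₁ ∷ ms) (m ∷ [])))
               (List.++-assoc (pre ∷ʳ u) (c ∷ l₁ ∷ ms ∷ʳ m) (lₖ ∷ []))) ,
    close , All-last (l₁ ∷ ms) (All-init (l₁ ∷ ms ∷ʳ m) n)

+-≅ : ∀ i {j k} → j ≅ k ℤ.+ + 24 [mod 48 ] → i ℤ.+ j ≅ i ℤ.+ k ℤ.+ + 24 [mod 48 ]
+-≅ i {j} {k} = subst (+ 48 ℤ.∣_) (lemma i j k)
  where
  lemma : ∀ i j k → j ℤ.- (k ℤ.+ + 24) ≡ i ℤ.+ j ℤ.- (i ℤ.+ k ℤ.+ + 24)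
  lemma = solve-∀

-- Reversal keeps the walk up to `c` and exchanges the roles of `l₁` and `lₖ`. As it permutes the
-- vertices, the walk remains self-avoiding and in X.
lasso-partners : ∀ {w c} → Lasso w c → Walk w → X c → Partners (w , c) (reverseAfter c w , c)
lasso-partners {w} {v} L@(lasso pre u l₁ ms lₖ refl close) wk@(t , w≡ , l , uq , x) xv =
  (wk′ , ext′ , inj₂ (∈-resp-↭ (↭-sym (reverseAfter-↭ v w)) (∈-++⁺ʳ (pre ∷ʳ u) (here refl)))) ,
  trans (partner-X xv) (cong (_, v) (trans (cong (reverseAfter v) w′≡)
    (trans (reverseAfter-++ (pre ∷ʳ u) v (lₖ ∷ (reverse ms ∷ʳ l₁)) tail≢)
      (cong (λ ys → (pre ∷ʳ u) ++ v ∷ ys)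
        (trans (reverse-∷-∷ʳ lₖ (reverse ms) l₁) (cong (λ ys → l₁ ∷ (ys ∷ʳ lₖ)) (List.reverse-involutive ms))))))) ,
  ↭-length (reverseAfter-↭ v w) ,
  subst₂ (λ i j → i ≅ j ℤ.+ + 24 [mod 48 ]) (sym (lasso-exponent L′ wk′)) (sym (lasso-exponent L wk))
    (+-≅ (winding (pre ++ u ∷ v ∷ []))
      (loop-reverse (adj-sym uv) vl₁ (adj-sym close) u≢l₁ u≢lₖ l₁≢lₖ))
  where
  zs = l₁ ∷ (ms ∷ʳ lₖ)
  w′ = reverseAfter v w
  unique = Unique-++⁻ (pre ∷ʳ u) uq
  tail≢ : All (_≢ v) (pre ∷ʳ u)
  tail≢ = All.map All.head (proj₂ unique)
  w′≡ : w′ ≡ (pre ∷ʳ u) ++ v ∷ lₖ ∷ (reverse ms ∷ʳ l₁)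
  w′≡ = trans (reverseAfter-++ (pre ∷ʳ u) v zs tail≢) (cong (λ ys → (pre ∷ʳ u) ++ v ∷ ys) (reverse-∷-∷ʳ l₁ ms lₖ))
  vl₁ : Adj v l₁
  vl₁ = Linked.head (Linked-++ʳ (pre ∷ʳ u) l)
  uv : Adj u v
  uv = Linked.head (Linked-++ʳ pre (subst (Linked Adj) (List.++-assoc pre (u ∷ []) (v ∷ zs)) l))
  u≢ : All (u ≢_) (v ∷ zs)
  u≢ = All-last pre (proj₂ unique)
  u≢l₁ : u ≢ l₁
  u≢l₁ = All.head (All.tail u≢)
  u≢lₖ : u ≢ lₖ
  u≢lₖ = All-last ms (All.tail (All.tail u≢))
  l₁≢lₖ : l₁ ≢ lₖ
  l₁≢lₖ = distinct (proj₁ unique)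
    where
    distinct : Unique (v ∷ l₁ ∷ (ms ∷ʳ lₖ)) → l₁ ≢ lₖ
    distinct (_ ∷ n ∷ _) = All-last ms n
  L′ : Lasso w′ v
  L′ = lasso pre u lₖ (reverse ms) l₁ w′≡ (adj-sym vl₁)
  linked-zs : Linked Adj (lₖ ∷ (reverse ms ∷ʳ l₁))
  linked-zs = subst (Linked Adj) (reverse-∷-∷ʳ l₁ ms lₖ)
    (Linked-reverse zs (Linked.tail (Linked-++ʳ (pre ∷ʳ u) l)))
  linked : Linked Adj w′
  linked = subst (Linked Adj) (sym w′≡) (Linked-++ (pre ∷ʳ u) (Linked-++ˡ (pre ∷ʳ u) l) (adj-sym close ∷ linked-zs))
  wk′ : Walk w′
  wk′ = reverseAfter-walk wk xv linked
  ext′ : Extends w′ v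
  ext′ = lasso-extends L′ (Unique-resp-↭ (↭-sym (reverseAfter-↭ v w)) uq)

bad-partners : ∀ {p} → Bad p → Partners p (partner p)
bad-partners {w , c} (wk , ext , bad) = by (X? c)
  where
  by : Dec (X c) → Partners (w , c) (partner (w , c))
  by (yes x) = subst (Partners (w , c)) (sym (partner-X x))
    (lasso-partners (walk-lasso wk ext x (fromInj₂ (contradiction x) bad)) wk x)
  by (no nx) = subst (Partners (w , c)) (sym (partner-¬X nx)) (reflect-partners wk ext nx)

-- Enumeration of walks and their extensions

neighbours-adj : ∀ {v u} → u ∈ neighbours v → Adj v u
neighbours-adj {v} i = proj₂ (∈-filter⁻ (adj? v) {xs = up v ∷ right v ∷ down v ∷ left v ∷ []} i)

adj-neighbours : ∀ {v u} → Adj v u → u ∈ neighbours v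
adj-neighbours {v} {u} a = let e , h = parity v ; d , i , eq = step-adj h a in
  subst₂ _∈_ (sym eq) (sym (neighbours-step h)) (∈-map⁺ (λ d → step d v) i)

∈-paths⁻ : ∀ n {v w} → w ∈ paths n v → ∃ λ t → w ≡ v ∷ t × length t ≡ n × Linked Adj w
∈-paths⁻ zero        (here refl) = [] , refl , refl , [-]
∈-paths⁻ (suc n) {v} i =
  let w′ , j , eq = ∈-map⁻ (v ∷_) i
      u , k , m = find (∈-concatMap⁻ (paths n) {xs = neighbours v} j)
      t , eq′ , len , l = ∈-paths⁻ n m
  in w′ , eq , trans (cong length eq′) (cong suc len) ,
     subst (Linked Adj) (sym eq) (subst (λ w → Linked Adj (v ∷ w)) (sym eq′)
       (neighbours-adj k ∷ subst (Linked Adj) eq′ l))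

∈-paths⁺ : ∀ {v} t → Linked Adj (v ∷ t) → (v ∷ t) ∈ paths (length t) v
∈-paths⁺     []      [-]     = here refl
∈-paths⁺ {v} (u ∷ t) (e ∷ l) = ∈-map⁺ (v ∷_)
  (∈-concatMap⁺ (paths (length t)) (lose (adj-neighbours e) (∈-paths⁺ t l)))

∈-slitSAWs⁻ : ∀ n {w} → w ∈ slitSAWs (suc n) → Walk w × length w ≡ suc (suc n)
∈-slitSAWs⁻ n i =
  let j , u , x = ∈-filter⁻ slitSAW? {xs = map (o ∷_) (paths n (right o))} i
      w′ , k , eq = ∈-map⁻ (o ∷_) j
      t , eq′ , len , l = ∈-paths⁻ n k
      eq″ = trans eq (cong (o ∷_) eq′)
  in (t , eq″ , subst (Linked Adj) (sym eq″) (inj₁ (inj₂ (refl , ℤ.divides 0ℤ refl)) ∷ subst (Linked Adj) eq′ l) ,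
      u , subst (All X) (cong (drop 1) eq″) x) ,
     trans (cong length eq″) (cong (suc ∘ suc) len)

∈-slitSAWs⁺ : ∀ n {w} → Walk w → length w ≡ suc (suc n) → w ∈ slitSAWs (suc n)
∈-slitSAWs⁺ n (t , refl , l , u , x) refl =
  ∈-filter⁺ slitSAW? (∈-map⁺ (o ∷_) (∈-paths⁺ t (Linked.tail l))) (u , x)

exts : List V → List V
exts (a ∷ b ∷ [])        = filter (λ c → ¬? (c ≟ⱽ a)) (neighbours b)
exts (_ ∷ w@(_ ∷ _ ∷ _)) = exts w
exts _                   = []

exts-∷ʳ : ∀ xs a b → exts (xs ∷ʳ a ∷ʳ b) ≡ filter (λ c → ¬? (c ≟ⱽ a)) (neighbours b)
exts-∷ʳ []           a b = refl
exts-∷ʳ (_ ∷ [])     a b = refl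
exts-∷ʳ (_ ∷ x ∷ []) a b = refl
exts-∷ʳ (_ ∷ x ∷ y ∷ xs) a b = exts-∷ʳ (x ∷ y ∷ xs) a b

walk-end : ∀ {w} → Walk w → ∃ λ xs → ∃₂ λ a b → w ≡ xs ∷ʳ a ∷ʳ b × Adj a b
walk-end (t , refl , l , _) = end o (right o) t l
  where
  end : ∀ x y t → Linked Adj (x ∷ y ∷ t) → ∃ λ xs → ∃₂ λ a b → x ∷ y ∷ t ≡ xs ∷ʳ a ∷ʳ b × Adj a b
  end x y []      (e ∷ _) = [] , x , y , refl , e
  end x y (z ∷ t) (_ ∷ l) = let xs , a , b , eq , ab = end y z t l in x ∷ xs , a , b , cong (x ∷_) eq , ab

∈-exts⁻ : ∀ {w c} → Walk w → c ∈ exts w → Extends w c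
∈-exts⁻ {w} {c} wk i =
  let xs , a , b , eq , _ = walk-end wk
      j , c≢a = ∈-filter⁻ (λ c → ¬? (c ≟ⱽ a)) {xs = neighbours b}
                  (subst (c ∈_) (trans (cong exts eq) (exts-∷ʳ xs a b)) i)
  in xs , a , b , eq , neighbours-adj j , c≢a

∈-exts⁺ : ∀ {w c} → Extends w c → c ∈ exts w
∈-exts⁺ (xs , a , b , refl , bc , c≢a) = subst (_ ∈_) (sym (exts-∷ʳ xs a b))
  (∈-filter⁺ (λ c → ¬? (c ≟ⱽ a)) (adj-neighbours bc) c≢a)

extensions : ℕ → List (List V × V)
extensions n = concatMap (λ w → map (w ,_) (exts w)) (slitSAWs n)

∈-extensions⁻ : ∀ n {w c} → (w , c) ∈ extensions (suc n) → Walk w × length w ≡ suc (suc n) × Extends w c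
∈-extensions⁻ n i with find (∈-concatMap⁻ (λ w → map (w ,_) (exts w)) {xs = slitSAWs (suc n)} i)
... | w , j , k with ∈-map⁻ (w ,_) k
... | c , m , refl = let wk , len = ∈-slitSAWs⁻ n j in wk , len , ∈-exts⁻ wk m

∈-extensions⁺ : ∀ n {w c} → Walk w → length w ≡ suc (suc n) → Extends w c → (w , c) ∈ extensions (suc n)
∈-extensions⁺ n {w} wk len ext = ∈-concatMap⁺ (λ w → map (w ,_) (exts w))
  (lose (∈-slitSAWs⁺ n wk len) (∈-map⁺ (w ,_) (∈-exts⁺ ext)))

-- The function `key` recovers `x` from any element of `f x`, so that the lists `f x` are disjoint.
Unique-concatMap : ∀ {A B : Set} (f : A → List B) (key : B → A) → (∀ x {y} → y ∈ f x → key y ≡ x) →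
                   (∀ x → Unique (f x)) → ∀ {xs} → Unique xs → Unique (concatMap f xs)
Unique-concatMap f key k u []       = []
Unique-concatMap f key k u {x ∷ xs} (n ∷ ns) = Unique.++⁺ (u x) (Unique-concatMap f key k u ns)
  λ (i , j) → let x′ , m , i′ = find (∈-concatMap⁻ f {xs = xs} j) in
    All.lookup n m (trans (sym (k x i)) (k x′ i′))

neighbours-unique : ∀ v → Unique (neighbours v)
neighbours-unique v = let e , h = parity v in
  subst Unique (sym (neighbours-step h)) (Unique.map⁺ (step-injective {v = v}) (dirs-unique e))
  where
  dirs-unique : ∀ e → Unique (dirs e)
  dirs-unique true  = ((λ ()) ∷ (λ ()) ∷ []) ∷ ((λ ()) ∷ []) ∷ [] ∷ []
  dirs-unique false = ((λ ()) ∷ (λ ()) ∷ []) ∷ ((λ ()) ∷ []) ∷ [] ∷ []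

paths-unique : ∀ n v → Unique (paths n v)
paths-unique zero    v = [] ∷ []
paths-unique (suc n) v = Unique.map⁺ List.∷-injectiveʳ
  (Unique-concatMap (paths n) (λ w → first w o)
    (λ u {w} i → let _ , eq , _ = ∈-paths⁻ n i in cong (λ w → first w o) eq)
    (paths-unique n) (neighbours-unique v))

slitSAWs-unique : ∀ n → Unique (slitSAWs n)
slitSAWs-unique zero    = []
slitSAWs-unique (suc n) = Unique.filter⁺ slitSAW? (Unique.map⁺ List.∷-injectiveʳ (paths-unique n (right o)))

exts-unique : ∀ w → Unique (exts w)
exts-unique []              = []
exts-unique (_ ∷ [])        = []
exts-unique (a ∷ b ∷ [])    = Unique.filter⁺ (λ c → ¬? (c ≟ⱽ a)) (neighbours-unique b)
exts-unique (_ ∷ b ∷ c ∷ w) = exts-unique (b ∷ c ∷ w)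

extensions-unique : ∀ n → Unique (extensions n)
extensions-unique n = Unique-concatMap (λ w → map (w ,_) (exts w)) proj₁
  (λ w i → let _ , _ , eq = ∈-map⁻ (w ,_) i in cong proj₁ eq)
  (λ w → Unique.map⁺ (cong proj₂) (exts-unique w)) (slitSAWs-unique n)

-- The pigeonhole principle.
unique-⊆-↭ : ∀ {A : Set} {xs ys : List A} → Unique xs → (∀ {x} → x ∈ xs → x ∈ ys) →
             length ys ℕ.≤ length xs → xs ↭ ys
unique-⊆-↭ {xs = []}     {[]}    _       _   _ = ↭-refl
unique-⊆-↭ {xs = []}     {_ ∷ _} _       _   ()
unique-⊆-↭ {xs = x ∷ xs} {ys}    (n ∷ u) sub len with ∈-∃++ (sub (here refl))
... | ys₁ , ys₂ , refl = ↭-trans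
  (prep x (unique-⊆-↭ u sub′ (ℕ.≤-pred (subst (ℕ._≤ length (x ∷ xs)) (↭-length (shift x ys₁ ys₂)) len))))
  (↭-sym (shift x ys₁ ys₂))
  where
  sub′ : ∀ {y} → y ∈ xs → y ∈ ys₁ ++ ys₂
  sub′ i with ∈-resp-↭ (shift x ys₁ ys₂) (sub (there i))
  ... | here refl = contradiction refl (All.lookup n i)
  ... | there j   = j

unique-⊆-length : ∀ {A : Set} {xs ys : List A} → Unique xs → (∀ {x} → x ∈ xs → x ∈ ys) → length xs ℕ.≤ length ys
unique-⊆-length {xs = []}     _       _   = ℕ.z≤n
unique-⊆-length {xs = x ∷ xs} (n ∷ u) sub with ∈-∃++ (sub (here refl))
... | ys₁ , ys₂ , refl = subst (length (x ∷ xs) ℕ.≤_) (sym (↭-length (shift x ys₁ ys₂)))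
  (ℕ.s≤s (unique-⊆-length u sub′))
  where
  sub′ : ∀ {y} → y ∈ xs → y ∈ ys₁ ++ ys₂
  sub′ i with ∈-resp-↭ (shift x ys₁ ys₂) (sub (there i))
  ... | here refl = contradiction refl (All.lookup n i)
  ... | there j   = j

unique-≡-↭ : ∀ {A : Set} {xs ys : List A} → Unique xs → Unique ys →
             (∀ {x} → x ∈ xs → x ∈ ys) → (∀ {x} → x ∈ ys → x ∈ xs) → xs ↭ ys
unique-≡-↭ u u′ sub sub′ = unique-⊆-↭ u sub (unique-⊆-length u′ sub′)

Good : List V × V → Set
Good (w , c) = X c × c ∉ w

good? : ∀ p → Dec (Good p)
good? (w , c) = X? c ×-dec ¬? (c ∈ⱽ? w)

extend : List V × V → List V
extend (w , c) = w ∷ʳ c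

extend-injective : ∀ {p p′} → extend p ≡ extend p′ → p ≡ p′
extend-injective {w , c} {w′ , c′} eq = let e , e′ = List.∷ʳ-injective w w′ eq in cong₂ _,_ e e′

-- The inverse of `extend` cuts off the last vertex.
good-slitSAWs : ∀ n → map extend (filter good? (extensions (suc n))) ↭ slitSAWs (suc (suc n))
good-slitSAWs n = unique-≡-↭
  (Unique.map⁺ extend-injective (Unique.filter⁺ good? (extensions-unique (suc n))))
  (slitSAWs-unique (suc (suc n))) to from
  where
  to : ∀ {w} → w ∈ map extend (filter good? (extensions (suc n))) → w ∈ slitSAWs (suc (suc n))
  to i with ∈-map⁻ extend i
  ... | (w , c) , j , refl with ∈-filter⁻ good? {xs = extensions (suc n)} j
  ... | k , xc , c∉w with ∈-extensions⁻ n k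
  ... | (t , refl , l , u , x) , len , ext = ∈-slitSAWs⁺ (suc n)
    (t ∷ʳ c , refl , Linked-extends l ext ,
     Unique-∷ʳ u (All.tabulate λ { i refl → c∉w i }) , All.++⁺ x (xc ∷ []))
    (trans (List.length-++ w) (trans (ℕ.+-comm (length w) 1) (cong suc len)))
  from : ∀ {w} → w ∈ slitSAWs (suc (suc n)) → w ∈ map extend (filter good? (extensions (suc n)))
  from {w} i with ∈-slitSAWs⁻ (suc n) i
  ... | (t , refl , l , u , x) , len = split t l u x len
    where
    split : ∀ t → Linked Adj (o ∷ right o ∷ t) → Unique (o ∷ right o ∷ t) → All X (right o ∷ t) →
            length (o ∷ right o ∷ t) ≡ suc (suc (suc n)) →
            (o ∷ right o ∷ t) ∈ map extend (filter good? (extensions (suc n)))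
    split t l u x len with initLast t
    split _ l u x ()  | []
    split _ l u x len | ts ∷ʳ′ c =
      let w₀ = o ∷ right o ∷ ts
          wk = ts , refl , Linked-init w₀ l , Unique-init w₀ u , All-init (right o ∷ ts) x
          xs , a , b , eq , _ = walk-end wk
      in ∈-map⁺ extend (∈-filter⁺ good?
           (∈-extensions⁺ n wk (ℕ.suc-injective (trans (sym (trans (List.length-++ w₀) (ℕ.+-comm (length w₀) 1))) len))
             (xs , a , b , eq , Linked-last (xs ∷ʳ a) (subst (λ w → Linked Adj (w ∷ʳ c)) eq l) ,
              All-last xs (All-init (xs ∷ʳ a) (subst (All (c ≢_)) eq (AllPairs-last w₀ u)))))
           (All-last (right o ∷ ts) x , λ i → All.lookup (AllPairs-last w₀ u) i refl))

bad⁺ : ∀ n {p} → p ∈ filter (¬? ∘ good?) (extensions (suc n)) → Bad p × length (proj₁ p) ≡ suc (suc n)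
bad⁺ n {w , c} i =
  let j , ng = ∈-filter⁻ (¬? ∘ good?) {xs = extensions (suc n)} i
      wk , len , ext = ∈-extensions⁻ n j
  in (wk , ext , by ng (X? c) (c ∈ⱽ? w)) , len
  where
  by : ¬ Good (w , c) → Dec (X c) → Dec (c ∈ w) → ¬ X c ⊎ c ∈ w
  by ng _       (yes c∈w) = inj₂ c∈w
  by ng (no nc) _         = inj₁ nc
  by ng (yes x) (no c∉w)  = contradiction (x , c∉w) ng

bad⁻ : ∀ n {p} → Bad p → length (proj₁ p) ≡ suc (suc n) → p ∈ filter (¬? ∘ good?) (extensions (suc n))
bad⁻ n (wk , ext , bad) len = ∈-filter⁺ (¬? ∘ good?) (∈-extensions⁺ n wk len ext)
  λ (x , c∉w) → [ contradiction x , c∉w ]′ bad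

-- Each bad extension is the partner of its partner, so it occurs among the partners. Both lists
-- have the same length, which makes this inclusion a permutation.
bad-↭ : ∀ n → map partner (filter (¬? ∘ good?) (extensions (suc n))) ↭ filter (¬? ∘ good?) (extensions (suc n))
bad-↭ n = ↭-sym (unique-⊆-↭ (Unique.filter⁺ (¬? ∘ good?) (extensions-unique (suc n))) sub
  (ℕ.≤-reflexive (List.length-map partner bads)))
  where
  bads = filter (¬? ∘ good?) (extensions (suc n))
  sub : ∀ {p} → p ∈ bads → p ∈ map partner bads
  sub i =
    let bad , len = bad⁺ n i
        bad′ , involutive , len′ , _ = bad-partners bad
    in subst (_∈ map partner bads) involutive (∈-map⁺ partner (bad⁻ n bad′ (trans len′ len)))

bad-exponents : ∀ n → All (λ p → pairExponent (partner p) ≅ pairExponent p ℤ.+ + 24 [mod 48 ])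
                          (filter (¬? ∘ good?) (extensions (suc n)))
bad-exponents n = All.tabulate λ i → let _ , _ , _ , e = bad-partners (proj₁ (bad⁺ n i)) in e

-- Sums of weights

exponent-∷ʳ : ∀ xs a b → exponent (xs ∷ʳ a ∷ʳ b) ≡ winding (xs ++ a ∷ b ∷ []) ℤ.+ + 8 ℤ.* + ℓ b a
exponent-∷ʳ xs a b = trans
  (cong₂ (λ d w → + 8 ℤ.* + d ℤ.+ winding w) (direction-∷ʳ xs a b) (List.++-assoc xs (a ∷ []) (b ∷ [])))
  (ℤ.+-comm (+ 8 ℤ.* + ℓ b a) (winding (xs ++ a ∷ b ∷ [])))

exponent-branch : ∀ xs a b c → exponent (xs ∷ʳ a ∷ʳ b ∷ʳ c) ≡ winding (xs ++ a ∷ b ∷ []) ℤ.+ branch a b c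
exponent-branch xs a b c = trans
  (cong₂ (λ d r → + 8 ℤ.* + d ℤ.+ r) (direction-∷ʳ (xs ∷ʳ a) b c)
    (trans (cong winding (trans (cong (_∷ʳ c) (List.++-assoc xs (a ∷ []) (b ∷ [])))
                                (List.++-assoc xs (a ∷ b ∷ []) (c ∷ []))))
      (winding-++ xs a b (c ∷ []))))
  (lemma (+ 8 ℤ.* + ℓ c b) (winding (xs ++ a ∷ b ∷ [])) (weight a b c))
  where
  lemma : ∀ i j k → i ℤ.+ (j ℤ.+ (k ℤ.+ 0ℤ)) ≡ j ℤ.+ (i ℤ.+ k)
  lemma = solve-∀

module ListSums {c ℓ} (R : CommutativeRing c ℓ) where

  open CommutativeRing R renaming (refl to ≈-refl; sym to ≈-sym; trans to ≈-trans)
  open Algebra.Properties.CommutativeSemigroup +-commutativeSemigroup using (x∙yz≈y∙xz)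

  Σ : {A : Set} → (A → Carrier) → List A → Carrier
  Σ f = foldr (λ x s → f x + s) 0#

  Σ-cong : ∀ {A : Set} {f g : A → Carrier} {xs} → All (λ x → f x ≈ g x) xs → Σ f xs ≈ Σ g xs
  Σ-cong []       = ≈-refl
  Σ-cong (e ∷ es) = +-cong e (Σ-cong es)

  Σ-++ : ∀ {A : Set} (f : A → Carrier) xs ys → Σ f (xs ++ ys) ≈ Σ f xs + Σ f ys
  Σ-++ f []       ys = ≈-sym (+-identityˡ _)
  Σ-++ f (x ∷ xs) ys = ≈-trans (+-congˡ (Σ-++ f xs ys)) (≈-sym (+-assoc _ _ _))

  Σ-↭ : ∀ {A : Set} (f : A → Carrier) {xs ys} → xs ↭ ys → Σ f xs ≈ Σ f ys
  Σ-↭ f ↭.refl         = ≈-refl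
  Σ-↭ f (↭.prep x p)   = +-congˡ (Σ-↭ f p)
  Σ-↭ f (↭.swap x y p) = ≈-trans (+-congˡ (+-congˡ (Σ-↭ f p))) (x∙yz≈y∙xz _ _ _)
  Σ-↭ f (↭.trans p q)  = ≈-trans (Σ-↭ f p) (Σ-↭ f q)

  Σ-map : ∀ {A B : Set} (f : B → Carrier) (g : A → B) xs → Σ f (map g xs) ≈ Σ (f ∘ g) xs
  Σ-map f g []       = ≈-refl
  Σ-map f g (x ∷ xs) = +-congˡ (Σ-map f g xs)

  Σ-concatMap : ∀ {A B : Set} (f : B → Carrier) (g : A → List B) xs →
                Σ f (concatMap g xs) ≈ Σ (λ x → Σ f (g x)) xs
  Σ-concatMap f g []       = ≈-refl
  Σ-concatMap f g (x ∷ xs) = ≈-trans (Σ-++ f (g x) (concatMap g xs)) (+-congˡ (Σ-concatMap f g xs))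

  Σ-partition : ∀ {A : Set} {P : A → Set} (P? : ∀ x → Dec (P x)) (f : A → Carrier) xs →
                Σ f xs ≈ Σ f (filter P? xs) + Σ f (filter (¬? ∘ P?) xs)
  Σ-partition P? f []       = ≈-sym (+-identityˡ _)
  Σ-partition P? f (x ∷ xs) with does (P? x)
  ... | true  = ≈-trans (+-congˡ (Σ-partition P? f xs)) (≈-sym (+-assoc _ _ _))
  ... | false = ≈-trans (+-congˡ (Σ-partition P? f xs)) (x∙yz≈y∙xz _ _ _)

  Σ-*ˡ : ∀ {A : Set} k (f : A → Carrier) xs → Σ (λ x → k * f x) xs ≈ k * Σ f xs
  Σ-*ˡ k f []       = ≈-sym (zeroʳ k)
  Σ-*ˡ k f (x ∷ xs) = ≈-trans (+-congˡ (Σ-*ˡ k f xs)) (≈-sym (distribˡ k _ _))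

-- The powers χ i = yⁱ of a 48th root of unity y with y²⁴ = -1.

record Character {c ℓ} (R : CommutativeRing c ℓ) : Set (c ⊔ ℓ) where
  open CommutativeRing R using (Carrier; _≈_; _+_; _*_; -_; 0#; 1#)
  field
    χ     : ℤ → Carrier
    χ-+   : ∀ i j → χ (i ℤ.+ j) ≈ χ i * χ j
    χ-≅   : ∀ {i j} → i ≅ j [mod 48 ] → χ i ≈ χ j
    χ-24  : χ (+ 24) ≈ - 1#
    halve : ∀ x → x + x ≈ 0# → x ≈ 0#

module Observable {c ℓ} {R : CommutativeRing c ℓ} (y : Character R) where

  open CommutativeRing R renaming (refl to ≈-refl; sym to ≈-sym; trans to ≈-trans)
  open Character y
  open ListSums R
  open Relation.Binary.Reasoning.Setoid setoid
  open Algebra.Properties.Ring ring using (-1*x≈-x)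

  F : ℕ → Carrier
  F n = Σ (χ ∘ exponent) (slitSAWs n)

  -- The sum y⁹ + y⁻⁹ of the factors of a left and a right turn.
  k : Carrier
  k = χ (+ 9) + χ (+ 39)

  χ-shift : ∀ {i j} m → i ≅ j ℤ.+ m [mod 48 ] → χ i ≈ χ m * χ j
  χ-shift m e = ≈-trans (χ-≅ e) (≈-trans (χ-+ _ m) (*-comm _ _))

  Σ-turns : ∀ {e i j} → Turns e i j → ∀ m → χ (m ℤ.+ i) + (χ (m ℤ.+ j) + 0#) ≈ k * χ (m ℤ.+ e)
  Σ-turns {e} (left-right p q) m = ≈-trans (+-cong (χ-shift (+ 9) (add p)) (≈-trans (+-identityʳ _) (χ-shift (+ 39) (add q))))
    (≈-sym (distribʳ _ _ _))
    where
    add : ∀ {i l} → i ≅ e ℤ.+ l [mod 48 ] → m ℤ.+ i ≅ m ℤ.+ e ℤ.+ l [mod 48 ]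
    add {i} {l} = subst (+ 48 ℤ.∣_) (lemma m i e l)
      where
      lemma : ∀ m i e l → i ℤ.- (e ℤ.+ l) ≡ m ℤ.+ i ℤ.- (m ℤ.+ e ℤ.+ l)
      lemma = solve-∀
  Σ-turns (right-left p q) m = ≈-trans
    (≈-trans (+-congˡ (+-identityʳ _)) (≈-trans (+-comm _ _) (+-congˡ (≈-sym (+-identityʳ _)))))
    (Σ-turns (left-right q p) m)

  Σ-exts : ∀ {w} → Walk w → Σ (λ c → χ (exponent (w ∷ʳ c))) (exts w) ≈ k * χ (exponent w)
  Σ-exts {w} wk =
    let xs , a , b , eq , ab = walk-end wk
        c₁ , c₂ , eq′ , turns = branches (adj-sym ab)
    in subst (λ w → Σ (λ c → χ (exponent (w ∷ʳ c))) (exts w) ≈ k * χ (exponent w)) (sym eq)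
       (subst (λ cs → Σ (λ c → χ (exponent (xs ∷ʳ a ∷ʳ b ∷ʳ c))) cs ≈ k * χ (exponent (xs ∷ʳ a ∷ʳ b)))
         (sym (trans (exts-∷ʳ xs a b) eq′))
         (subst₂ _≈_
           (sym (cong₂ (λ i j → χ i + (χ j + 0#)) (exponent-branch xs a b c₁) (exponent-branch xs a b c₂)))
           (sym (cong (λ i → k * χ i) (exponent-∷ʳ xs a b)))
           (Σ-turns turns (winding (xs ++ a ∷ b ∷ [])))))

  Σ-extensions : ∀ n → Σ (χ ∘ pairExponent) (extensions (suc n)) ≈ k * F (suc n)
  Σ-extensions n = begin
    Σ (χ ∘ pairExponent) (extensions (suc n))
      ≈⟨ Σ-concatMap (χ ∘ pairExponent) (λ w → map (w ,_) (exts w)) (slitSAWs (suc n)) ⟩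
    Σ (λ w → Σ (χ ∘ pairExponent) (map (w ,_) (exts w))) (slitSAWs (suc n))
      ≈⟨ Σ-cong (All.tabulate λ {w} i →
           ≈-trans (Σ-map (χ ∘ pairExponent) (w ,_) (exts w)) (Σ-exts (proj₁ (∈-slitSAWs⁻ n i)))) ⟩
    Σ (λ w → k * χ (exponent w)) (slitSAWs (suc n))
      ≈⟨ Σ-*ˡ k (χ ∘ exponent) (slitSAWs (suc n)) ⟩
    k * F (suc n) ∎

  -- Adding the sum to itself, rearranged by `partner`, gives zero without choosing a representative
  -- of each pair; `halve` then removes the factor 2.
  Σ-bad : ∀ n → Σ (χ ∘ pairExponent) (filter (¬? ∘ good?) (extensions (suc n))) ≈ 0#
  Σ-bad n = halve B (begin
    B + B                                      ≈⟨ +-congˡ (Σ-↭ (χ ∘ pairExponent) (bad-↭ n)) ⟨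
    B + Σ (χ ∘ pairExponent) (map partner bads) ≈⟨ +-congˡ (Σ-map (χ ∘ pairExponent) partner bads) ⟩
    B + Σ (χ ∘ pairExponent ∘ partner) bads
      ≈⟨ +-congˡ (Σ-cong (All.map (λ {p} e → ≈-trans (χ-shift (+ 24) e) (*-congʳ χ-24)) (bad-exponents n))) ⟩
    B + Σ (λ p → - 1# * χ (pairExponent p)) bads ≈⟨ +-congˡ (Σ-*ˡ (- 1#) (χ ∘ pairExponent) bads) ⟩
    B + - 1# * B                               ≈⟨ +-congˡ (-1*x≈-x B) ⟩
    B + - B                                    ≈⟨ -‿inverseʳ B ⟩
    0#                                         ∎)
    where
    bads = filter (¬? ∘ good?) (extensions (suc n))
    B = Σ (χ ∘ pairExponent) bads

  F-suc : ∀ n → F (suc (suc n)) ≈ k * F (suc n)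
  F-suc n = begin
    F (suc (suc n))                                   ≈⟨ Σ-↭ (χ ∘ exponent) (good-slitSAWs n) ⟨
    Σ (χ ∘ exponent) (map extend goods)               ≈⟨ Σ-map (χ ∘ exponent) extend goods ⟩
    Σ (χ ∘ pairExponent) goods                        ≈⟨ +-identityʳ _ ⟨
    Σ (χ ∘ pairExponent) goods + 0#                   ≈⟨ +-congˡ (Σ-bad n) ⟨
    Σ (χ ∘ pairExponent) goods + Σ (χ ∘ pairExponent) (filter (¬? ∘ good?) (extensions (suc n)))
                                                      ≈⟨ Σ-partition good? (χ ∘ pairExponent) (extensions (suc n)) ⟨
    Σ (χ ∘ pairExponent) (extensions (suc n))         ≈⟨ Σ-extensions n ⟩
    k * F (suc n)                                     ∎
    where goods = filter good? (extensions (suc n))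

  -- The only walk of length 1 is `a`, whose reversed edge has direction 3, and 8 · 3 = 24.
  F-one : F 1 ≈ - 1#
  F-one = ≈-trans (+-identityʳ _) χ-24

-- Real and complex numbers

module OrderedField {c ℓ₁ ℓ₂} (ℝ : RealNumbers c ℓ₁ ℓ₂) where

  open RealNumbers ℝ renaming (refl to ≈-refl; sym to ≈-sym; trans to ≈-trans)
  open Analysis ℝ using (fromℕ)
  open IsStrictTotalOrder isStrictTotalOrder using (compare; irrefl; asym; <-respʳ-≈; <-respˡ-≈)
    renaming (trans to <-trans)
  open Algebra.Properties.Ring ring using (-‿distribʳ-*)
  open Algebra.Properties.Semiring.Mult semiring using (×1-homo-*)

  fromℕ-* : ∀ m n → fromℕ (m ℕ.* n) ≈ fromℕ m * fromℕ n
  fromℕ-* = ×1-homo-*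

  <⇒≉ : ∀ {x y} → x < y → ¬ x ≈ y
  <⇒≉ x<y x≈y = irrefl x≈y x<y

  ≤-refl : ∀ {x} → x ≤ x
  ≤-refl = irrefl ≈-refl

  <⇒≤ : ∀ {x y} → x < y → x ≤ y
  <⇒≤ = asym

  ≈⇒≤ : ∀ {x y} → x ≈ y → x ≤ y
  ≈⇒≤ e = irrefl (≈-sym e)

  <-≤-trans : ∀ {x y z} → x < y → y ≤ z → x < z
  <-≤-trans {x} {y} {z} x<y y≤z with compare y z
  ... | tri< y<z _ _ = <-trans x<y y<z
  ... | tri≈ _ y≈z _ = <-respʳ-≈ y≈z x<y
  ... | tri> _ _ z<y = contradiction z<y y≤z

  ≤-trans : ∀ {x y z} → x ≤ y → y ≤ z → x ≤ z
  ≤-trans x≤y y≤z z<x = x≤y (<-≤-trans′ y≤z z<x)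
    where
    <-≤-trans′ : ∀ {x y z} → x ≤ y → y < z → x < z
    <-≤-trans′ {x} {y} {z} x≤y y<z with compare x y
    ... | tri< x<y _ _ = <-trans x<y y<z
    ... | tri≈ _ x≈y _ = <-respˡ-≈ (≈-sym x≈y) y<z
    ... | tri> _ _ y<x = contradiction y<x x≤y

  0<⇒x<x+y : ∀ x {y} → 0# < y → x < x + y
  0<⇒x<x+y x {y} 0<y = <-respˡ-≈ (+-identityˡ x) (<-respʳ-≈ (+-comm y x) (+-monoˡ-< x 0<y))

  +-mono-≤ : ∀ {x y u v} → x ≤ y → u ≤ v → x + u ≤ y + v
  +-mono-≤ {x} {y} {u} {v} x≤y u≤v = ≤-trans (+-monoˡ-≤ x≤y)
    (λ l → +-monoˡ-≤ u≤v (<-respʳ-≈ (+-comm y u) (<-respˡ-≈ (+-comm y v) l)))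
    where
    +-monoˡ-≤ : ∀ {x y z} → x ≤ y → x + z ≤ y + z
    +-monoˡ-≤ {x} {y} {z} x≤y l = x≤y (<-respˡ-≈ (cancel y z) (<-respʳ-≈ (cancel x z) (+-monoˡ-< (- z) l)))
      where
      cancel : ∀ x z → x + z + - z ≈ x
      cancel x z = ≈-trans (+-assoc x z (- z)) (≈-trans (+-congˡ (-‿inverseʳ z)) (+-identityʳ x))

  x<0⇒0<-x : ∀ {x} → x < 0# → 0# < - x
  x<0⇒0<-x {x} x<0 = <-respˡ-≈ (-‿inverseʳ x) (<-respʳ-≈ (+-identityˡ (- x)) (+-monoˡ-< (- x) x<0))

  0<x+y : ∀ {x y} → 0# < x → 0# < y → 0# < x + y
  0<x+y {x} 0<x 0<y = <-trans 0<x (0<⇒x<x+y x 0<y)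

  0<fromℕ : ∀ n → 0# < fromℕ (suc n)
  0<fromℕ zero    = <-respʳ-≈ (≈-sym (+-identityʳ 1#)) 0<1
  0<fromℕ (suc n) = 0<x+y 0<1 (0<fromℕ n)

  fromℕ≉0 : ∀ n → ¬ fromℕ (suc n) ≈ 0#
  fromℕ≉0 n e = <⇒≉ (0<fromℕ n) (≈-sym e)

  0<x⁻¹ : ∀ {x} → 0# < x → 0# < x ⁻¹
  0<x⁻¹ {x} 0<x with compare 0# (x ⁻¹)
  ... | tri< l _ _ = l
  ... | tri≈ _ e _ = contradiction 0<1
    (irrefl (≈-trans (≈-sym (zeroʳ x)) (≈-trans (*-congˡ e) (*-inverseʳ λ x≈0 → <⇒≉ 0<x (≈-sym x≈0)))))
  ... | tri> _ _ g = contradiction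
    (<-respʳ-≈ (≈-trans (≈-sym (-‿distribʳ-* x (x ⁻¹))) (-‿cong (*-inverseʳ λ x≈0 → <⇒≉ 0<x (≈-sym x≈0))))
      (*-pos 0<x (x<0⇒0<-x g)))
    (asym -1<0)
    where
    -1<0 : - 1# < 0#
    -1<0 = <-respˡ-≈ (+-identityˡ (- 1#)) (<-respʳ-≈ (-‿inverseʳ 1#) (+-monoˡ-< (- 1#) 0<1))

  *-cancel-0 : ∀ {x y} → ¬ x ≈ 0# → x * y ≈ 0# → y ≈ 0#
  *-cancel-0 {x} {y} x≉0 e = begin
    y                ≈⟨ *-identityˡ y ⟨
    1# * y           ≈⟨ *-congʳ (≈-trans (*-comm (x ⁻¹) x) (*-inverseʳ x≉0)) ⟨
    x ⁻¹ * x * y     ≈⟨ *-assoc (x ⁻¹) x y ⟩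
    x ⁻¹ * (x * y)   ≈⟨ *-congˡ e ⟩
    x ⁻¹ * 0#        ≈⟨ zeroʳ (x ⁻¹) ⟩
    0#               ∎
    where open Relation.Binary.Reasoning.Setoid setoid

  2*x≈x+x : ∀ x → fromℕ 2 * x ≈ x + x
  2*x≈x+x x = ≈-trans (distribʳ x 1# (1# + 0#)) (+-cong (*-identityˡ x) (≈-trans (*-congʳ (+-identityʳ 1#)) (*-identityˡ x)))

  x+x≈0⇒x≈0 : ∀ x → x + x ≈ 0# → x ≈ 0#
  x+x≈0⇒x≈0 x e = *-cancel-0 (fromℕ≉0 1) (≈-trans (2*x≈x+x x) e)

  ⁻¹-unique : ∀ {x y} → ¬ x ≈ 0# → x * y ≈ 1# → x ⁻¹ ≈ y
  ⁻¹-unique {x} {y} x≉0 e = begin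
    x ⁻¹              ≈⟨ *-identityʳ (x ⁻¹) ⟨
    x ⁻¹ * 1#         ≈⟨ *-congˡ e ⟨
    x ⁻¹ * (x * y)    ≈⟨ *-assoc (x ⁻¹) x y ⟨
    x ⁻¹ * x * y      ≈⟨ *-congʳ (≈-trans (*-comm (x ⁻¹) x) (*-inverseʳ x≉0)) ⟩
    1# * y            ≈⟨ *-identityˡ y ⟩
    y                 ∎
    where open Relation.Binary.Reasoning.Setoid setoid

  -- 1/m = n/(m n), which brings angles to a common denominator.
  ⁻¹-fromℕ : ∀ a b → fromℕ (suc a) ⁻¹ ≈ fromℕ (suc b) * fromℕ (suc a ℕ.* suc b) ⁻¹
  ⁻¹-fromℕ a b = ⁻¹-unique (fromℕ≉0 a) (begin
    fromℕ (suc a) * (fromℕ (suc b) * fromℕ (suc a ℕ.* suc b) ⁻¹)  ≈⟨ *-assoc _ _ _ ⟨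
    fromℕ (suc a) * fromℕ (suc b) * fromℕ (suc a ℕ.* suc b) ⁻¹    ≈⟨ *-congʳ (fromℕ-* (suc a) (suc b)) ⟨
    fromℕ (suc a ℕ.* suc b) * fromℕ (suc a ℕ.* suc b) ⁻¹          ≈⟨ *-inverseʳ (fromℕ≉0 (b ℕ.+ a ℕ.* suc b)) ⟩
    1#                                                              ∎)
    where open Relation.Binary.Reasoning.Setoid setoid

module ComplexNumbers {c ℓ₁ ℓ₂} (ℝ : RealNumbers c ℓ₁ ℓ₂) where

  open RealNumbers ℝ renaming (refl to ≈-refl; sym to ≈-sym; trans to ≈-trans)
  open Analysis ℝ
  open OrderedField ℝ
  open IsStrictTotalOrder isStrictTotalOrder using (<-respʳ-≈)
  open Algebra.Properties.Ring ring using (-0#≈0#; -1*x≈-x; -‿distribʳ-*; -‿involutive)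
  open Algebra.Solver.Ring.NaturalCoefficients.Default commutativeSemiring using (solve; _:+_; _:*_; _:=_)

  -- The solver handles commutative semirings. With negation written as a product, `- 1#` becomes
  -- just another variable for it.
  neg : ∀ x → - x ≈ - 1# * x
  neg x = ≈-sym (-1*x≈-x x)

  *-assoc-re : ∀ a b c d e f →
    (a * c - b * d) * e - (a * d + b * c) * f ≈ a * (c * e - d * f) - b * (c * f + d * e)
  *-assoc-re a b c d e f = ≈-trans (+-cong (*-congʳ (+-congˡ (neg _))) (neg _))
    (≈-trans
      (solve 7 (λ a b c d e f n →
        (a :* c :+ n :* (b :* d)) :* e :+ n :* ((a :* d :+ b :* c) :* f) :=
        a :* (c :* e :+ n :* (d :* f)) :+ n :* (b :* (c :* f :+ d :* e))) ≈-refl a b c d e f (- 1#))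
      (≈-sym (+-cong (*-congˡ (+-congˡ (neg _))) (neg _))))

  *-assoc-im : ∀ a b c d e f →
    (a * c - b * d) * f + (a * d + b * c) * e ≈ a * (c * f + d * e) + b * (c * e - d * f)
  *-assoc-im a b c d e f = ≈-trans (+-congʳ (*-congʳ (+-congˡ (neg _))))
    (≈-trans
      (solve 7 (λ a b c d e f n →
        (a :* c :+ n :* (b :* d)) :* f :+ (a :* d :+ b :* c) :* e :=
        a :* (c :* f :+ d :* e) :+ b :* (c :* e :+ n :* (d :* f))) ≈-refl a b c d e f (- 1#))
      (≈-sym (+-congˡ (*-congˡ (+-congˡ (neg _))))))

  distribˡ-re : ∀ a b c d e f → a * (c + e) - b * (d + f) ≈ (a * c - b * d) + (a * e - b * f)
  distribˡ-re a b c d e f = ≈-trans (+-congˡ (neg _))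
    (≈-trans
      (solve 7 (λ a b c d e f n →
        a :* (c :+ e) :+ n :* (b :* (d :+ f)) :=
        (a :* c :+ n :* (b :* d)) :+ (a :* e :+ n :* (b :* f))) ≈-refl a b c d e f (- 1#))
      (≈-sym (+-cong (+-congˡ (neg _)) (+-congˡ (neg _)))))

  distribˡ-im : ∀ a b c d e f → a * (d + f) + b * (c + e) ≈ (a * d + b * c) + (a * f + b * e)
  distribˡ-im = solve 6 (λ a b c d e f →
    a :* (d :+ f) :+ b :* (c :+ e) := (a :* d :+ b :* c) :+ (a :* f :+ b :* e)) ≈-refl

  1*-re : ∀ a b → 1# * a - 0# * b ≈ a
  1*-re a b = ≈-trans (+-cong (*-identityˡ a) (≈-trans (-‿cong (zeroˡ b)) -0#≈0#)) (+-identityʳ a)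

  1*-im : ∀ a b → 1# * b + 0# * a ≈ b
  1*-im a b = ≈-trans (+-cong (*-identityˡ b) (zeroˡ a)) (+-identityʳ b)

  -- A copy of the equality of ℂ that does not unfold into real and imaginary
  -- parts, since those of powers are huge terms.

  infix 4 _≋_

  record _≋_ (z w : Complex) : Set ℓ₁ where
    constructor equal
    field parts : z ℂ.≈ w

  open _≋_ public

  ℂ-*-comm : ∀ z w → z ℂ.* w ≋ w ℂ.* z
  ℂ-*-comm (a +i b) (c +i d) = equal
    (+-cong (*-comm a c) (-‿cong (*-comm b d)) , ≈-trans (+-comm _ _) (+-cong (*-comm b c) (*-comm a d)))

  ≋-isEquivalence : IsEquivalence _≋_
  ≋-isEquivalence = record
    { refl  = equal (≈-refl , ≈-refl)
    ; sym   = λ (equal (e , f)) → equal (≈-sym e , ≈-sym f)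
    ; trans = λ (equal (e , f)) (equal (g , h)) → equal (≈-trans e g , ≈-trans f h)
    }

  open IsEquivalence ≋-isEquivalence public using () renaming (refl to ≋-refl; sym to ≋-sym; trans to ≋-trans)

  ℂ-+-cong : ∀ {z z′ w w′} → z ≋ z′ → w ≋ w′ → z ℂ.+ w ≋ z′ ℂ.+ w′
  ℂ-+-cong (equal (e , f)) (equal (g , h)) = equal (+-cong e g , +-cong f h)

  ℂ-*-cong : ∀ {z z′ w w′} → z ≋ z′ → w ≋ w′ → z ℂ.* w ≋ z′ ℂ.* w′
  ℂ-*-cong (equal (e , f)) (equal (g , h)) =
    equal (+-cong (*-cong e g) (-‿cong (*-cong f h)) , +-cong (*-cong e h) (*-cong f g))

  ℂ-*-identityˡ : ∀ z → ℂ.1# ℂ.* z ≋ z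
  ℂ-*-identityˡ z = equal (1*-re _ _ , 1*-im _ _)

  ℂ-distribˡ : ∀ z w v → z ℂ.* (w ℂ.+ v) ≋ z ℂ.* w ℂ.+ z ℂ.* v
  ℂ-distribˡ z w v = equal (distribˡ-re _ _ _ _ _ _ , distribˡ-im _ _ _ _ _ _)

  ℂ-commutativeRing : CommutativeRing c ℓ₁
  ℂ-commutativeRing = record
    { Carrier = Complex
    ; _≈_     = _≋_
    ; _+_     = ℂ._+_
    ; _*_     = ℂ._*_
    ; -_      = ℂ.-_
    ; 0#      = ℂ.0#
    ; 1#      = ℂ.1#
    ; isCommutativeRing = record
      { isRing = record
        { +-isAbelianGroup = record
          { isGroup = record
            { isMonoid = record
              { isSemigroup = record
                { isMagma = record { isEquivalence = ≋-isEquivalence ; ∙-cong = ℂ-+-cong }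
                ; assoc = λ z w v → equal (+-assoc _ _ _ , +-assoc _ _ _)
                }
              ; identity = (λ z → equal (+-identityˡ _ , +-identityˡ _)) , (λ z → equal (+-identityʳ _ , +-identityʳ _))
              }
            ; inverse = (λ z → equal (-‿inverseˡ _ , -‿inverseˡ _)) , (λ z → equal (-‿inverseʳ _ , -‿inverseʳ _))
            ; ⁻¹-cong = λ (equal (e , f)) → equal (-‿cong e , -‿cong f)
            }
          ; comm = λ z w → equal (+-comm _ _ , +-comm _ _)
          }
        ; *-cong = ℂ-*-cong
        ; *-assoc = λ z w v → equal (*-assoc-re _ _ _ _ _ _ , *-assoc-im _ _ _ _ _ _)
        ; *-identity = ℂ-*-identityˡ , (λ z → ≋-trans (ℂ-*-comm z ℂ.1#) (ℂ-*-identityˡ z))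
        ; distrib = ℂ-distribˡ , (λ z w v → ≋-trans (ℂ-*-comm (w ℂ.+ v) z)
            (≋-trans (ℂ-distribˡ z w v) (≋-sym (ℂ-+-cong (ℂ-*-comm w z) (ℂ-*-comm v z)))))
        }
      ; *-comm = ℂ-*-comm
      }
    }

  module ℂ-ring = CommutativeRing ℂ-commutativeRing

  expi-cong : ∀ {θ φ} → θ ≈ φ → expi θ ≋ expi φ
  expi-cong e = equal (cos-cong e , sin-cong e)

  expi-+ : ∀ θ φ → expi (θ + φ) ≋ expi θ ℂ.* expi φ
  expi-+ θ φ = equal (cos-+ θ φ , ≈-trans (sin-+ θ φ) (+-comm _ _))

  conj : Complex → Complex
  conj (a +i b) = a +i (- b)

  *-conj : ∀ z → re z * re z + im z * im z ≈ 1# → z ℂ.* conj z ≋ ℂ.1#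
  *-conj (a +i b) e = equal
    ( ≈-trans (+-congˡ (≈-trans (-‿cong (≈-sym (-‿distribʳ-* b b))) (-‿involutive _))) e
    , ≈-trans (+-cong (≈-sym (-‿distribʳ-* a b)) (*-comm b a)) (-‿inverseˡ (a * b)))

  expi-conj : ∀ θ → expi θ ℂ.* conj (expi θ) ≋ ℂ.1#
  expi-conj θ = *-conj (expi θ) (cos²+sin²≈1 θ)

  -- The values at 0 are not among the axioms, but `expi 0#` is idempotent by the addition theorems
  -- and invertible by the unit circle equation.
  expi-0 : expi 0# ≋ ℂ.1#
  expi-0 = begin
    e                       ≈⟨ ℂ-ring.*-identityʳ e ⟨
    e ℂ.* ℂ.1#              ≈⟨ ℂ-ring.*-congˡ (expi-conj 0#) ⟨
    e ℂ.* (e ℂ.* conj e)    ≈⟨ ℂ-ring.*-assoc e e (conj e) ⟨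
    e ℂ.* e ℂ.* conj e      ≈⟨ ℂ-ring.*-congʳ (≋-sym (≋-trans (expi-cong (≈-sym (+-identityʳ 0#))) (expi-+ 0# 0#))) ⟩
    e ℂ.* conj e            ≈⟨ expi-conj 0# ⟩
    ℂ.1#                    ∎
    where
    open Relation.Binary.Reasoning.Setoid ℂ-ring.setoid
    e = expi 0#

  expi-fromℕ : ∀ n θ → expi (fromℕ n * θ) ≋ expi θ ℂ.^ n
  expi-fromℕ zero    θ = ≋-trans (expi-cong (zeroˡ θ)) expi-0
  expi-fromℕ (suc n) θ = ≋-trans
    (expi-cong (≈-trans (distribʳ θ 1# (fromℕ n)) (+-congʳ (*-identityˡ θ))))
    (≋-trans (expi-+ θ (fromℕ n * θ)) (ℂ-ring.*-congˡ (expi-fromℕ n θ)))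

  -- sin π = 2 sin (π/2) cos (π/2), where sin (π/2) ≠ 0.

  π/2 : Carrier
  π/2 = π * fromℕ 2 ⁻¹

  π/2+π/2 : π/2 + π/2 ≈ π
  π/2+π/2 = begin
    π/2 + π/2                       ≈⟨ +-cong (*-identityʳ π/2) (*-identityʳ π/2) ⟨
    π/2 * 1# + π/2 * 1#             ≈⟨ distribˡ π/2 1# 1# ⟨
    π/2 * (1# + 1#)                 ≈⟨ *-congˡ (+-congˡ (+-identityʳ 1#)) ⟨
    π * fromℕ 2 ⁻¹ * fromℕ 2        ≈⟨ *-assoc π _ _ ⟩
    π * (fromℕ 2 ⁻¹ * fromℕ 2)      ≈⟨ *-congˡ (≈-trans (*-comm _ _) (*-inverseʳ (fromℕ≉0 1))) ⟩
    π * 1#                          ≈⟨ *-identityʳ π ⟩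
    π                               ∎
    where open Relation.Binary.Reasoning.Setoid setoid

  0<π/2 : 0# < π/2
  0<π/2 = *-pos 0<π (0<x⁻¹ (0<fromℕ 1))

  0<sin-π/2 : 0# < sin π/2
  0<sin-π/2 = sin-pos π/2 0<π/2 (<-respʳ-≈ π/2+π/2 (0<⇒x<x+y π/2 0<π/2))

  cos-π/2 : cos π/2 ≈ 0#
  cos-π/2 = *-cancel-0 (λ e → <⇒≉ 0<sin-π/2 (≈-sym e)) (x+x≈0⇒x≈0 _
    (≈-trans (+-congˡ (*-comm _ _)) (≈-trans (≈-sym (sin-+ π/2 π/2)) (≈-trans (sin-cong π/2+π/2) sin-π))))

  sin²-π/2 : sin π/2 * sin π/2 ≈ 1#
  sin²-π/2 = ≈-trans (≈-sym (≈-trans (+-congʳ (≈-trans (*-congʳ cos-π/2) (zeroˡ _))) (+-identityˡ _))) (cos²+sin²≈1 π/2)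

  expi-π : expi π ≋ ℂ.- ℂ.1#
  expi-π = equal
    ( ≈-trans (cos-cong (≈-sym π/2+π/2)) (≈-trans (cos-+ π/2 π/2)
      (≈-trans (+-cong (≈-trans (*-congʳ cos-π/2) (zeroˡ _)) (-‿cong sin²-π/2)) (+-identityˡ _)))
    , ≈-trans sin-π (≈-sym -0#≈0#))

  -- All angles are multiples of τ = 2π / 48.

  τ : Carrier
  τ = fromℕ 2 * π * fromℕ 48 ⁻¹

  ω : Complex
  ω = expi τ

  private
    swap₃ : ∀ a b i → a * (b * i) ≈ b * (a * i)
    swap₃ = solve 3 (λ a b i → a :* (b :* i) := b :* (a :* i)) ≈-refl

    swap₃′ : ∀ a b i → a * b * i ≈ b * (a * i)
    swap₃′ = solve 3 (λ a b i → a :* b :* i := b :* (a :* i)) ≈-refl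

    swap₄ : ∀ p a b i → p * (a * b * i) ≈ a * (b * p * i)
    swap₄ = solve 4 (λ p a b i → p :* (a :* b :* i) := a :* (b :* p :* i)) ≈-refl

    swap₄′ : ∀ a b t i → a * b * t * i ≈ a * t * (b * i)
    swap₄′ = solve 4 (λ a b t i → a :* b :* t :* i := a :* t :* (b :* i)) ≈-refl

  π≈24τ : π ≈ fromℕ 24 * τ
  π≈24τ = begin
    π                                         ≈⟨ *-identityʳ π ⟨
    π * 1#                                    ≈⟨ *-congˡ (*-inverseʳ (fromℕ≉0 47)) ⟨
    π * (fromℕ 48 * i)                        ≈⟨ *-congˡ (*-congʳ (fromℕ-* 24 2)) ⟩
    π * (fromℕ 24 * fromℕ 2 * i)              ≈⟨ swap₄ π (fromℕ 24) (fromℕ 2) i ⟩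
    fromℕ 24 * τ                              ∎
    where
    open Relation.Binary.Reasoning.Setoid setoid
    i = fromℕ 48 ⁻¹

  ω^≋ : ∀ n {θ} → fromℕ n * τ ≈ θ → ω ℂ.^ n ≋ expi θ
  ω^≋ n e = ≋-trans (≋-sym (expi-fromℕ n τ)) (expi-cong e)

  ω^24 : ω ℂ.^ 24 ≋ ℂ.- ℂ.1#
  ω^24 = ≋-trans (ω^≋ 24 (≈-sym π≈24τ)) expi-π

  ω^8 : ω ℂ.^ 8 ≋ ζ
  ω^8 = ω^≋ 8 (≈-sym (≈-trans (*-congˡ (⁻¹-fromℕ 5 7)) (swap₃ (fromℕ 2 * π) (fromℕ 8) (fromℕ 48 ⁻¹))))

  ω^[6j+1] : ∀ j → ω ℂ.^ (6 ℕ.* toℕ j ℕ.+ 1) ≋ y j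
  ω^[6j+1] j = ω^≋ (6 ℕ.* toℕ j ℕ.+ 1) (≈-sym (swap₃′ (fromℕ 2 * π) (fromℕ (6 ℕ.* toℕ j ℕ.+ 1)) (fromℕ 48 ⁻¹)))

  3τ≈π/8 : fromℕ 3 * τ ≈ π / fromℕ 8
  3τ≈π/8 = ≈-sym (≈-trans (*-congʳ π≈24τ) (≈-trans (*-congʳ (*-congʳ (fromℕ-* 3 8)))
    (≈-trans (swap₄′ (fromℕ 3) (fromℕ 8) τ (fromℕ 8 ⁻¹))
      (≈-trans (*-congˡ (*-inverseʳ (fromℕ≉0 7))) (*-identityʳ _)))))

-- Residues and powers modulo 48

%-≅ : ∀ {i j} → i ≅ j [mod 48 ] → i ℤ.%ℕ 48 ≡ j ℤ.%ℕ 48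
%-≅ {i} {j} d = residue (ℤ.n%ℕd<d i 48) (ℤ.n%ℕd<d j 48)
  (subst (+ 48 ℤ.∣_) (lemma i j (+ (i ℤ.%ℕ 48)) (+ (j ℤ.%ℕ 48)) (i ℤ./ℕ 48) (j ℤ./ℕ 48)
      (ℤ.a≡a%ℕn+[a/ℕn]*n i 48) (ℤ.a≡a%ℕn+[a/ℕn]*n j 48))
    (ℤ.∣m∣n⇒∣m-n d (ℤ.divides (i ℤ./ℕ 48 ℤ.- j ℤ./ℕ 48) refl)))
  where
  lemma : ∀ i j a b q r → i ≡ a ℤ.+ q ℤ.* + 48 → j ≡ b ℤ.+ r ℤ.* + 48 → i ℤ.- j ℤ.- (q ℤ.- r) ℤ.* + 48 ≡ a ℤ.- b
  lemma _ _ a b q r refl refl = identity a b q r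
    where
    identity : ∀ a b q r → (a ℤ.+ q ℤ.* + 48) ℤ.- (b ℤ.+ r ℤ.* + 48) ℤ.- (q ℤ.- r) ℤ.* + 48 ≡ a ℤ.- b
    identity = solve-∀
  residue : ∀ {a b} → a ℕ.< 48 → b ℕ.< 48 → + 48 ℤ.∣ + a ℤ.- + b → a ≡ b
  residue {a} {b} a< b< d = by (ℤ.∣ + a ℤ.- + b ∣) refl
    where
    bound : ℤ.∣ + a ℤ.- + b ∣ ℕ.< 48
    bound = ℕ.≤-<-trans (subst (λ i → ℤ.∣ i ∣ ℕ.≤ a ℕ.⊔ b) (sym (ℤ.m-n≡m⊖n a b)) (ℤ.∣m⊝n∣≤m⊔n a b)) (ℕ.⊔-lub a< b<)
    by : ∀ m → ℤ.∣ + a ℤ.- + b ∣ ≡ m → a ≡ b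
    by zero    eq = ℤ.+-injective (ℤ.i-j≡0⇒i≡j (+ a) (+ b) (ℤ.∣i∣≡0⇒i≡0 eq))
    by (suc m) eq = contradiction (ℕ.∣⇒≤ (subst (48 ℕ.∣_) eq (ℤ.∣⇒∣ᵤ d))) (ℕ.<⇒≱ (subst (ℕ._< 48) eq bound))

module Powers {c ℓ} (R : CommutativeRing c ℓ) where

  open CommutativeRing R renaming (refl to ≈-refl; sym to ≈-sym; trans to ≈-trans)
  open Algebra.Properties.Semiring.Exp semiring
  open Algebra.Properties.Ring ring using (-1*x≈-x; -‿involutive)
  open Relation.Binary.Reasoning.Setoid setoid

  1^n≈1 : ∀ n → 1# ^ n ≈ 1#
  1^n≈1 zero    = ≈-refl
  1^n≈1 (suc n) = ≈-trans (*-identityˡ _) (1^n≈1 n)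

  ^-≡ : ∀ x {m n} → m ≡ n → x ^ m ≈ x ^ n
  ^-≡ x refl = ≈-refl

  ^-multiple : ∀ {x} m n → x ^ m ≈ 1# → x ^ (m ℕ.* n) ≈ 1#
  ^-multiple {x} m n e = ≈-trans (≈-sym (^-assocʳ x m n)) (≈-trans (^-congˡ n e) (1^n≈1 n))

  [-1]^2≈1 : (- 1#) ^ 2 ≈ 1#
  [-1]^2≈1 = ≈-trans (*-congˡ (*-identityʳ (- 1#))) (≈-trans (-1*x≈-x (- 1#)) (-‿involutive 1#))

  module 48thRoot (y : Carrier) (y^24 : y ^ 24 ≈ - 1#) where

    y^48 : y ^ 48 ≈ 1#
    y^48 = ≈-trans (≈-sym (^-assocʳ y 24 2)) (≈-trans (^-congˡ 2 y^24) [-1]^2≈1)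

    ^-mod : ∀ m → y ^ m ≈ y ^ (+ m ℤ.%ℕ 48)
    ^-mod m = begin
      y ^ m                                      ≈⟨ ^-≡ y (ℕ.m≡m%n+[m/n]*n m 48) ⟩
      y ^ (m ℕ.% 48 ℕ.+ m ℕ./ 48 ℕ.* 48)         ≈⟨ ^-homo-* y (m ℕ.% 48) (m ℕ./ 48 ℕ.* 48) ⟩
      y ^ (m ℕ.% 48) * y ^ (m ℕ./ 48 ℕ.* 48)     ≈⟨ *-congˡ (^-≡ y (ℕ.*-comm (m ℕ./ 48) 48)) ⟩
      y ^ (m ℕ.% 48) * y ^ (48 ℕ.* (m ℕ./ 48))   ≈⟨ *-congˡ (^-multiple 48 (m ℕ./ 48) y^48) ⟩
      y ^ (m ℕ.% 48) * 1#                        ≈⟨ *-identityʳ _ ⟩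
      y ^ (m ℕ.% 48)                             ∎

    ^-≅ : ∀ m i → + m ≅ i [mod 48 ] → y ^ m ≈ y ^ (i ℤ.%ℕ 48)
    ^-≅ m i e = ≈-trans (^-mod m) (^-≡ y (%-≅ {+ m} {i} e))

    -- Exponents may be negative; reducing them modulo 48 avoids inverses.
    character : (∀ x → x + x ≈ 0# → x ≈ 0#) → Character R
    character halve = record
      { χ     = λ i → y ^ (i ℤ.%ℕ 48)
      ; χ-+   = λ i j → ≈-sym (≈-trans (≈-sym (^-homo-* y (i ℤ.%ℕ 48) (j ℤ.%ℕ 48)))
                                       (^-≅ (i ℤ.%ℕ 48 ℕ.+ j ℤ.%ℕ 48) (i ℤ.+ j) (sum-≅ i j)))
      ; χ-≅   = λ {i} {j} e → ^-≡ y (%-≅ {i} {j} e)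
      ; χ-24  = y^24
      ; halve = halve
      }
      where
      sum-≅ : ∀ i j → + (i ℤ.%ℕ 48 ℕ.+ j ℤ.%ℕ 48) ≅ i ℤ.+ j [mod 48 ]
      sum-≅ i j = ℤ.divides (ℤ.- (i ℤ./ℕ 48) ℤ.- j ℤ./ℕ 48)
        (trans (cong (λ k → + (i ℤ.%ℕ 48) ℤ.+ + (j ℤ.%ℕ 48) ℤ.- k)
                 (cong₂ ℤ._+_ (ℤ.a≡a%ℕn+[a/ℕn]*n i 48) (ℤ.a≡a%ℕn+[a/ℕn]*n j 48)))
          (identity (+ (i ℤ.%ℕ 48)) (+ (j ℤ.%ℕ 48)) (i ℤ./ℕ 48) (j ℤ./ℕ 48)))
        where
        identity : ∀ a b q r → a ℤ.+ b ℤ.- ((a ℤ.+ q ℤ.* + 48) ℤ.+ (b ℤ.+ r ℤ.* + 48)) ≡ (ℤ.- q ℤ.- r) ℤ.* + 48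
        identity = solve-∀

    -- For j = 7 the number ζ⁴ y is the power 32 + 43 = 75 of ω, hence equal to -ω³, and the angle
    -- of ω³ is the π/8 in the definition of `xᶜ`.
    y^75 : y ^ 75 ≈ - (y ^ 3)
    y^75 = begin
      y ^ 75          ≈⟨ ^-mod 75 ⟩
      y ^ 27          ≈⟨ ^-homo-* y 24 3 ⟩
      y ^ 24 * y ^ 3  ≈⟨ *-congʳ y^24 ⟩
      - 1# * y ^ 3    ≈⟨ -1*x≈-x _ ⟩
      - (y ^ 3)       ∎

    ^-product : ∀ l m i → + (8 ℕ.* l ℕ.+ m) ≅ i [mod 48 ] → (y ^ 8) ^ l * y ^ m ≈ y ^ (i ℤ.%ℕ 48)
    ^-product l m i e = ≈-trans (*-congʳ (^-assocʳ y 8 l))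
      (≈-trans (≈-sym (^-homo-* y (8 ℕ.* l) m)) (^-≅ (8 ℕ.* l ℕ.+ m) i e))

    -- - (z + z⁻¹) for z = y³³

    coefficient : ∀ {z w} → z ≈ y ^ 33 → z * w ≈ 1# → - (z + w) ≈ y ^ 9 + y ^ 39
    coefficient {z} {w} e e′ = begin
      - (z + w)                    ≈⟨ -1*x≈-x (z + w) ⟨
      - 1# * (z + w)               ≈⟨ *-cong (≈-sym y^24) (+-cong e w≈) ⟩
      y ^ 24 * (y ^ 33 + y ^ 15)   ≈⟨ distribˡ _ _ _ ⟩
      y ^ 24 * y ^ 33 + y ^ 24 * y ^ 15   ≈⟨ +-cong (^-homo-* y 24 33) (^-homo-* y 24 15) ⟨
      y ^ 57 + y ^ 39              ≈⟨ +-congʳ (^-mod 57) ⟩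
      y ^ 9 + y ^ 39               ∎
      where
      w≈ : w ≈ y ^ 15
      w≈ = begin
        w                      ≈⟨ *-identityˡ w ⟨
        1# * w                 ≈⟨ *-congʳ (≈-trans (≈-sym (^-homo-* y 15 33)) y^48) ⟨
        y ^ 15 * y ^ 33 * w    ≈⟨ *-assoc _ _ _ ⟩
        y ^ 15 * (y ^ 33 * w)  ≈⟨ *-congˡ (≈-trans (*-congʳ (≈-sym e)) e′) ⟩
        y ^ 15 * 1#            ≈⟨ *-identityʳ _ ⟩
        y ^ 15                 ∎

  module _ (ω : Carrier) (ω^24 : ω ^ 24 ≈ - 1#) (j : ℕ) where

    private
      ω^48 : ω ^ 48 ≈ 1#
      ω^48 = 48thRoot.y^48 ω ω^24

    root^24 : (ω ^ (6 ℕ.* j ℕ.+ 1)) ^ 24 ≈ - 1#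
    root^24 = begin
      (ω ^ (6 ℕ.* j ℕ.+ 1)) ^ 24            ≈⟨ ^-assocʳ ω (6 ℕ.* j ℕ.+ 1) 24 ⟩
      ω ^ ((6 ℕ.* j ℕ.+ 1) ℕ.* 24)          ≈⟨ ^-≡ ω (identity j) ⟩
      ω ^ (48 ℕ.* (3 ℕ.* j) ℕ.+ 24)         ≈⟨ ^-homo-* ω (48 ℕ.* (3 ℕ.* j)) 24 ⟩
      ω ^ (48 ℕ.* (3 ℕ.* j)) * ω ^ 24       ≈⟨ *-cong (^-multiple 48 (3 ℕ.* j) ω^48) ω^24 ⟩
      1# * - 1#                             ≈⟨ *-identityˡ _ ⟩
      - 1#                                  ∎
      where
      identity : ∀ j → (6 ℕ.* j ℕ.+ 1) ℕ.* 24 ≡ 48 ℕ.* (3 ℕ.* j) ℕ.+ 24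
      identity = ℕ-solve-∀

    -- This explains the exponents 6 j + 1: a power ωᵐ satisfies y⁸ = ζ just when 8 m is congruent
    -- to 8 modulo 48, that is, when m is congruent to 1 modulo 6.
    root^8 : (ω ^ (6 ℕ.* j ℕ.+ 1)) ^ 8 ≈ ω ^ 8
    root^8 = begin
      (ω ^ (6 ℕ.* j ℕ.+ 1)) ^ 8      ≈⟨ ^-assocʳ ω (6 ℕ.* j ℕ.+ 1) 8 ⟩
      ω ^ ((6 ℕ.* j ℕ.+ 1) ℕ.* 8)    ≈⟨ ^-≡ ω (identity j) ⟩
      ω ^ (48 ℕ.* j ℕ.+ 8)           ≈⟨ ^-homo-* ω (48 ℕ.* j) 8 ⟩
      ω ^ (48 ℕ.* j) * ω ^ 8         ≈⟨ *-congʳ (^-multiple 48 j ω^48) ⟩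
      1# * ω ^ 8                     ≈⟨ *-identityˡ _ ⟩
      ω ^ 8                          ∎
      where
      identity : ∀ j → (6 ℕ.* j ℕ.+ 1) ℕ.* 8 ≡ 48 ℕ.* j ℕ.+ 8
      identity = ℕ-solve-∀

ℓ<6 : ∀ u v → ℓ u v ℕ.< 6
ℓ<6 u v = bound (does (basic? u v)) (ℓᵇ<3 u v) (ℓᵇ<3 v u)
  where
  ℓᵇ<3 : ∀ u v → ℓᵇ u v ℕ.< 3
  ℓᵇ<3 u v with does (vertical? u v) | does (adj? v (right v))
  ... | true  | true  = ℕ.s≤s (ℕ.s≤s ℕ.z≤n)
  ... | true  | false = ℕ.s≤s (ℕ.s≤s (ℕ.s≤s ℕ.z≤n))
  ... | false | _     = ℕ.s≤s ℕ.z≤n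
  bound : ∀ b {i j} → i ℕ.< 3 → j ℕ.< 3 → (if b then i else 3 ℕ.+ j) ℕ.< 6
  bound true  i< _ = ℕ.≤-trans i< (ℕ.m≤m+n 3 3)
  bound false _ j< = ℕ.+-monoʳ-< 3 j<

direction<6 : ∀ w → direction w ℕ.< 6
direction<6 []              = ℕ.s≤s ℕ.z≤n
direction<6 (_ ∷ [])        = ℕ.s≤s ℕ.z≤n
direction<6 (u ∷ v ∷ [])    = ℓ<6 v u
direction<6 (_ ∷ v ∷ w ∷ t) = direction<6 (v ∷ w ∷ t)

≅-% : ∀ i → i ≅ + (i ℤ.%ℕ 48) [mod 48 ]
≅-% i = ℤ.divides (i ℤ./ℕ 48) (trans (cong (λ j → j ℤ.- + (i ℤ.%ℕ 48)) (ℤ.a≡a%ℕn+[a/ℕn]*n i 48))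
  (lemma (+ (i ℤ.%ℕ 48)) (i ℤ./ℕ 48)))
  where
  lemma : ∀ a q → a ℤ.+ q ℤ.* + 48 ℤ.- a ≡ q ℤ.* + 48
  lemma = solve-∀

≅-sym : ∀ {i j} → i ≅ j [mod 48 ] → j ≅ i [mod 48 ]
≅-sym {i} {j} d = subst (+ 48 ℤ.∣_) (neg-− i j) (ℤ.∣m⇒∣-m d)

counted-exponent : ∀ l k w → Counted l k w → + (8 ℕ.* toℕ l ℕ.+ toℕ k) ≅ exponent w [mod 48 ]
counted-exponent l k w (d , e) = subst (λ i → i ℤ.+ + toℕ k ≅ exponent w [mod 48 ])
  (trans (sym (ℤ.pos-* 8 (direction w))) (cong (λ d → + (8 ℕ.* d)) d))
  (subst (+ 48 ℤ.∣_) (lemma (+ 8 ℤ.* + direction w) (+ toℕ k) (winding w)) (≅-sym {winding w} e))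
  where
  lemma : ∀ d a b → a ℤ.- b ≡ d ℤ.+ a ℤ.- (d ℤ.+ b)
  lemma = solve-∀

-- Double sums, over directions and residues of winding numbers

module FiniteSums {c ℓ} (R : CommutativeRing c ℓ) where

  open CommutativeRing R renaming (refl to ≈-refl; sym to ≈-sym; trans to ≈-trans)
  open Algebra.Properties.CommutativeMonoid.Sum +-commutativeMonoid public
    using (sum; sum-cong-≋; ∑-distrib-+; ∑-comm; sum-replicate-zero)
  open Algebra.Properties.Semiring.Sum semiring using (*-distribʳ-sum)

  sum-zero : ∀ {n} (f : Vector Carrier n) → (∀ i → f i ≈ 0#) → sum f ≈ 0#
  sum-zero {n} f f≈0 = ≈-trans (sum-cong-≋ f≈0) (sum-replicate-zero n)

  sum-single : ∀ {n} (i : Fin n) (f : Vector Carrier n) → (∀ j → j ≢ i → f j ≈ 0#) → sum f ≈ f i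
  sum-single {suc n} Fin.zero    f f≈0 =
    ≈-trans (+-congˡ (sum-zero (λ j → f (Fin.suc j)) λ j → f≈0 (Fin.suc j) λ ())) (+-identityʳ _)
  sum-single {suc n} (Fin.suc i) f f≈0 = ≈-trans (+-congʳ (f≈0 Fin.zero λ ()))
    (≈-trans (+-identityˡ _) (sum-single i (λ j → f (Fin.suc j)) λ j n → f≈0 (Fin.suc j) (n ∘ Fin.suc-injective)))

  -- As a record the equation does not unfold into sums of 6 · 48 terms.

  record DoubleSum {m n} (F : Fin m → Fin n → Carrier) (s : Carrier) : Set ℓ where
    constructor double
    field total : sum (λ l → sum (F l)) ≈ s

  doubleSum-zero : ∀ {m n} (F : Fin m → Fin n → Carrier) → (∀ l k → F l k ≈ 0#) → DoubleSum F 0#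
  doubleSum-zero F e = double (sum-zero _ λ l → sum-zero (F l) (e l))

  doubleSum-cong : ∀ {m n} {F G : Fin m → Fin n → Carrier} {s} → (∀ l k → F l k ≈ G l k) → DoubleSum G s → DoubleSum F s
  doubleSum-cong e (double p) = double (≈-trans (sum-cong-≋ λ l → sum-cong-≋ (e l)) p)

  doubleSum-single : ∀ {m n} (i : Fin m) (j : Fin n) (F : Fin m → Fin n → Carrier) {s} →
                     (∀ l k → ¬ (l ≡ i × k ≡ j) → F l k ≈ 0#) → F i j ≈ s → DoubleSum F s
  doubleSum-single i j F F≈0 e = double (≈-trans
    (sum-single i (λ l → sum (F l)) λ l l≢i → sum-zero (F l) λ k → F≈0 l k (l≢i ∘ proj₁))
    (≈-trans (sum-single j (F i) λ k k≢j → F≈0 i k (k≢j ∘ proj₂)) e))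

  doubleSum-+ : ∀ {m n} (F G H : Fin m → Fin n → Carrier) {s t} → (∀ l k → F l k ≈ G l k + H l k) →
                DoubleSum G s → DoubleSum H t → DoubleSum F (s + t)
  doubleSum-+ F G H e (double p) (double q) = double (≈-trans
    (sum-cong-≋ λ l → ≈-trans (sum-cong-≋ (e l)) (∑-distrib-+ (G l) (H l)))
    (≈-trans (∑-distrib-+ (λ l → sum (G l)) (λ l → sum (H l))) (+-cong p q)))

  doubleSum-*ʳ : ∀ {m n} (F : Fin m → Fin n → Carrier) {s} r → DoubleSum F s → DoubleSum (λ l k → F l k * r) (s * r)
  doubleSum-*ʳ F r (double p) = double (≈-trans (sum-cong-≋ λ l → ≈-sym (*-distribʳ-sum r (F l)))
    (≈-trans (≈-sym (*-distribʳ-sum r (λ l → sum (F l)))) (*-congʳ p)))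

  doubleSum-sum : ∀ {m n p} (F : Fin m → Fin n → Fin p → Carrier) (s : Fin p → Carrier) →
                  (∀ i → DoubleSum (λ l k → F l k i) (s i)) → DoubleSum (λ l k → sum (F l k)) (sum s)
  doubleSum-sum F s e = double (≈-trans (sum-cong-≋ λ l → ∑-comm (F l))
    (≈-trans (∑-comm λ l i → sum (λ k → F l k i)) (sum-cong-≋ λ i → DoubleSum.total (e i))))

module Counting {c ℓ} (R : CommutativeRing c ℓ) where

  open CommutativeRing R renaming (refl to ≈-refl; sym to ≈-sym; trans to ≈-trans)
  open ListSums R
  open FiniteSums R
  open Relation.Binary.Reasoning.Setoid setoid

  -- The embedding `N` of the natural numbers and the coefficients `C` are left open, to serve
  -- twice: over ℂ with the weights of the walks, and over ℝ with all coefficients 1, for the number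
  -- of walks.
  module _ (N : ℕ → Carrier) (N-zero : N 0 ≈ 0#) (N-suc : ∀ n → N (suc n) ≈ 1# + N n)
    (f : List V → Carrier) (C : Fin 6 → Fin 48 → Carrier) (C-f : ∀ l k w → Counted l k w → C l k ≈ f w) where

    indicator : ∀ {P : Set} → Dec P → Carrier
    indicator P? = if does P? then 1# else 0#

    count : Fin 6 → Fin 48 → List (List V) → ℕ
    count l k ws = length (filter (counted? l k) ws)

    N-count : ∀ l k w ws → N (count l k (w ∷ ws)) ≈ indicator (counted? l k w) + N (count l k ws)
    N-count l k w ws with does (counted? l k w)
    ... | true  = N-suc (count l k ws)
    ... | false = ≈-sym (+-identityˡ _)

    -- A walk is counted for exactly one pair: its direction, which is less than 6, and the residue
    -- of its winding number.
    C-single : ∀ w → DoubleSum (λ l k → C l k * indicator (counted? l k w)) (f w)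
    C-single w = doubleSum-single l₀ k₀ (λ l k → C l k * indicator (counted? l k w))
      (λ l k n → uncounted l k λ (d , e) →
        n (Fin.toℕ-injective (trans (sym d) (sym l₀≡)) , Fin.toℕ-injective (trans (sym (residue k e)) (sym k₀≡))))
      (≈-trans (*-congˡ (reflexive (cong (if_then 1# else 0#) (dec-true (counted? l₀ k₀ w) counted))))
        (≈-trans (*-identityʳ _) (C-f l₀ k₀ w counted)))
      where
      l₀ : Fin 6
      l₀ = fromℕ< (direction<6 w)
      k₀ : Fin 48
      k₀ = fromℕ< (ℤ.n%ℕd<d (winding w) 48)
      l₀≡ : toℕ l₀ ≡ direction w
      l₀≡ = Fin.toℕ-fromℕ< (direction<6 w)
      k₀≡ : toℕ k₀ ≡ winding w ℤ.%ℕ 48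
      k₀≡ = Fin.toℕ-fromℕ< (ℤ.n%ℕd<d (winding w) 48)
      uncounted : ∀ l k → ¬ Counted l k w → C l k * indicator (counted? l k w) ≈ 0#
      uncounted l k n = ≈-trans
        (*-congˡ (reflexive (cong (if_then 1# else 0#) (dec-false (counted? l k w) n)))) (zeroʳ _)
      residue : ∀ k → winding w ≅ + toℕ k [mod 48 ] → winding w ℤ.%ℕ 48 ≡ toℕ k
      residue k e = trans (%-≅ {winding w} {+ toℕ k} e) (ℕ.m<n⇒m%n≡m (Fin.toℕ<n k))
      counted : Counted l₀ k₀ w
      counted = sym l₀≡ , subst (λ m → winding w ≅ + m [mod 48 ]) (sym k₀≡) (≅-% (winding w))

    Σ-counts : ∀ ws → DoubleSum (λ l k → C l k * N (count l k ws)) (Σ f ws)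
    Σ-counts []       = doubleSum-zero (λ l k → C l k * N 0) λ l k → ≈-trans (*-congˡ N-zero) (zeroʳ _)
    Σ-counts (w ∷ ws) = doubleSum-+ (λ l k → C l k * N (count l k (w ∷ ws)))
      (λ l k → C l k * indicator (counted? l k w)) (λ l k → C l k * N (count l k ws))
      (λ l k → ≈-trans (*-congˡ (N-count l k w ws)) (distribˡ _ _ _))
      (C-single w) (Σ-counts ws)

-- Generating functions

-- The equality `_∼_` may differ from that of the raw ring `A`; this allows ℂ with `_≋_` while the
-- operations are those of the statement.
module Series {c e ℓ} (A : RawRing c e) (_∼_ : Rel (RawRing.Carrier A) ℓ)
  (isCommutativeRing : IsCommutativeRing _∼_ (RawRing._+_ A) (RawRing._*_ A) (RawRing.-_ A) (RawRing.0# A) (RawRing.1# A))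
  where

  R : CommutativeRing c ℓ
  R = record { isCommutativeRing = isCommutativeRing }

  open CommutativeRing R hiding (zero) renaming (_≈_ to infix 4 _≋_; refl to ≋-refl; sym to ≋-sym; trans to ≋-trans)
  open FiniteSums R
  open ListSums R
  open Powers R
  open Algebra.Properties.Ring ring using (-0#≈0#; -‿distribˡ-*; -‿distribʳ-*; -‿involutive)
  open Algebra.Properties.Semiring.Exp semiring using (_^_; ^-congˡ; ^-assocʳ; ^-homo-*)

  module A where
    open RawRing A public
    open Algebra.Definitions.RawSemiring (RawRing.rawSemiring A) public using (_^_; sum)

  module A⟦x⟧ where
    open PowerSeries A public
    open RawRing ⟦x⟧ public
    open Algebra.Definitions.RawSemiring rawSemiring public using (sum)

  ^-≡-A : ∀ z n → z ^ n ≡ z A.^ n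
  ^-≡-A z zero    = refl
  ^-≡-A z (suc n) = cong (λ v → z * v) (^-≡-A z n)

  sum-≡ : ∀ {n} (f : Vector Carrier n) → sum f ≡ A.sum f
  sum-≡ {zero}  f = refl
  sum-≡ {suc n} f = cong (λ s → f Fin.zero + s) (sum-≡ (λ i → f (Fin.suc i)))

  A-sum-head : ∀ n (f : Vector Carrier (suc n)) → (∀ i → f (Fin.suc i) ≋ 0#) → A.sum f ≋ f Fin.zero
  A-sum-head n f f≈0 = ≋-trans (+-congˡ (≋-trans (reflexive (sym (sum-≡ (λ i → f (Fin.suc i)))))
    (sum-zero (λ i → f (Fin.suc i)) f≈0))) (+-identityʳ _)

  series-sum : ∀ {m} (F : Vector (ℕ → Carrier) m) n → A⟦x⟧.sum F n ≡ A.sum (λ i → F i n)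
  series-sum {zero}  F zero    = refl
  series-sum {zero}  F (suc n) = refl
  series-sum {suc m} F n       = cong (λ s → F Fin.zero n + s) (series-sum (λ i → F (Fin.suc i)) n)

  series-doubleSum : ∀ {m p} (F : Fin m → Fin p → ℕ → Carrier) n {s} → DoubleSum (λ l k → F l k n) s →
                     A⟦x⟧.sum (λ l → A⟦x⟧.sum (F l)) n ≋ s
  series-doubleSum F n (double e) = ≋-trans
    (reflexive (trans (series-sum (λ l → A⟦x⟧.sum (F l)) n) (sym (sum-≡ (λ l → A⟦x⟧.sum (F l) n)))))
    (≋-trans (sum-cong-≋ λ l → reflexive (trans (series-sum (F l) n) (sym (sum-≡ (λ k → F l k n))))) e)

  const-* : ∀ a g n → (A⟦x⟧.const a A⟦x⟧.* g) n ≋ a * g n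
  const-* a g n = A-sum-head n (λ i → A⟦x⟧.const a (toℕ i) * g (n ℕ.∸ toℕ i)) λ i → zeroˡ (g (n ℕ.∸ suc (toℕ i)))

  x-*-zero : ∀ g → (A⟦x⟧.x A⟦x⟧.* g) 0 ≋ 0#
  x-*-zero g = ≋-trans (+-identityʳ _) (zeroˡ (g 0))

  x-*-suc : ∀ g n → (A⟦x⟧.x A⟦x⟧.* g) (suc n) ≋ g n
  x-*-suc g n = ≋-trans (+-cong (zeroˡ (g (suc n)))
      (A-sum-head n (λ i → A⟦x⟧.x (suc (toℕ i)) * g (n ℕ.∸ toℕ i)) λ i → zeroˡ (g (n ℕ.∸ suc (toℕ i)))))
    (≋-trans (+-identityˡ _) (*-identityˡ (g n)))

  module _ (a : Carrier) where

    1+ax : ℕ → Carrier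
    1+ax = A⟦x⟧.1# A⟦x⟧.+ A⟦x⟧.const a A⟦x⟧.* A⟦x⟧.x

    1+ax-one : 1+ax 1 ≋ a
    1+ax-one = ≋-trans (+-identityˡ _) (≋-trans (const-* a A⟦x⟧.x 1) (*-identityʳ a))

    1+ax-suc : ∀ n → 1+ax (suc (suc n)) ≋ 0#
    1+ax-suc n = ≋-trans (+-identityˡ _) (≋-trans (const-* a A⟦x⟧.x (suc (suc n))) (zeroʳ a))

    inverse-suc : ∀ n → A⟦x⟧.inverse 1+ax (suc n) ≋ - (a * A⟦x⟧.inverse 1+ax n)
    inverse-suc n = -‿cong (≋-trans
      (A-sum-head n (λ i → 1+ax (suc (toℕ i)) * A⟦x⟧.inverseCoefficients 1+ax n i)
        λ i → ≋-trans (*-congʳ (1+ax-suc (toℕ i))) (zeroˡ (A⟦x⟧.inverseCoefficients 1+ax n (Fin.suc i))))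
      (*-congʳ 1+ax-one))

    -- The inverse of 1 + a x is the geometric series of ratio -a. This is the recursion of `F`, and
    -- the factor x shifts the coefficients by one.
    recursive-series : (F : ℕ → Carrier) → F 0 ≋ 0# → F 1 ≋ - 1# →
                       (∀ n → F (suc (suc n)) ≋ - a * F (suc n)) →
                       ∀ n → (A⟦x⟧.x A⟦x⟧.* A⟦x⟧.inverse 1+ax) n ≋ - F n
    recursive-series F F0 F1 Fsuc zero    =
      ≋-trans (x-*-zero (A⟦x⟧.inverse 1+ax)) (≋-sym (≋-trans (-‿cong F0) -0#≈0#))
    recursive-series F F0 F1 Fsuc (suc n) = ≋-trans (x-*-suc (A⟦x⟧.inverse 1+ax) n) (coefficients n)
      where
      coefficients : ∀ n → A⟦x⟧.inverse 1+ax n ≋ - F (suc n)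
      coefficients zero    = ≋-sym (≋-trans (-‿cong F1) (-‿involutive 1#))
      coefficients (suc n) = ≋-trans (inverse-suc n) (-‿cong (≋-trans (*-congˡ (coefficients n))
        (≋-trans (≋-sym (-‿distribʳ-* a (F (suc n)))) (≋-trans (-‿distribˡ-* a (F (suc n))) (≋-sym (Fsuc n))))))

  module Roots (ω : Carrier) (ω^24 : (ω A.^ 24) ≋ (- 1#)) (j : ℕ) (ζ y conj-z a : Carrier)
    (ω^8 : (ω A.^ 8) ≋ ζ) (ω^[6j+1] : (ω A.^ (6 ℕ.* j ℕ.+ 1)) ≋ y)
    (z*conj-z : ((ζ A.^ 4 * y) * conj-z) ≋ 1#) (z+conj-z : a ≋ (ζ A.^ 4 * y + conj-z))
    (halve : ∀ v → (v + v) ≋ 0# → v ≋ 0#)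
    (N : ℕ → Carrier) (N-zero : N 0 ≋ 0#) (N-suc : ∀ n → N (suc n) ≋ (1# + N n))
    where

    y≋ : y ≋ ω ^ (6 ℕ.* j ℕ.+ 1)
    y≋ = ≋-trans (≋-sym (ω^[6j+1])) (reflexive (sym (^-≡-A ω (6 ℕ.* j ℕ.+ 1))))

    ω^24≋ : ω ^ 24 ≋ - 1#
    ω^24≋ = ≋-trans (reflexive (^-≡-A ω 24)) ω^24

    y^24 : y ^ 24 ≋ - 1#
    y^24 = ≋-trans (^-congˡ 24 y≋) (root^24 ω ω^24≋ j)

    y^8 : y ^ 8 ≋ ζ
    y^8 = ≋-trans (^-congˡ 8 y≋) (≋-trans (root^8 ω ω^24≋ j) (≋-trans (reflexive (^-≡-A ω 8)) ω^8))

    open 48thRoot y y^24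

    yᶜ : Character R
    yᶜ = character halve

    open Observable yᶜ using (F-suc; k)
    open Observable yᶜ public using (F; F-one)
    open Character yᶜ using (χ)

    ζ^l*y^k : ∀ l k → (ζ A.^ l) * (y A.^ k) ≋ (y ^ 8) ^ l * y ^ k
    ζ^l*y^k l k = *-cong (≋-trans (reflexive (sym (^-≡-A ζ l))) (^-congˡ l (≋-sym y^8))) (reflexive (sym (^-≡-A y k)))

    C : Fin 6 → Fin 48 → Carrier
    C l k = ζ A.^ toℕ l * y A.^ toℕ k

    C-χ : ∀ l k w → Counted l k w → C l k ≋ χ (exponent w)
    C-χ l k w counted = ≋-trans (ζ^l*y^k (toℕ l) (toℕ k))
      (^-product (toℕ l) (toℕ k) (exponent w) (counted-exponent l k w counted))

    F-counts : ∀ n → DoubleSum (λ l k → C l k * N (G l k n)) (F n)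
    F-counts n = Counting.Σ-counts R N N-zero N-suc (χ ∘ exponent) C C-χ (slitSAWs n)

    z : Carrier
    z = ζ A.^ 4 * y

    z≋y^33 : z ≋ y ^ 33
    z≋y^33 = ≋-trans (*-cong (≋-trans (reflexive (sym (^-≡-A ζ 4))) (^-congˡ 4 (≋-sym y^8)))
        (≋-sym (*-identityʳ y)))
      (≋-trans (*-congʳ (^-assocʳ y 8 4)) (≋-sym (^-homo-* y 32 1)))

    z≋ω : z ≋ ω ^ (32 ℕ.+ (6 ℕ.* j ℕ.+ 1))
    z≋ω = ≋-trans (*-cong (≋-trans (reflexive (sym (^-≡-A ζ 4)))
        (≋-trans (^-congˡ 4 (≋-trans (≋-sym ω^8) (reflexive (sym (^-≡-A ω 8))))) (^-assocʳ ω 8 4))) y≋)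
      (≋-sym (^-homo-* ω 32 (6 ℕ.* j ℕ.+ 1)))

    z-seven : j ≡ 7 → z ≋ - (ω A.^ 3)
    z-seven refl = ≋-trans z≋ω (≋-trans (48thRoot.y^75 ω ω^24≋) (-‿cong (reflexive (^-≡-A ω 3))))

    -a≋k : (- a) ≋ k
    -a≋k = ≋-trans (-‿cong z+conj-z) (coefficient z≋y^33 z*conj-z)

    F-recursive : ∀ n → F (suc (suc n)) ≋ - a * F (suc n)
    F-recursive n = ≋-trans (F-suc n) (*-congʳ (≋-sym -a≋k))

    F-series : ∀ n → (A⟦x⟧.x A⟦x⟧.* A⟦x⟧.inverse (1+ax a)) n ≋ (- F n)
    F-series = recursive-series a F ≋-refl F-one F-recursive

module Phases {c ℓ₁ ℓ₂} (ℝ : RealNumbers c ℓ₁ ℓ₂) where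

  private module ℝ = RealNumbers ℝ
  open RealNumbers ℝ using (-‿cong; -‿inverseʳ; +-identityˡ)
    renaming (refl to ≈-refl; sym to ≈-sym; trans to ≈-trans)
  open Analysis ℝ
  open ComplexNumbers ℝ
  open OrderedField ℝ using (2*x≈x+x; x+x≈0⇒x≈0)
  open Series ℂ _≋_ (CommutativeRing.isCommutativeRing ℂ-commutativeRing) using (module Roots)

  conj-cong : ∀ {z w} → z ≋ w → conj z ≋ conj w
  conj-cong (equal (e , f)) = equal (e , -‿cong f)

  2Re-conj : ∀ z → fromℝ (2Re z) ≋ z ℂ.+ conj z
  2Re-conj (a +i b) = equal (2*x≈x+x a , ≈-sym (-‿inverseʳ b))

  halve : ∀ z → z ℂ.+ z ≋ ℂ.0# → z ≋ ℂ.0#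
  halve (a +i b) (equal (e , f)) = equal (x+x≈0⇒x≈0 a e , x+x≈0⇒x≈0 b f)

  Phase : Complex → Set (c ⊔ ℓ₁)
  Phase z = ∃ λ θ → z ≋ expi θ

  phase-conj : ∀ {z} → Phase z → z ℂ.* conj z ≋ ℂ.1#
  phase-conj (θ , e) = ≋-trans (ℂ-*-cong e (conj-cong e)) (expi-conj θ)

  phase-* : ∀ {z w} → Phase z → Phase w → Phase (z ℂ.* w)
  phase-* (θ , e) (φ , f) = θ ℝ.+ φ , ≋-trans (ℂ-*-cong e f) (≋-sym (expi-+ θ φ))

  phase-^ : ∀ θ n → Phase (expi θ ℂ.^ n)
  phase-^ θ n = fromℕ n ℝ.* θ , ≋-sym (expi-fromℕ n θ)

  module At (j : Fin 8) = Roots ω ω^24 (toℕ j) ζ (y j) (conj (ζ ℂ.^ 4 ℂ.* y j)) (fromℝ (2Re (ζ ℂ.^ 4 ℂ.* y j)))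
    ω^8 (ω^[6j+1] j)
    (phase-conj (phase-* (phase-^ _ 4) (_ , ≋-refl)))
    (2Re-conj (ζ ℂ.^ 4 ℂ.* y j)) halve
    (λ n → fromℝ (fromℕ n)) ≋-refl (λ n → equal (≈-refl , ≈-sym (+-identityˡ _)))

-- Divergence

module Divergence {c ℓ₁ ℓ₂} (ℝ : RealNumbers c ℓ₁ ℓ₂) where

  open RealNumbers ℝ renaming (refl to ≈-refl; sym to ≈-sym; trans to ≈-trans)
  open Analysis ℝ
  open OrderedField ℝ
  open ComplexNumbers ℝ
  open Phases ℝ
  open Series ℂ _≋_ (CommutativeRing.isCommutativeRing ℂ-commutativeRing) using (^-≡-A)
  open FiniteSums commutativeRing
  open ListSums commutativeRing using (Σ)
  open IsStrictTotalOrder isStrictTotalOrder using (compare; <-respʳ-≈; <-respˡ-≈; _<?_) renaming (trans to <-trans)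
  open Algebra.Properties.Ring ring using (-0#≈0#; -‿distribˡ-*; -‿distribʳ-*; -‿involutive; -‿+-comm)
  open Algebra.Properties.Semiring.Exp semiring using (_^_)
  open Relation.Binary.Reasoning.Setoid setoid

  -- sup {x : x = 0, or x = 1 and A} is positive if and only if A holds.

  excluded-middle : (A : Set (c ⊔ ℓ₁ ⊔ ℓ₂)) → Dec A
  excluded-middle A with sup (λ x → x ≈ 0# ⊎ (x ≈ 1# × A)) (0# , inj₁ ≈-refl)
    (1# , λ { x (inj₁ x≈0) 1<x → <⇒≤ 0<1 (<-respʳ-≈ x≈0 1<x)
            ; x (inj₂ (x≈1 , _)) 1<x → <⇒≉ 1<x (≈-sym x≈1) })
  ... | s , isUpper , isLeast with 0# <? s
  ... | yes 0<s = yes (let x , Px , 0<x = isLeast 0# 0<s in [ (λ x≈0 → contradiction (≈-sym x≈0) (<⇒≉ 0<x)) , proj₂ ]′ Px)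
  ... | no 0≮s  = no λ a → ≤-trans (isUpper 1# (inj₂ (≈-refl , a))) 0≮s 0<1

  -- Otherwise the multiples of `x` have a supremum s; some multiple exceeds s - x, and the next one
  -- exceeds s.
  archimedean : ∀ {x b} → 0# < x → ¬ (∀ n → fromℕ n * x ≤ b)
  archimedean {x} {b} 0<x bounded =
    let s , isUpper , isLeast = sup (λ z → Lift (c ⊔ ℓ₁ ⊔ ℓ₂) (∃ λ n → z ≈ fromℕ n * x))
          (0# , lift (0 , ≈-sym (zeroˡ x)))
          (b , λ { z (lift (n , e)) b<z → bounded n (<-respʳ-≈ e b<z) })
        z , lift (n , e) , s-x<z = isLeast (s - x) (s-x<s s)
    in isUpper (fromℕ (suc n) * x) (lift (suc n , ≈-refl))
         (<-respˡ-≈ (cancel s) (<-respʳ-≈ (next n e) (+-monoˡ-< x s-x<z)))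
    where
    cancel : ∀ s → s - x + x ≈ s
    cancel s = ≈-trans (+-assoc _ _ _) (≈-trans (+-congˡ (-‿inverseˡ x)) (+-identityʳ s))
    s-x<s : ∀ s → s - x < s
    s-x<s s = <-respʳ-≈ (cancel s) (0<⇒x<x+y (s - x) 0<x)
    next : ∀ {z} n → z ≈ fromℕ n * x → z + x ≈ fromℕ (suc n) * x
    next n e = ≈-trans (+-comm _ _) (≈-sym (≈-trans (distribʳ x 1# _) (+-cong (*-identityˡ x) (≈-sym e))))

  *-monoˡ-≤ : ∀ {x y z} → 0# < z → x ≤ y → x * z ≤ y * z
  *-monoˡ-≤ {x} {y} {z} 0<z x≤y yz<xz = x≤y (<-respˡ-≈ (cancel y) (<-respʳ-≈ (cancel x) (scale (0<x⁻¹ 0<z) yz<xz)))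
    where
    cancel : ∀ x → x * z * z ⁻¹ ≈ x
    cancel x = ≈-trans (*-assoc _ _ _) (≈-trans (*-congˡ (*-inverseʳ λ z≈0 → <⇒≉ 0<z (≈-sym z≈0))) (*-identityʳ x))
    add : ∀ a b → a - b + b ≈ a
    add a b = ≈-trans (+-assoc _ _ _) (≈-trans (+-congˡ (-‿inverseˡ b)) (+-identityʳ a))
    scale : ∀ {a b r} → 0# < r → a < b → a * r < b * r
    scale {a} {b} {r} 0<r a<b = <-respˡ-≈ (+-identityˡ _) (<-respʳ-≈
      (≈-trans (+-congʳ (≈-trans (distribʳ r b (- a)) (+-congˡ (≈-sym (-‿distribˡ-* a r))))) (add (b * r) (a * r)))
      (+-monoˡ-< (a * r) (*-pos (<-respˡ-≈ (-‿inverseʳ a) (+-monoˡ-< (- a) a<b)) 0<r)))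

  sum-mono-≤ : ∀ {n} {f g : Vector Carrier n} → (∀ i → f i ≤ g i) → sum f ≤ sum g
  sum-mono-≤ {zero}  f≤g = ≤-refl
  sum-mono-≤ {suc n} f≤g = +-mono-≤ (f≤g Fin.zero) (sum-mono-≤ (λ i → f≤g (Fin.suc i)))

  doubleSum-≤ : ∀ {m n} {F B : Fin m → Fin n → Carrier} {s} → (∀ l k → F l k ≤ B l k) → DoubleSum F s →
                s ≤ sum (λ l → sum (B l))
  doubleSum-≤ F≤B (double e) = ≤-trans (≈⇒≤ (≈-sym e)) (sum-mono-≤ λ l → sum-mono-≤ (F≤B l))

  fromℕ*≤sum : ∀ {n x} {f : Vector Carrier n} → (∀ i → x ≤ f i) → fromℕ n * x ≤ sum f
  fromℕ*≤sum {zero}  {x} x≤f = ≈⇒≤ (zeroˡ x)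
  fromℕ*≤sum {suc n} {x} x≤f = ≤-trans (≈⇒≤ (≈-trans (distribʳ x 1# (fromℕ n)) (+-congʳ (*-identityˡ x))))
    (+-mono-≤ (x≤f Fin.zero) (fromℕ*≤sum (λ i → x≤f (Fin.suc i))))

  0<^ : ∀ {x} → 0# < x → ∀ n → 0# < x ^ n
  0<^ 0<x zero    = 0<1
  0<^ 0<x (suc n) = *-pos 0<x (0<^ 0<x n)

  partialSum : (ℕ → ℕ) → Carrier → ℕ → Carrier
  partialSum g x N = sum {N} λ n → fromℕ (g (toℕ n)) * x ^ toℕ n

  decide : {A : Set (c ⊔ ℓ₂)} → Dec A
  decide {A} with excluded-middle (Lift (c ⊔ ℓ₁ ⊔ ℓ₂) A)
  ... | yes (lift a) = yes a
  ... | no n         = no (n ∘ lift)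

  bounded : ∀ g x → ¬ DivergesAt g x → ∃ λ b → ∀ N → partialSum g x N ≤ b
  bounded g x n with decide {∃ λ b → ∀ N → partialSum g x N ≤ b}
  ... | yes b = b
  ... | no ¬b = contradiction diverges n
    where
    diverges : DivergesAt g x
    diverges M with decide {Lift c (∃ λ N → M < partialSum g x N)}
    ... | yes (lift d) = d
    ... | no ¬d        = contradiction (M , λ N l → ¬d (lift (N , l))) ¬b

  -- If none of the finitely many series diverged, all of them would be bounded, and so would their
  -- sum. But each term of the sum from index 1 on is at least `x`.
  doubleSum-diverges : ∀ {m p} (g : Fin m → Fin p → ℕ → ℕ) (x : Carrier) (T : ℕ → Carrier) → 0# < x →
    (∀ n → DoubleSum (λ l k → fromℕ (g l k n)) (T n)) → (∀ n → x ≤ T (suc n) * x ^ suc n) → 0# ≤ T 0 * x ^ 0 →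
    ∃₂ λ l k → DivergesAt (g l k) x
  doubleSum-diverges g x T 0<x T-total x≤ 0≤ with Fin.any? (λ l → Fin.any? λ k → decide {DivergesAt (g l k) x})
  ... | yes d = d
  ... | no ¬d = contradiction unbounded (archimedean 0<x)
    where
    bound = λ l k → bounded (g l k) x λ d → ¬d (l , k , d)
    total : ∀ N → DoubleSum (λ l k → partialSum (g l k) x N) (sum {N} λ n → T (toℕ n) * x ^ toℕ n)
    total N = doubleSum-sum {p = N} (λ l k n → fromℕ (g l k (toℕ n)) * x ^ toℕ n) (λ n → T (toℕ n) * x ^ toℕ n)
      λ n → doubleSum-*ʳ (λ l k → fromℕ (g l k (toℕ n))) (x ^ toℕ n) (T-total (toℕ n))
    unbounded : ∀ N → fromℕ N * x ≤ sum (λ l → sum λ k → proj₁ (bound l k))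
    -- Among the `suc N` terms, the one of index 0 contributes only its sign, and each of the other
    -- `N` at least `x`.
    unbounded N = ≤-trans
      (≤-trans (≤-trans (fromℕ*≤sum {N} (λ n → x≤ (toℕ n))) (≈⇒≤ (≈-sym (+-identityˡ _)))) (+-mono-≤ 0≤ ≤-refl))
      (doubleSum-≤ (λ l k → proj₂ (bound l k) (suc N)) (total (suc N)))

  module ζ₇ = At 7F

  b : Carrier
  b = fromℕ 2 * cos (π / fromℕ 8)

  0<π/8 : 0# < π / fromℕ 8
  0<π/8 = *-pos 0<π (0<x⁻¹ (0<fromℕ 7))

  π/8<π/2 : π / fromℕ 8 < π/2
  π/8<π/2 = <-respʳ-≈ (begin
    π / fromℕ 8 + fromℕ 3 * (π / fromℕ 8)         ≈⟨ +-congʳ (*-identityˡ (π / fromℕ 8)) ⟨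
    1# * (π / fromℕ 8) + fromℕ 3 * (π / fromℕ 8)  ≈⟨ distribʳ (π / fromℕ 8) 1# (fromℕ 3) ⟨
    fromℕ 4 * (π / fromℕ 8)                       ≈⟨ *-assoc (fromℕ 4) π (fromℕ 8 ⁻¹) ⟨
    fromℕ 4 * π * fromℕ 8 ⁻¹                      ≈⟨ *-congʳ (*-comm (fromℕ 4) π) ⟩
    π * fromℕ 4 * fromℕ 8 ⁻¹                      ≈⟨ *-assoc π (fromℕ 4) (fromℕ 8 ⁻¹) ⟩
    π * (fromℕ 4 * fromℕ 8 ⁻¹)                    ≈⟨ *-congˡ (⁻¹-fromℕ 1 3) ⟨
    π/2                                           ∎)
    (0<⇒x<x+y (π / fromℕ 8) (*-pos (0<fromℕ 2) 0<π/8))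

  -- The axioms give signs of sines only: cos θ sin (π/2) = sin (θ + π/2), where θ + π/2 < π.
  0<cos-π/8 : 0# < cos (π / fromℕ 8)
  0<cos-π/8 = positive (<-respʳ-≈ shift-π/2 (sin-pos (θ + π/2) (0<x+y 0<π/8 0<π/2)
      (<-respʳ-≈ π/2+π/2 (+-monoˡ-< π/2 π/8<π/2))))
    where
    θ = π / fromℕ 8
    shift-π/2 : sin (θ + π/2) ≈ cos θ * sin π/2
    shift-π/2 = ≈-trans (sin-+ θ π/2) (≈-trans (+-congʳ (≈-trans (*-congˡ cos-π/2) (zeroʳ (sin θ)))) (+-identityˡ _))
    positive : 0# < cos θ * sin π/2 → 0# < cos θ
    positive 0<cs with compare 0# (cos θ)
    ... | tri< l _ _ = l
    ... | tri≈ _ e _ = contradiction (≈-trans (≈-sym (zeroˡ (sin π/2))) (*-congʳ e)) (<⇒≉ 0<cs)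
    ... | tri> _ _ g = contradiction (*-monoˡ-≤ 0<sin-π/2 (<⇒≤ g)) λ n →
      n (<-respˡ-≈ (≈-sym (zeroˡ (sin π/2))) 0<cs)

  0<b : 0# < b
  0<b = *-pos (0<fromℕ 1) 0<cos-π/8

  b*xᶜ : b * xᶜ ≈ 1#
  b*xᶜ = ≈-trans (*-congˡ (*-identityˡ (b ⁻¹))) (*-inverseʳ λ e → <⇒≉ 0<b (≈-sym e))

  0<xᶜ : 0# < xᶜ
  0<xᶜ = *-pos 0<1 (0<x⁻¹ 0<b)

  b^n*xᶜ^n : ∀ n → b ^ n * xᶜ ^ n ≈ 1#
  b^n*xᶜ^n zero    = *-identityˡ 1#
  b^n*xᶜ^n (suc n) = begin
    (b * b ^ n) * (xᶜ * xᶜ ^ n)  ≈⟨ interchange b (b ^ n) xᶜ (xᶜ ^ n) ⟩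
    (b * xᶜ) * (b ^ n * xᶜ ^ n)  ≈⟨ *-cong b*xᶜ (b^n*xᶜ^n n) ⟩
    1# * 1#                      ≈⟨ *-identityˡ 1# ⟩
    1#                           ∎
    where open Algebra.Properties.CommutativeSemigroup *-commutativeSemigroup using (interchange)

  a≋-b : fromℝ (2Re ζ₇.z) ≋ fromℝ (- b)
  a≋-b = equal (re-part (≋-trans (ζ₇.z-seven refl) (CommutativeRing.-‿cong ℂ-commutativeRing (ω^≋ 3 3τ≈π/8))) , ≈-refl)
    where
    re-part : ∀ {z} → z ≋ ℂ.- expi (π / fromℕ 8) → 2Re z ≈ - b
    re-part (equal (e , _)) = ≈-trans (*-congˡ e) (≈-sym (-‿distribʳ-* (fromℕ 2) (cos (π / fromℕ 8))))

  -- For j = 7 the ratio of the recursion is the real number `b`, starting from -1.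
  F-power : ∀ n → ζ₇.F (suc n) ≋ fromℝ (- (b ^ n))
  F-power zero    = ≋-trans ζ₇.F-one (equal (≈-refl , -0#≈0#))
  F-power (suc n) = ≋-trans (ζ₇.F-recursive n)
    (≋-trans (ℂ-*-cong (CommutativeRing.-‿cong ℂ-commutativeRing a≋-b) (F-power n))
      (equal
        ( ≈-trans (+-cong (≈-trans (*-congʳ (-‿involutive b)) (≈-sym (-‿distribʳ-* b (b ^ n))))
            (≈-trans (-‿cong (≈-trans (*-congʳ -0#≈0#) (zeroˡ 0#))) -0#≈0#)) (+-identityʳ _)
        , ≈-trans (+-cong (zeroʳ _) (≈-trans (*-congʳ -0#≈0#) (zeroˡ _))) (+-identityʳ 0#))))

  -cos≤1 : ∀ θ → - cos θ ≤ 1#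
  -cos≤1 θ 1<-cos = contradiction 1<1 (λ l → ≤-refl l)
    where
    0<-cos = <-trans 0<1 1<-cos
    square : ∀ x → - x * - x ≈ x * x
    square x = ≈-trans (≈-sym (-‿distribˡ-* x (- x))) (≈-trans (-‿cong (≈-sym (-‿distribʳ-* x x))) (-‿involutive (x * x)))
    0≤square : ∀ x → 0# ≤ x * x
    0≤square x with compare 0# x
    ... | tri< l _ _ = <⇒≤ (*-pos l l)
    ... | tri≈ _ e _ = ≈⇒≤ (≈-trans (≈-sym (zeroˡ x)) (*-congʳ e))
    ... | tri> _ _ g = <⇒≤ (<-respʳ-≈ (square x) (*-pos (x<0⇒0<-x g) (x<0⇒0<-x g)))
    1<1 : 1# < 1#
    1<1 = <-≤-trans (<-≤-trans 1<-cos
      (≤-trans (≈⇒≤ (≈-sym (*-identityˡ _))) (≤-trans (*-monoˡ-≤ 0<-cos (<⇒≤ 1<-cos)) (≈⇒≤ (square (cos θ))))))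
      (≤-trans (≈⇒≤ (≈-sym (+-identityʳ _))) (≤-trans (+-mono-≤ ≤-refl (0≤square (sin θ))) (≈⇒≤ (cos²+sin²≈1 θ))))

  walks : ℕ → Carrier
  walks n = Σ (λ _ → 1#) (slitSAWs n)

  -re-Σ≤ : ∀ {A : Set} (f : A → Complex) → (∀ x → - re (f x) ≤ 1#) → ∀ xs →
           - re (ListSums.Σ ℂ-commutativeRing f xs) ≤ Σ (λ _ → 1#) xs
  -re-Σ≤ f f≤1 []       = ≈⇒≤ -0#≈0#
  -re-Σ≤ f f≤1 (x ∷ xs) = ≤-trans (≈⇒≤ (≈-sym (-‿+-comm _ _))) (+-mono-≤ (f≤1 x) (-re-Σ≤ f f≤1 xs))

  -re-phase : ∀ {z} → Phase z → - re z ≤ 1#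
  -re-phase (θ , equal (e , _)) = ≤-trans (≈⇒≤ (-‿cong e)) (-cos≤1 θ)

  phase-χ : ∀ i → Phase (Character.χ ζ₇.yᶜ i)
  phase-χ i = subst Phase (sym (^-≡-A (y 7F) (i ℤ.%ℕ 48))) (phase-^ _ (i ℤ.%ℕ 48))

  -- The weights are on the unit circle, so each walk contributes at most 1 to the negated real part
  -- of `ζ₇.F (suc n)`, which is `b ^ n`.
  b^n≤walks : ∀ n → b ^ n ≤ walks (suc n)
  b^n≤walks n = ≤-trans (≈⇒≤ (≈-sym (≈-trans (-‿cong (proj₁ (parts (F-power n)))) (-‿involutive (b ^ n)))))
    (-re-Σ≤ (Character.χ ζ₇.yᶜ ∘ exponent) (λ w → -re-phase (phase-χ (exponent w))) (slitSAWs (suc n)))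

  xᶜ≤walks : ∀ n → xᶜ ≤ walks (suc n) * xᶜ ^ suc n
  xᶜ≤walks n = ≤-trans (≈⇒≤ (begin
    xᶜ                       ≈⟨ *-identityʳ xᶜ ⟨
    xᶜ * 1#                  ≈⟨ *-congˡ (b^n*xᶜ^n n) ⟨
    xᶜ * (b ^ n * xᶜ ^ n)    ≈⟨ x∙yz≈y∙xz xᶜ (b ^ n) (xᶜ ^ n) ⟩
    b ^ n * xᶜ ^ suc n       ∎))
    (*-monoˡ-≤ (0<^ 0<xᶜ (suc n)) (b^n≤walks n))
    where open Algebra.Properties.CommutativeSemigroup *-commutativeSemigroup using (x∙yz≈y∙xz)

  walks-G : ∀ n → DoubleSum (λ l k → fromℕ (G l k n)) (walks n)
  walks-G n = doubleSum-cong (λ l k → ≈-sym (*-identityˡ _))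
    (Counting.Σ-counts commutativeRing fromℕ ≈-refl (λ _ → ≈-refl) (λ _ → 1#) (λ _ _ → 1#) (λ _ _ _ _ → ≈-refl) (slitSAWs n))

  divergence : ∃₂ λ (l : Fin 6) (k : Fin 48) → DivergesAt (G l k) xᶜ
  divergence = doubleSum-diverges G xᶜ walks 0<xᶜ walks-G xᶜ≤walks (≈⇒≤ (≈-sym (zeroˡ (xᶜ ^ 0))))

-- Once the sum over l and k is unfolded, so are the powers of ζ and y j, and
-- comparing them is infeasible.  A proof of Exactly t passes on the term t as
-- it stands in a statement, so that it is never unfolded.

data Exactly {a} {A : Set a} (t : A) : Set where
  exactly : Exactly t

module _ {c ℓ₁ ℓ₂} (ℝ : RealNumbers c ℓ₁ ℓ₂) where

  open Analysis ℝ
  open ComplexNumbers ℝ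
  open Phases ℝ
  open Divergence ℝ using (divergence)
  open Series ℂ _≋_ (CommutativeRing.isCommutativeRing ℂ-commutativeRing) using (series-doubleSum; const-*)
  open FiniteSums ℂ-commutativeRing using (DoubleSum; doubleSum-cong)
  open ℂ⟦x⟧

  doubleSum-negated : ∀ {m p} (F : Fin m → Fin p → ℕ → Complex) n {s} → DoubleSum (λ l k → F l k n) s →
                      (- sum (λ l → sum (λ k → F l k))) n ≋ ℂ.- s
  doubleSum-negated F n d = CommutativeRing.-‿cong ℂ-commutativeRing (series-doubleSum F n d)

  left-side : ∀ j n → (x * inverse (1# + const (fromℝ (2Re (ζ ℂ.^ 4 ℂ.* y j))) * x)) n ≋ ℂ.- At.F j n
  left-side j n = At.F-series j n

  right-side-term : ∀ j l k n → (const (ζ ℂ.^ toℕ l ℂ.* y j ℂ.^ toℕ k) * fromCounts (G l k)) n ≋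
                    At.C j l k ℂ.* fromCounts (G l k) n
  right-side-term j l k n = const-* (ζ ℂ.^ toℕ l ℂ.* y j ℂ.^ toℕ k) (fromCounts (G l k)) n

  right-side : ∀ j n → DoubleSum (λ l k → (const (ζ ℂ.^ toℕ l ℂ.* y j ℂ.^ toℕ k) * fromCounts (G l k)) n) (At.F j n)
  right-side j n = doubleSum-cong {G = λ l k → At.C j l k ℂ.* fromCounts (G l k) n}
    (λ l k → right-side-term j l k n) (At.F-counts j n)

  left-series : ∀ j → Exactly (x * inverse (1# + const (fromℝ (2Re (ζ ℂ.^ 4 ℂ.* y j))) * x))
  left-series j = exactly

  right-series : ∀ j → Exactly {A = Fin 6 → Fin 48 → ℕ → Complex}
    (λ l k → const (ζ ℂ.^ toℕ l ℂ.* y j ℂ.^ toℕ k) * fromCounts (G l k))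
  right-series j = exactly

  compare-coefficients : ∀ {m p} {f h : ℕ → Complex} {F : Fin m → Fin p → ℕ → Complex} → Exactly f → Exactly F →
    (∀ n → f n ≋ ℂ.- h n) → (∀ n → DoubleSum (λ l k → F l k n) (h n)) →
    f ≈ - (sum λ l → sum λ k → F l k)
  compare-coefficients {F = F} _ _ p d n = parts (≋-trans (p n) (≋-sym (doubleSum-negated F n (d n))))

  generating-function : ∀ j →
    x * inverse (1# + const (fromℝ (2Re (ζ ℂ.^ 4 ℂ.* y j))) * x)
      ≈ - (sum λ (l : Fin 6) → sum λ (k : Fin 48) →
             const (ζ ℂ.^ toℕ l ℂ.* y j ℂ.^ toℕ k) * fromCounts (G l k))
  generating-function j =
    compare-coefficients {h = At.F j} (left-series j) (right-series j) (left-side j) (right-side j)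

  corollary6 :
    (∀ (j : Fin 8) →
      x * inverse (1# + const (fromℝ (2Re (ζ ℂ.^ 4 ℂ.* y j))) * x)
        ≈ - (sum λ (l : Fin 6) → sum λ (k : Fin 48) →
               const (ζ ℂ.^ toℕ l ℂ.* y j ℂ.^ toℕ k) * fromCounts (G l k)))
    × (∃₂ λ (l : Fin 6) (k : Fin 48) → DivergesAt (G l k) xᶜ)
  corollary6 = generating-function , divergence
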